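{- Let $n$ be a positive integer. There exists a flexible Latin directed triple system of order $n$ (a flexible LDTS($n$)) if and only if $n \equiv 0$ or $1 \pmod 3$ and $n \notin \{4, 6, 10, 12\}$.
   Context: A transitively ordered triple $\langle x,y,z\rangle$ of distinct points is regarded as containing the ordered pairs $(x,y)$, $(y,z)$, $(x,z)$. A directed triple system of order $n$, DTS($n$), is a pair $(V,\mathcal{B})$ where $V$ is a set of $n$ points and $\mathcal{B}$ is a collection of transitively ordered triples of distinct points of $V$ such that every ordered pair of distinct points of $V$ is contained in precisely one triple of $\mathcal{B}$. Given a DTS($n$), define a binary operation on $V$ by $x\cdot x=x$ and, for $x\neq y$, $x\cdot y=z$ where $z$ is the third element of the unique triple of $\mathcal{B}$ containing the ordered pair $(x,y)$. The DTS($n$) is called a Latin directed triple system, LDTS($n$), if $(V,\cdot)$ is a quasigroup, i.e. if its operation table is a Latin square. An LDTS($n$) is flexible if this quasigroup satisfies the flexible law $x\cdot(y\cdot x)=(x\cdot y)\cdot x$ for all $x,y\in V$. -}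

module Defs where

open import Algebra.Core using (Op₂)
open import Algebra.Definitions using (Flexible)
open import Algebra.Structures using (IsQuasigroup)
open import Data.Fin.Base using (Fin)
open import Data.Fin.Properties using (inj⇒≟)
open import Data.Nat.Base using (ℕ)
open import Data.Product using (Σ; ∃!; ∃₂; _×_; _,_)
open import Function.Bundles using (_↔_)
open import Function.Properties.Inverse using (↔⇒↣)
open import Level using (0ℓ)
open import Relation.Binary.Definitions using (DecidableEquality)
open import Relation.Binary.PropositionalEquality using (_≡_; _≢_)
open import Relation.Nullary.Decidable using (yes; no)
open import Relation.Unary using (Pred; _∈_)

-- Two triples with equal coordinates are propositionally equal, since
-- proofs of _≢_ are definitionally proof-irrelevant.
record Triple (V : Set) : Set where
  constructor ⟨_,_,_⟩
  field
    x y z : V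
    {x≢y} : x ≢ y
    {y≢z} : y ≢ z
    {x≢z} : x ≢ z

data Contains {V : Set} (t : Triple V) : V → V → Set where
  xy : Contains t (Triple.x t) (Triple.y t)
  yz : Contains t (Triple.y t) (Triple.z t)
  xz : Contains t (Triple.x t) (Triple.z t)

third : ∀ {V} (t : Triple V) {a b} → Contains t a b → V
third t xy = Triple.z t
third t yz = Triple.x t
third t xz = Triple.y t

-- The collection of blocks is a set of triples.  A repeated triple would
-- cover its ordered pairs twice, so multiplicities play no role.
record DTS (n : ℕ) : Set₁ where
  field
    V      : Set
    V↔Fin  : V ↔ Fin n
    𝓑      : Pred (Triple V) 0ℓ
    unique : ∀ {a b} → a ≢ b → ∃! _≡_ (λ t → t ∈ 𝓑 × Contains t a b)

  infix 4 _≟_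
  _≟_ : DecidableEquality V
  _≟_ = inj⇒≟ (↔⇒↣ V↔Fin)

  infixl 7 _·_
  _·_ : Op₂ V
  a · b with a ≟ b
  ... | yes _  = a
  ... | no a≢b with unique a≢b
  ...   | t , (_ , ab∈t) , _ = third t ab∈t

  IsLatin : Set
  IsLatin = ∃₂ λ (_\\_ _//_ : Op₂ V) → IsQuasigroup _≡_ _·_ _\\_ _//_

  IsFlexible : Set
  IsFlexible = Flexible _≡_ _·_

FlexibleLDTS : ℕ → Set₁
FlexibleLDTS n = Σ (DTS n) λ D → DTS.IsLatin D × DTS.IsFlexible D

{-# OPTIONS --safe #-}

-- A flexible LDTS(n) amounts to a decomposition of the edges of Kₙ into triangles,
-- each carrying a triple in both directions, and bipyramids: the join of a cycle
-- x₀ , … , xₖ₋₁ with k ≥ 3 and two poles y and c, carrying the triples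
-- ⟨ xᵢ , y , xᵢ₊₁ ⟩ and ⟨ xᵢ₊₁ , c , xᵢ ⟩.
--
-- Such decompositions can be doubled, from order s to 2 s + 1, and tripled, from
-- order s to 3 s - 2 e: three copies of a system share a hole of e points, and a
-- Latin square of order s - e covers the remaining edges by triangles.  With e in
-- {0 , 1 , 3 , 4} and finitely many small systems this reaches every order claimed.
--
-- Conversely, the triples cover n (n - 1) pairs, so n ≢ 2 (mod 3).  If n is even,
-- every point y has odd degree, so the rims of the bipyramids with pole y contain
-- an odd number p ≥ 3 of points.  With t the number of edges at y in triangles,
-- the sum of 3 p + t over all points is n (n - 1), which excludes 4, 6 and 10.
-- For n = 12 the sum leaves so little room that a short case analysis, starting
-- from a bipyramid with a rim of length at least 4 or from a triangle, leads to a
-- contradiction; if there is neither, then every p is divisible by 3, so p = 3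
-- throughout and the sum is too small.
module Submission where

open import Defs
open import Data.Nat using (ℕ; NonZero; _%_)
open import Data.List using ([]; _∷_)
open import Data.List.Membership.Propositional using (_∉_)
open import Data.Product using (_×_)
open import Data.Sum using (_⊎_)
open import Function.Bundles using (_⇔_)
open import Relation.Binary.PropositionalEquality using (_≡_)

open import Algebra.Core using (Op₂)
open import Algebra.Structures using (IsQuasigroup)
open import Data.Bool.Base using (Bool; true; false; T; not; _∧_; _∨_; _xor_; if_then_else_)
open import Data.Bool.Properties using (T-∧; T-∨; not-involutive; xor-comm)
open import Data.Empty using (⊥)
open import Data.Fin.Base using (Fin; zero; suc; toℕ; fromℕ<; splitAt; join)
open import Data.Fin.Properties using (toℕ-fromℕ<; toℕ-injective; toℕ<n; toℕ-↑ʳ; toℕ-↑ˡ; splitAt-join; join-splitAt; +↔⊎; *↔×; 2↔Bool; 1↔⊤; any?; injective⇒≤; suc-injective) renaming (_≟_ to _≟ᶠ_)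
open import Data.List.Base using (List; map; concatMap; foldr; replicate; upTo; _++_; cartesianProduct; length; lookup)
open import Data.List.Membership.Propositional using (_∈_)
open import Data.List.Membership.Propositional.Properties using (∈-cartesianProduct⁺; ∈-upTo⁺)
open import Data.List.Relation.Unary.All using (All; []; _∷_)
open import Data.List.Relation.Unary.AllPairs using ([]; _∷_)
open import Data.List.Relation.Unary.Any using (here; there)
open import Data.List.Relation.Unary.Unique.Propositional using (Unique)
open import Data.Maybe.Base using (Maybe; just; nothing; _>>=_)
open import Data.Nat.Base using (zero; suc; _+_; _*_; _∸_; _/_; _⊓_; _⊔_; _≤_; _<_; z≤n; s≤s; s≤s⁻¹; s<s⁻¹; nonZero; ≢-nonZero⁻¹; _≡ᵇ_; _<ᵇ_; _≤ᵇ_)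
open import Data.Nat.DivMod using (_mod_; m%n<n; m<n⇒m%n≡m; [m+kn]%n≡m%n; m≡m%n+[m/n]*n; m*n%n≡0)
open import Data.Nat.Induction using (<-rec)
open import Data.Nat.Properties hiding (_≟_; suc-injective)
import Data.Nat.Properties as ℕ
open import Data.Nat.Tactic.RingSolver using (solve-∀)
open import Data.Product using (Σ; _,_; proj₁; proj₂; map₂; ∃; ∃!; uncurry)
open import Data.Product.Function.NonDependent.Propositional using (_×-↔_)
open import Data.Product.Properties using (,-injectiveˡ; ,-injectiveʳ)
open import Data.Sum.Base using (inj₁; inj₂; [_,_]′)
import Data.Sum.Base as Sum
open import Data.Sum.Function.Propositional using (_⊎-↔_)
open import Data.Unit.Base using (⊤; tt)
open import Function.Base using (const; _∘_)
open import Function.Bundles using (_↔_; Inverse; Equivalence; mk↔ₛ′; mk⇔)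
open import Function.Properties.Inverse using (↔-refl; ↔-sym; ↔-trans)
open import Relation.Binary.Definitions using (DecidableEquality)
open import Relation.Binary.PropositionalEquality using (_≢_; refl; sym; trans; cong; cong₂; subst; subst₂; isEquivalence; ≢-sym; module ≡-Reasoning)
open import Relation.Nullary using (¬_; yes; no; does; contradiction)
open import Relation.Nullary.Decidable using (decidable-stable)
import Algebra.Properties.CommutativeMonoid.Sum as Sums
open Sums +-0-commutativeMonoid using (sum; sum-cong-≗; ∑-distrib-+; ∑-comm)

-- Why such decompositions: for a triple ⟨ x , y , z ⟩ the Latin property forces a next triple ⟨ z ,
-- y , u ⟩ and a previous one with the same middle point, so these triples close up to cycles.
-- Flexibility then makes (z , x) the outer pair of a triple ⟨ z , c , x ⟩ and keeps c constant
-- along the cycle. All of this is local: `Closed` mentions four triples and no rim or length, so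
-- each construction and each explicit system only has to verify a condition on a table of pairs.
-- The obstacle for even orders is that 4, 6, 10 and 12 are missing. A hole of four points can never
-- be filled, yet 18 v + 4 = 3 (6 v + 4) - 8 is reached over such a hole, so systems with holes have
-- to be carried through the recursion. Explicit systems are needed for those even orders whose
-- tripling would start from order 6, 10 or 12. The case analysis for order 12 is carried out by a
-- verified program that replays a prescribed tree of cases.

data Role : Set where
  XY YZ XZ : Role

-- cell a b = (r , z): in the triple covering (a , b) this pair has role r, and
-- z is the third point.
Cells : Set → Set
Cells V = V → V → Role × V

module _ {V : Set} (D : V → V → Set) (cell : Cells V) where

  record Block (x y z : V) : Set where
    constructor block
    field
      Dxy : D x y
      Dyz : D y z
      Dxz : D x z
      cxy : cell x y ≡ (XY , z)
      cyz : cell y z ≡ (YZ , x)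
      cxz : cell x z ≡ (XZ , y)

  -- In a flexible system the triples ⟨ xᵢ , y , xᵢ₊₁ ⟩ with a given middle
  -- point form cycles, and each cycle has a second pole c with triples
  -- ⟨ xᵢ₊₁ , c , xᵢ ⟩.
  record Closed (x y z : V) : Set where
    constructor closed
    field
      {pole next} : V
      self  : Block x y z
      fwd   : Block z y next
      back  : Block z pole x
      shift : Block next pole z

  data Covered (a b : V) : Set where
    asXY : ∀ {z} → Closed a b z → Covered a b
    asYZ : ∀ {z} → Closed z a b → Covered a b
    asXZ : ∀ {z} → Closed a z b → Covered a b

module _ {V W : Set} {D : V → V → Set} {E : W → W → Set} {cell : Cells V} {cell′ : Cells W}
         (e : V → W)
         (hom : ∀ {a b} → D a b → E (e a) (e b) × cell′ (e a) (e b) ≡ map₂ e (cell a b)) where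

  private
    image : ∀ {a b r z} → D a b → cell a b ≡ (r , z) → cell′ (e a) (e b) ≡ (r , e z)
    image d eq = trans (proj₂ (hom d)) (cong (map₂ e) eq)

  Block-map : ∀ {x y z} → Block D cell x y z → Block E cell′ (e x) (e y) (e z)
  Block-map (block d₁ d₂ d₃ p q r) =
    block (proj₁ (hom d₁)) (proj₁ (hom d₂)) (proj₁ (hom d₃)) (image d₁ p) (image d₂ q) (image d₃ r)

  Closed-map : ∀ {x y z} → Closed D cell x y z → Closed E cell′ (e x) (e y) (e z)
  Closed-map (closed s f b h) = closed (Block-map s) (Block-map f) (Block-map b) (Block-map h)

  -- `Closed` speaks only of entries of the table at pairs in D. A piece of a larger system can
  -- therefore be verified on its own, as long as the two tables agree on the pairs of the piece.
  Covered-map : ∀ {a b} → Covered D cell a b → Covered E cell′ (e a) (e b)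
  Covered-map (asXY c) = asXY (Closed-map c)
  Covered-map (asYZ c) = asYZ (Closed-map c)
  Covered-map (asXZ c) = asXZ (Closed-map c)

-- Pairs inside the hole H are not covered.
Off : {V : Set} (H : V → Set) → V → V → Set
Off H a b = a ≢ b × ¬ (H a × H b)

record System (V : Set) (H : V → Set) : Set where
  field
    cell  : Cells V
    cover : ∀ {a b} → Off H a b → Covered (Off H) cell a b

∅ : {V : Set} → V → Set
∅ _ = ⊥

off : {V : Set} {a b : V} → a ≢ b → Off ∅ a b
off a≢b = a≢b , proj₁

module _ {V : Set} {D : V → V → Set} {cell : Cells V} where

  -- Applying Closed to ⟨ z , c , x ⟩ goes around the cycle backwards, since its
  -- second pole is y by uniqueness for (x , z).
  Closed-prev : (∀ {a b} → D a b → Covered D cell a b) → ∀ {x y z} → Block D cell x y z →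
                let c = proj₂ (cell z x) ; w = proj₂ (cell x c) in
                Block D cell w y x × Block D cell z c x × Block D cell x c w
  Closed-prev cover {x} {y} {z} b with cover (Block.Dxy b)
  ... | asYZ c = contradiction (trans (sym (Block.cxy b)) (Block.cyz (Closed.self c))) λ ()
  ... | asXZ c = contradiction (trans (sym (Block.cxy b)) (Block.cxz (Closed.self c))) λ ()
  ... | asXY c with ,-injectiveʳ (trans (sym (Block.cxy b)) (Block.cxy (Closed.self c)))
  ...   | refl with cover (Block.Dxy (Closed.back c))
  ...     | asYZ c′ = contradiction (trans (sym (Block.cxy (Closed.back c))) (Block.cyz (Closed.self c′))) λ ()
  ...     | asXZ c′ = contradiction (trans (sym (Block.cxy (Closed.back c))) (Block.cxz (Closed.self c′))) λ ()
  ...     | asXY c′ with ,-injectiveʳ (trans (sym (Block.cxy (Closed.back c))) (Block.cxy (Closed.self c′)))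
  ...       | refl with ,-injectiveʳ (trans (sym (Block.cxz b)) (Block.cxz (Closed.back c′)))
  ...         | refl
    rewrite Block.cxz (Closed.back c) | Block.cxy (Closed.fwd c′)
    = Closed.shift c′ , Closed.back c , Closed.fwd c′

  -- A pair has one role and one third point in the table, so the closed triple that covers (x , y)
  -- is the given triple itself.
  Closed-next : (∀ {a b} → D a b → Covered D cell a b) → ∀ {x y z} → Block D cell x y z →
                let c = proj₂ (cell z x) ; u = proj₂ (cell z y) in
                Block D cell z y u × Block D cell z c x × Block D cell u c z
  Closed-next cover b with cover (Block.Dxy b)
  ... | asYZ c = contradiction (trans (sym (Block.cxy b)) (Block.cyz (Closed.self c))) λ ()
  ... | asXZ c = contradiction (trans (sym (Block.cxy b)) (Block.cxz (Closed.self c))) λ ()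
  ... | asXY c with ,-injectiveʳ (trans (sym (Block.cxy b)) (Block.cxy (Closed.self c)))
  ...   | refl rewrite Block.cxz (Closed.back c) | Block.cxy (Closed.fwd c)
    = Closed.fwd c , Closed.back c , Closed.shift c

-- From a system to a flexible LDTS

module ToLDTS {n : ℕ} {V : Set} (V↔Fin : V ↔ Fin n) (S : System V ∅) where
  open System S
  private
    B : V → V → V → Set
    B = Block (Off ∅) cell

    op : V → V → V
    op a b = proj₂ (cell a b)

  design : DTS n
  design = record
    { V = V
    ; V↔Fin = V↔Fin
    ; 𝓑 = λ t → B (Triple.x t) (Triple.y t) (Triple.z t)
    ; unique = λ a≢b → unique (cover (off a≢b))
    }
    where
    triple : ∀ {x y z} → B x y z → Triple V
    triple {x} {y} {z} b = ⟨_,_,_⟩ x y z {proj₁ (Block.Dxy b)} {proj₁ (Block.Dyz b)} {proj₁ (Block.Dxz b)}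

    same : ∀ {x y z x′ y′ z′ : V} {p q r p′ q′ r′} → x ≡ x′ → y ≡ y′ → z ≡ z′ →
           ⟨_,_,_⟩ x y z {p} {q} {r} ≡ ⟨_,_,_⟩ x′ y′ z′ {p′} {q′} {r′}
    same refl refl refl = refl

    clash : ∀ {a b : V} {r s : Role} {x y : V} → cell a b ≡ (r , x) → cell a b ≡ (s , y) → r ≡ s
    clash p q = ,-injectiveˡ (trans (sym p) q)

    agree : ∀ {a b : V} {r : Role} {x y : V} → cell a b ≡ (r , x) → cell a b ≡ (r , y) → x ≡ y
    agree p q = ,-injectiveʳ (trans (sym p) q)

    unique : ∀ {a b} → Covered (Off ∅) cell a b →
             ∃! _≡_ (λ t → B (Triple.x t) (Triple.y t) (Triple.z t) × Contains t a b)
    unique (asXY c) = triple s , (s , xy) , λ where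
        (s′ , xy) → same refl refl (agree (Block.cxy s) (Block.cxy s′))
        (s′ , yz) → contradiction (clash (Block.cxy s) (Block.cyz s′)) λ ()
        (s′ , xz) → contradiction (clash (Block.cxy s) (Block.cxz s′)) λ ()
      where s = Closed.self c
    unique (asYZ c) = triple s , (s , yz) , λ where
        (s′ , xy) → contradiction (clash (Block.cyz s) (Block.cxy s′)) λ ()
        (s′ , yz) → same (agree (Block.cyz s) (Block.cyz s′)) refl refl
        (s′ , xz) → contradiction (clash (Block.cyz s) (Block.cxz s′)) λ ()
      where s = Closed.self c
    unique (asXZ c) = triple s , (s , xz) , λ where
        (s′ , xy) → contradiction (clash (Block.cxz s) (Block.cxy s′)) λ ()
        (s′ , yz) → contradiction (clash (Block.cxz s) (Block.cyz s′)) λ ()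
        (s′ , xz) → same refl (agree (Block.cxz s) (Block.cxz s′)) refl
      where s = Closed.self c

  open DTS design using (_·_; _≟_)

  private
    ·-cell : ∀ {a b r z} → a ≢ b → cell a b ≡ (r , z) → a · b ≡ z
    ·-cell {a} {b} a≢b eq with a ≟ b
    ... | yes a≡b = contradiction a≡b a≢b
    ... | no  a≢b′ with DTS.unique design a≢b′
    ...   | _ , (s , xy) , _ = ,-injectiveʳ (trans (sym (Block.cxy s)) eq)
    ...   | _ , (s , yz) , _ = ,-injectiveʳ (trans (sym (Block.cyz s)) eq)
    ...   | _ , (s , xz) , _ = ,-injectiveʳ (trans (sym (Block.cxz s)) eq)

    ·-idem : ∀ a → a · a ≡ a
    ·-idem a with a ≟ a
    ... | yes _  = refl
    ... | no a≢a = contradiction refl a≢a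

    ·xy : ∀ {x y z} → B x y z → x · y ≡ z
    ·xy s = ·-cell (proj₁ (Block.Dxy s)) (Block.cxy s)
    ·yz : ∀ {x y z} → B x y z → y · z ≡ x
    ·yz s = ·-cell (proj₁ (Block.Dyz s)) (Block.cyz s)
    ·xz : ∀ {x y z} → B x y z → x · z ≡ y
    ·xz s = ·-cell (proj₁ (Block.Dxz s)) (Block.cxz s)

    next : ∀ {x y z} → B x y z → B z y (op z y)
    next s = proj₁ (Closed-next cover s)
    prev : ∀ {x y z} → B x y z → B (op x (op z x)) y x
    prev s = proj₁ (Closed-prev cover s)

    ≡⊎covered : ∀ x y → x ≡ y ⊎ Covered (Off ∅) cell x y
    ≡⊎covered x y with x ≟ y
    ... | yes p = inj₁ p
    ... | no p  = inj₂ (cover (off p))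

    pick : Role → V → V → V
    pick XY u v = u
    pick YZ u v = v
    pick XZ u v = u

    pick′ : Role → V → V → V
    pick′ XY u v = v
    pick′ YZ u v = u
    pick′ XZ u v = u

    -- If x comes first in the triple of (x , z), its third point w solves x · w = z. If x is the
    -- middle point, w is the rim point after z in the cycle around x.
    _⧵_ : Op₂ V
    x ⧵ z with x ≟ z
    ... | yes _ = x
    ... | no  _ = pick (proj₁ (cell x z)) (op x z) (op z x)

    -- Only when y is the middle point of the triple of (z , y) is the solution of w · y = z not the
    -- third point: then w is the rim point before z, reached through the second pole as in
    -- `Closed-prev`.
    _⧸_ : Op₂ V
    z ⧸ y with z ≟ y
    ... | yes _ = z
    ... | no  _ = pick′ (proj₁ (cell z y)) (op z y) (op z (op (op z y) z))

    ⧵-cell : ∀ {x z r w} → x ≢ z → cell x z ≡ (r , w) → x ⧵ z ≡ pick r w (op z x)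
    ⧵-cell {x} {z} x≢z eq with x ≟ z
    ... | yes x≡z = contradiction x≡z x≢z
    ... | no _ rewrite eq = refl

    ⧸-cell : ∀ {z y r w} → z ≢ y → cell z y ≡ (r , w) → z ⧸ y ≡ pick′ r w (op z (op w z))
    ⧸-cell {z} {y} z≢y eq with z ≟ y
    ... | yes z≡y = contradiction z≡y z≢y
    ... | no _ rewrite eq = refl

    ⧵-idem : ∀ a → a ⧵ a ≡ a
    ⧵-idem a with a ≟ a
    ... | yes _  = refl
    ... | no a≢a = contradiction refl a≢a

    ⧸-idem : ∀ a → a ⧸ a ≡ a
    ⧸-idem a with a ≟ a
    ... | yes _  = refl
    ... | no a≢a = contradiction refl a≢a

    ·-⧵ : ∀ x z → x · (x ⧵ z) ≡ z
    ·-⧵ x z with x ≟ z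
    ... | yes refl = ·-idem x
    ... | no x≢z with cover (off x≢z)
    ...   | asXY c rewrite Block.cxy (Closed.self c) = ·xz (Closed.self c)
    ...   | asXZ c rewrite Block.cxz (Closed.self c) = ·xy (Closed.self c)
    ...   | asYZ c rewrite Block.cyz (Closed.self c) = ·yz (next (Closed.self c))

    ⧸-· : ∀ y z → (z ⧸ y) · y ≡ z
    ⧸-· y z with z ≟ y
    ... | yes refl = ·-idem z
    ... | no z≢y with cover (off z≢y)
    ...   | asXY c rewrite Block.cxy (Closed.self c) = ·xy (prev (Closed.self c))
    ...   | asXZ c rewrite Block.cxz (Closed.self c) = ·yz (Closed.self c)
    ...   | asYZ c rewrite Block.cyz (Closed.self c) = ·xz (Closed.self c)

    ⧵-· : ∀ x y → x ⧵ (x · y) ≡ y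
    ⧵-· x y with ≡⊎covered x y
    ... | inj₁ refl = trans (cong (x ⧵_) (·-idem x)) (⧵-idem x)
    ... | inj₂ (asXY c) = trans (cong (x ⧵_) (·xy s)) (⧵-cell (proj₁ (Block.Dxz s)) (Block.cxz s))
      where s = Closed.self c
    ... | inj₂ (asXZ c) = trans (cong (x ⧵_) (·xz s)) (⧵-cell (proj₁ (Block.Dxy s)) (Block.cxy s))
      where s = Closed.self c
    ... | inj₂ (asYZ c) = trans (cong (x ⧵_) (·yz s))
        (trans (⧵-cell (proj₁ (Block.Dyz p)) (Block.cyz p)) (cong proj₂ (Block.cxy s)))
      where s = Closed.self c ; p = prev s

    ·-⧸ : ∀ y z → (z · y) ⧸ y ≡ z
    ·-⧸ y z with z ≟ y
    ... | yes refl = ⧸-idem z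
    ... | no z≢y with DTS.unique design z≢y
    ...   | _ , (s , xy) , _ = trans (⧸-cell (proj₁ (Block.Dxy t)) (Block.cxy t))
                                 (,-injectiveʳ (trans (sym (Block.cyz (prev t))) (Block.cyz s)))
            where t = next s
    ...   | _ , (s , yz) , _ = ⧸-cell (proj₁ (Block.Dxz s)) (Block.cxz s)
    ...   | _ , (s , xz) , _ = ⧸-cell (proj₁ (Block.Dyz s)) (Block.cyz s)

  open ≡-Reasoning

  isLatin : DTS.IsLatin design
  isLatin = _⧵_ , _⧸_ , record
    { isMagma = record { isEquivalence = isEquivalence ; ∙-cong = cong₂ _·_ }
    ; \\-cong = cong₂ _⧵_
    ; //-cong = cong₂ _⧸_
    ; leftDivides = ·-⧵ , ⧵-·
    ; rightDivides = ⧸-· , ·-⧸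
    }

  -- The common value of both sides depends on the role of (x , y): the second pole if it is XY, y
  -- itself if it is YZ, and the rim point before x if it is XZ.
  isFlexible : DTS.IsFlexible design
  isFlexible x y with ≡⊎covered x y
  ... | inj₁ refl = cong₂ _·_ (·-idem x) (sym (·-idem x)) 
  ... | inj₂ (asXY c) = begin
      (x · y) · x ≡⟨ cong (_· x) (·xy s) ⟩
      _ · x       ≡⟨ ·xz q ⟩
      _           ≡⟨ ·xz r ⟨
      x · _       ≡⟨ cong (x ·_) (·yz p) ⟨
      x · (y · x) ∎
    where s = Closed.self c
          p = proj₁ (Closed-prev cover s)
          q = proj₁ (proj₂ (Closed-prev cover s))
          r = proj₂ (proj₂ (Closed-prev cover s))
  ... | inj₂ (asYZ c) = begin
      (x · y) · x ≡⟨ cong (_· x) (·yz s) ⟩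
      _ · x       ≡⟨ ·xy s ⟩
      y           ≡⟨ ·yz t ⟨
      x · _       ≡⟨ cong (x ·_) (·xy t) ⟨
      x · (y · x) ∎
    where s = Closed.self c
          t = next s
  ... | inj₂ (asXZ c) = begin
      (x · y) · x ≡⟨ cong (_· x) (·xz s) ⟩
      _ · x       ≡⟨ ·yz p ⟩
      _           ≡⟨ ·xy r ⟨
      x · _       ≡⟨ cong (x ·_) (·xz q) ⟨
      x · (y · x) ∎
    where s = Closed.self c
          p = proj₁ (Closed-prev cover s)
          q = proj₁ (proj₂ (Closed-prev cover s))
          r = proj₂ (proj₂ (Closed-prev cover s))

  flexibleLDTS : FlexibleLDTS n
  flexibleLDTS = design , isLatin , isFlexible

-- From designs to cells and back

transport : ∀ {V W : Set} {H : V → Set} {K : W → Set} (f : V ↔ W) →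
            (∀ v → H v → K (Inverse.to f v)) →
            (∀ {a b} → Off H a b → Off K (Inverse.to f a) (Inverse.to f b)) →
            System V H → System W K
transport {H = H} {K} f grow keep S = record { cell = cell′ ; cover = cover′ }
  where
  open System S
  open Inverse f using (to; from; strictlyInverseˡ; strictlyInverseʳ)

  cell′ : Cells _
  cell′ a b = let r , z = cell (from a) (from b) in r , to z

  off-from : ∀ {a b} → Off K a b → Off H (from a) (from b)
  off-from {a} {b} (a≢b , ¬K) =
    (λ eq → a≢b (trans (sym (strictlyInverseˡ a)) (trans (cong to eq) (strictlyInverseˡ b)))) ,
    (λ (h , h′) → ¬K (subst K (strictlyInverseˡ a) (grow _ h) , subst K (strictlyInverseˡ b) (grow _ h′)))

  hom : ∀ {a b} → Off H a b →
        Off K (to a) (to b) × cell′ (to a) (to b) ≡ (let r , z = cell a b in r , to z)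
  hom {a} {b} d = keep d , cong₂ (λ p q → let r , z = cell p q in r , to z) (strictlyInverseʳ a) (strictlyInverseʳ b)

  cover′ : ∀ {a b} → Off K a b → Covered (Off K) cell′ a b
  cover′ {a} {b} d = subst₂ (Covered (Off K) cell′) (strictlyInverseˡ a) (strictlyInverseˡ b)
                       (Covered-map to hom (cover (off-from d)))

Off-to : ∀ {V W : Set} {H : V → Set} {K : W → Set} (f : V ↔ W) →
         (∀ v → K (Inverse.to f v) → H v) →
         ∀ {a b} → Off H a b → Off K (Inverse.to f a) (Inverse.to f b)
Off-to f shrink {a} {b} (a≢b , ¬H) =
  (λ eq → a≢b (trans (sym (strictlyInverseʳ a)) (trans (cong from eq) (strictlyInverseʳ b)))) ,
  (λ (k , k′) → ¬H (shrink a k , shrink b k′))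
  where open Inverse f using (from; strictlyInverseʳ)

relocate : ∀ {V W : Set} {H : V → Set} {K : W → Set} (f : V ↔ W) →
           (∀ v → H v → K (Inverse.to f v)) → (∀ v → K (Inverse.to f v) → H v) →
           System V H → System W K
relocate {K = K} f grow shrink = transport f grow (Off-to {K = K} f shrink)

module FromLDTS {n : ℕ} (design : DTS n) (latin : DTS.IsLatin design) (flexible : DTS.IsFlexible design) where
  open DTS design
  private
    _⧵_ = proj₁ latin
    _⧸_ = proj₁ (proj₂ latin)
    open IsQuasigroup (proj₂ (proj₂ latin)) using (leftDividesˡ; rightDividesˡ)

    role : ∀ {t : Triple V} {a b} → Contains t a b → Role
    role xy = XY
    role yz = YZ
    role xz = XZ

    cell : Cells V
    cell a b with a ≟ b
    ... | yes _ = XY , a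
    ... | no a≢b with unique a≢b
    ...   | t , (_ , ab∈t) , _ = role ab∈t , third t ab∈t

    B : V → V → V → Set
    B x y z = Σ (x ≢ y) λ p → Σ (y ≢ z) λ q → Σ (x ≢ z) λ r → 𝓑 (⟨ x , y , z ⟩ {p} {q} {r})

    Contains-irrelevant : ∀ {t : Triple V} {a b} (p q : Contains t a b) → p ≡ q
    Contains-irrelevant xy xy = refl
    Contains-irrelevant {⟨ _ , _ , _ ⟩ {p} {q} {r}} xy yz = contradiction refl p
    Contains-irrelevant {⟨ _ , _ , _ ⟩ {p} {q} {r}} xy xz = contradiction refl q
    Contains-irrelevant {⟨ _ , _ , _ ⟩ {p} {q} {r}} yz xy = contradiction refl p
    Contains-irrelevant yz yz = refl
    Contains-irrelevant {⟨ _ , _ , _ ⟩ {p} {q} {r}} yz xz = contradiction refl p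
    Contains-irrelevant {⟨ _ , _ , _ ⟩ {p} {q} {r}} xz xy = contradiction refl q
    Contains-irrelevant {⟨ _ , _ , _ ⟩ {p} {q} {r}} xz yz = contradiction refl p
    Contains-irrelevant xz xz = refl

    cell-∈ : ∀ {t a b} → a ≢ b → 𝓑 t → (p : Contains t a b) → cell a b ≡ (role p , third t p)
    cell-∈ {t} {a} {b} a≢b t∈𝓑 p with a ≟ b
    ... | yes a≡b = contradiction a≡b a≢b
    ... | no  a≢b with unique a≢b
    ...   | t′ , (_ , p′) , uniq with uniq (t∈𝓑 , p)
    ...     | refl with Contains-irrelevant p p′
    ...       | refl = refl

    cell-xy : ∀ {x y z} → B x y z → cell x y ≡ (XY , z)
    cell-xy (p , _ , _ , t) = cell-∈ p t xy
    cell-yz : ∀ {x y z} → B x y z → cell y z ≡ (YZ , x)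
    cell-yz (_ , q , _ , t) = cell-∈ q t yz
    cell-xz : ∀ {x y z} → B x y z → cell x z ≡ (XZ , y)
    cell-xz (_ , _ , r , t) = cell-∈ r t xz

    ·-cell : ∀ {a b} → a ≢ b → a · b ≡ proj₂ (cell a b)
    ·-cell {a} {b} a≢b with a ≟ b
    ... | yes a≡b = contradiction a≡b a≢b
    ... | no  a≢b with unique a≢b
    ...   | _ , (_ , xy) , _ = refl
    ...   | _ , (_ , yz) , _ = refl
    ...   | _ , (_ , xz) , _ = refl

    ·-idem : ∀ a → a · a ≡ a
    ·-idem a with a ≟ a
    ... | yes _  = refl
    ... | no a≢a = contradiction refl a≢a

    ·xy : ∀ {x y z} → B x y z → x · y ≡ z
    ·xy b = trans (·-cell (proj₁ b)) (cong proj₂ (cell-xy b))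
    ·yz : ∀ {x y z} → B x y z → y · z ≡ x
    ·yz b = trans (·-cell (proj₁ (proj₂ b))) (cong proj₂ (cell-yz b))
    ·xz : ∀ {x y z} → B x y z → x · z ≡ y
    ·xz b = trans (·-cell (proj₁ (proj₂ (proj₂ b)))) (cong proj₂ (cell-xz b))

    data Cases (a b c : V) : Set where
      isXY : B a b c → Cases a b c
      isYZ : B c a b → Cases a b c
      isXZ : B a c b → Cases a b c

    cases : ∀ {a b c} → a ≢ b → a · b ≡ c → Cases a b c
    cases {a} {b} a≢b refl with a ≟ b
    ... | yes a≡b = contradiction a≡b a≢b
    ... | no  a≢b with unique a≢b
    ...   | ⟨ _ , _ , _ ⟩ {p} {q} {r} , (t , xy) , _ = isXY (p , q , r , t)
    ...   | ⟨ _ , _ , _ ⟩ {p} {q} {r} , (t , yz) , _ = isYZ (p , q , r , t)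
    ...   | ⟨ _ , _ , _ ⟩ {p} {q} {r} , (t , xz) , _ = isXZ (p , q , r , t)

    clash : ∀ {a b r s} {c d : V} → cell a b ≡ (r , c) → cell a b ≡ (s , d) → r ≡ s
    clash p q = ,-injectiveˡ (trans (sym p) q)

    agree : ∀ {a b r s} {c d : V} → cell a b ≡ (r , c) → cell a b ≡ (s , d) → c ≡ d
    agree p q = ,-injectiveʳ (trans (sym p) q)

    -- Solve y · u = z. The pair (y , z) already has role YZ, and the only position of (y , u) that
    -- does not give it another role is in ⟨ z , y , u ⟩.
    next : ∀ {x y z} → B x y z → ∃ λ u → B z y u
    next {x} {y} {z} b@(_ , y≢z , _) = u , B-zyu
      where
      u = y ⧵ z
      yu≡z : y · u ≡ z
      yu≡z = leftDividesˡ y z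
      y≢u : y ≢ u
      y≢u eq = y≢z (trans (sym (·-idem y)) (trans (cong (y ·_) eq) yu≡z))
      B-zyu : B z y u
      B-zyu with cases y≢u yu≡z
      ... | isXY c = contradiction (clash (cell-yz b) (cell-xz c)) λ ()
      ... | isYZ c = c
      ... | isXZ c = contradiction (clash (cell-yz b) (cell-xy c)) λ ()

    prev : ∀ {x y z} → B x y z → ∃ λ w → B w y x
    prev {x} {y} {z} b@(x≢y , _) = w , B-wyx
      where
      w = x ⧸ y
      wy≡x : w · y ≡ x
      wy≡x = rightDividesˡ y x
      w≢y : w ≢ y
      w≢y eq = x≢y (trans (sym wy≡x) (trans (cong (_· y) eq) (·-idem y)))
      B-wyx : B w y x
      B-wyx with cases w≢y wy≡x
      ... | isXY c = c
      ... | isYZ c = contradiction (clash (cell-xy b) (cell-xz c)) λ ()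
      ... | isXZ c = contradiction (clash (cell-xy b) (cell-yz c)) λ ()

    -- In any other role of (z , x), flexibility identifies a neighbouring rim point, so that ⟨ z ,
    -- y , x ⟩ is a triple; but then (z , x) is an outer pair after all.
    back : ∀ {x y z} → B x y z → B z (z · x) x
    back {x} {y} {z} b with cases (≢-sym (proj₁ (proj₂ (proj₂ b)))) refl | next b | prev b
    ... | isXZ c | _ | _ = c
    ... | isXY c | _ | w , p = contradiction (trans (sym (cell-xz (subst (λ v → B v y x) w≡z p))) (cell-xy c)) λ ()
      where
      -- x · c = w by flexibility at (x , z), while ⟨ z , x , c ⟩ gives x · c = z.
      w≡z : w ≡ z
      w≡z = trans (sym (·yz p)) (trans (cong (_· x) (sym (·xz b))) (trans (flexible x z) (·yz c)))
    ... | isYZ c | u , q | _ = contradiction (trans (sym (cell-xz (subst (B z y) u≡x q))) (cell-yz c)) λ ()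
      where
      u≡x : u ≡ x
      u≡x = trans (sym (·xy q)) (trans (cong (z ·_) (sym (·xz b))) (trans (sym (flexible z x)) (·xy c)))

    -- Two consecutive rim edges have the same second pole; this is flexibility at (z , y).
    step : ∀ {x y z u} → B x y z → B z y u → u · z ≡ z · x
    step {x} {y} {z} b q = trans (cong (_· z) (sym (·xy q))) (trans (flexible z y) (cong (z ·_) (·yz b)))

    toBlock : ∀ {x y z} → B x y z → Block (Off ∅) cell x y z
    toBlock b@(p , q , r , _) = block (off p) (off q) (off r) (cell-xy b) (cell-yz b) (cell-xz b)

    toClosed : ∀ {x y z} → B x y z → Closed (Off ∅) cell x y z
    toClosed b with next b
    ... | u , q = closed (toBlock b) (toBlock q) (toBlock (back b))
                    (toBlock (subst (λ v → B u v _) (step b q) (back q)))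

    cover : ∀ {a b} → Off ∅ a b → Covered (Off ∅) cell a b
    cover (a≢b , _) with cases a≢b refl
    ... | isXY b = asXY (toClosed b)
    ... | isYZ b = asYZ (toClosed b)
    ... | isXZ b = asXZ (toClosed b)

  system : System (Fin n) ∅
  system = relocate V↔Fin (λ _ ()) (λ _ ()) record { cell = cell ; cover = cover }

-- Recursive constructions

module Doubling {V : Set} (_≟_ : DecidableEquality V) (S : System V ∅) where
  open System S renaming (cell to cell₀; cover to cover₀)

  Point : Set
  Point = (V × Bool) ⊎ ⊤

  -- Points (x , a) with a ∈ ℤ₂ and a point ∞: every triple ⟨ x , y , z ⟩ is
  -- lifted to the four triples ⟨ (x , a) , (y , b) , (z , a + b) ⟩, and
  -- (x , 0), (x , 1), ∞ form a bidirectional triple.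
  cell : Cells Point
  cell (inj₁ (x , a)) (inj₁ (y , b)) with x ≟ y
  ... | yes _ = XZ , inj₂ tt
  ... | no  _ = map₂ (λ z → inj₁ (z , a xor b)) (cell₀ x y)
  cell (inj₁ (x , a)) (inj₂ _) = XY , inj₁ (x , not a)
  cell (inj₂ _) (inj₁ (x , a)) = YZ , inj₁ (x , not a)
  cell (inj₂ _) (inj₂ _) = XY , inj₂ tt

  private
    lift : ∀ {x y r z} a b c → c ≡ a xor b → x ≢ y → cell₀ x y ≡ (r , z) →
           cell (inj₁ (x , a)) (inj₁ (y , b)) ≡ (r , inj₁ (z , c))
    lift {x} {y} a b c refl x≢y eq with x ≟ y
    ... | yes x≡y = contradiction x≡y x≢y
    ... | no _ = cong (map₂ _) eq

    base : ∀ {x y : V} {a b : Bool} → _≡_ {A = Point} (inj₁ (x , a)) (inj₁ (y , b)) → x ≡ y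
    base refl = refl

    yz-sum : ∀ a b → a ≡ b xor (a xor b)
    yz-sum false false = refl
    yz-sum false true  = refl
    yz-sum true  false = refl
    yz-sum true  true  = refl

    xz-sum : ∀ a b → b ≡ a xor (a xor b)
    xz-sum false b = refl
    xz-sum true  b = sym (not-involutive b)

    cancel : ∀ a b → (a xor b) xor b ≡ a
    cancel a b = trans (xor-comm (a xor b) b) (sym (yz-sum a b))

    lift-block : ∀ {x y z} a b c → c ≡ a xor b → Block (Off ∅) cell₀ x y z →
                 Block (Off ∅) cell (inj₁ (x , a)) (inj₁ (y , b)) (inj₁ (z , c))
    lift-block a b _ refl (block (p , _) (q , _) (r , _) e₁ e₂ e₃) =
      block (off (p ∘ base)) (off (q ∘ base)) (off (r ∘ base))
            (lift a b _ refl p e₁) (lift b (a xor b) a (yz-sum a b) q e₂) (lift a (a xor b) b (xz-sum a b) r e₃)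

    -- The poles lie on level b, and the levels along the rim alternate between a and a + b. For b =
    -- 1 an odd rim closes up only after two turns, which the local condition does not notice.
    lift-closed : ∀ {x y z} a b c → c ≡ a xor b → Closed (Off ∅) cell₀ x y z →
                  Closed (Off ∅) cell (inj₁ (x , a)) (inj₁ (y , b)) (inj₁ (z , c))
    lift-closed a b _ refl (closed s f k h) = closed
      (lift-block a b _ refl s) (lift-block (a xor b) b a (sym (cancel a b)) f)
      (lift-block (a xor b) b a (sym (cancel a b)) k) (lift-block a b _ refl h)

    fibre-xz : ∀ x a b → cell (inj₁ (x , a)) (inj₁ (x , b)) ≡ (XZ , inj₂ tt)
    fibre-xz x a b with x ≟ x
    ... | yes _ = refl
    ... | no x≢x = contradiction refl x≢x

    fibre : ∀ x a → Block (Off ∅) cell (inj₁ (x , a)) (inj₂ tt) (inj₁ (x , not a))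
    fibre x a = block (off λ ()) (off λ ()) (off (λ eq → not-fixed a (cong level eq)))
                  refl (cong (λ b → YZ , inj₁ (x , b)) (not-involutive a)) (fibre-xz x a (not a))
      where
      level : Point → Bool
      level (inj₁ (_ , b)) = b
      level (inj₂ _) = false
      not-fixed : ∀ a → a ≢ not a
      not-fixed true ()
      not-fixed false ()

    fibre-closed : ∀ x a → Closed (Off ∅) cell (inj₁ (x , a)) (inj₂ tt) (inj₁ (x , not a))
    fibre-closed x a = closed (fibre x a) back back (fibre x a)
      where
      back : Block (Off ∅) cell (inj₁ (x , not a)) (inj₂ tt) (inj₁ (x , a))
      back = subst (λ b → Block (Off ∅) cell (inj₁ (x , not a)) (inj₂ tt) (inj₁ (x , b)))
                   (not-involutive a) (fibre x (not a))

  system : System Point ∅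
  system = record { cell = cell ; cover = cover }
    where
    cover : ∀ {p q} → Off ∅ p q → Covered (Off ∅) cell p q
    cover {inj₁ (x , a)} {inj₁ (y , b)} (p≢q , _) with x ≟ y
    cover {inj₁ (x , false)} {inj₁ (x , false)} (p≢q , _) | yes refl = contradiction refl p≢q
    cover {inj₁ (x , true)}  {inj₁ (x , true)}  (p≢q , _) | yes refl = contradiction refl p≢q
    cover {inj₁ (x , false)} {inj₁ (x , true)}  _ | yes refl = asXZ (fibre-closed x false)
    cover {inj₁ (x , true)}  {inj₁ (x , false)} _ | yes refl = asXZ (fibre-closed x true)
    cover {inj₁ (x , a)} {inj₁ (y , b)} _ | no x≢y with cover₀ (off x≢y)
    ... | asXY c = asXY (lift-closed a b _ refl c)
    ... | asYZ c = asYZ (lift-closed (b xor a) a b (sym (cancel b a)) c)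
    ... | asXZ c = asXZ (lift-closed a (a xor b) b (xz-sum a b) c)
    cover {inj₁ (x , a)} {inj₂ _} _ = asXY (fibre-closed x a)
    cover {inj₂ _} {inj₁ (x , false)} _ = asYZ (fibre-closed x true)
    cover {inj₂ _} {inj₁ (x , true)}  _ = asYZ (fibre-closed x false)
    cover {inj₂ tt} {inj₂ tt} (p≢q , _) = contradiction refl p≢q

IsInj₂ : {A B : Set} → A ⊎ B → Set
IsInj₂ = [ const ⊥ , const ⊤ ]′

-- The groups are three copies of W, each completed by the points of E; the
-- pairs between different copies are covered by bidirectional triples.
module Tripling {W E : Set} {H : W ⊎ E → Set}
         (_∙_ : W → W → W) (∙-comm : ∀ a b → a ∙ b ≡ b ∙ a) (∙-cancel : ∀ a b → a ∙ (a ∙ b) ≡ b)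
         (S₀ : System (W ⊎ E) H) (S₁ : System (W ⊎ E) IsInj₂) where

  Point : Set
  Point = (W ⊎ E) ⊎ (W ⊎ W)

  Hole : Point → Set
  Hole = [ H , const ⊥ ]′

  private
    module S₀ = System S₀
    module S₁ = System S₁

    pattern p₀ a = inj₁ (inj₁ a)
    pattern p₁ a = inj₂ (inj₁ a)
    pattern p₂ a = inj₂ (inj₂ a)
    pattern pₑ e = inj₁ (inj₂ e)

    e₁ e₂ : W ⊎ E → Point
    e₁ (inj₁ a) = p₁ a
    e₁ (inj₂ e) = pₑ e
    e₂ (inj₁ a) = p₂ a
    e₂ (inj₂ e) = pₑ e

    -- Pairs inside E belong to the first copy alone: `S₁` leaves them uncovered and `S₀` covers
    -- those outside H. This is why H and E may be different sets, in any position to each other.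
    cell : Cells Point
    cell (inj₁ u) (inj₁ v) = map₂ inj₁ (S₀.cell u v)
    cell (p₁ a) (p₁ b) = map₂ e₁ (S₁.cell (inj₁ a) (inj₁ b))
    cell (p₁ a) (pₑ e) = map₂ e₁ (S₁.cell (inj₁ a) (inj₂ e))
    cell (pₑ e) (p₁ b) = map₂ e₁ (S₁.cell (inj₂ e) (inj₁ b))
    cell (p₂ a) (p₂ b) = map₂ e₂ (S₁.cell (inj₁ a) (inj₁ b))
    cell (p₂ a) (pₑ e) = map₂ e₂ (S₁.cell (inj₁ a) (inj₂ e))
    cell (pₑ e) (p₂ b) = map₂ e₂ (S₁.cell (inj₂ e) (inj₁ b))
    cell (p₀ a) (p₁ b) = XY , p₂ (a ∙ b)
    cell (p₁ b) (p₂ c) = YZ , p₀ (b ∙ c)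
    cell (p₀ a) (p₂ c) = XZ , p₁ (a ∙ c)
    cell (p₂ c) (p₁ b) = XY , p₀ (c ∙ b)
    cell (p₁ b) (p₀ a) = YZ , p₂ (b ∙ a)
    cell (p₂ c) (p₀ a) = XZ , p₁ (c ∙ a)

    Covered′ : Point → Point → Set
    Covered′ = Covered (Off Hole) cell

    hom₀ : ∀ {a b} → Off H a b →
           Off Hole (inj₁ a) (inj₁ b) × cell (inj₁ a) (inj₁ b) ≡ map₂ inj₁ (S₀.cell a b)
    hom₀ (a≢b , ¬H) = ((λ { refl → a≢b refl }) , ¬H) , refl

    hom₁ : ∀ {a b} → Off IsInj₂ a b → Off Hole (e₁ a) (e₁ b) × cell (e₁ a) (e₁ b) ≡ map₂ e₁ (S₁.cell a b)
    hom₁ {inj₁ _} {inj₁ _} (a≢b , _) = ((λ { refl → a≢b refl }) , proj₁) , refl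
    hom₁ {inj₁ _} {inj₂ _} (a≢b , _) = ((λ ()) , proj₁) , refl
    hom₁ {inj₂ _} {inj₁ _} (a≢b , _) = ((λ ()) , proj₂) , refl
    hom₁ {inj₂ _} {inj₂ _} (_ , ¬E) = contradiction (tt , tt) ¬E

    hom₂ : ∀ {a b} → Off IsInj₂ a b → Off Hole (e₂ a) (e₂ b) × cell (e₂ a) (e₂ b) ≡ map₂ e₂ (S₁.cell a b)
    hom₂ {inj₁ _} {inj₁ _} (a≢b , _) = ((λ { refl → a≢b refl }) , proj₁) , refl
    hom₂ {inj₁ _} {inj₂ _} (a≢b , _) = ((λ ()) , proj₁) , refl
    hom₂ {inj₂ _} {inj₁ _} (a≢b , _) = ((λ ()) , proj₂) , refl
    hom₂ {inj₂ _} {inj₂ _} (_ , ¬E) = contradiction (tt , tt) ¬E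

    group₀ : ∀ {a b} → Off H a b → Covered′ (inj₁ a) (inj₁ b)
    group₀ d = Covered-map inj₁ hom₀ (S₀.cover d)
    group₁ : ∀ {a b} → Off IsInj₂ a b → Covered′ (e₁ a) (e₁ b)
    group₁ d = Covered-map e₁ hom₁ (S₁.cover d)
    group₂ : ∀ {a b} → Off IsInj₂ a b → Covered′ (e₂ a) (e₂ b)
    group₂ d = Covered-map e₂ hom₂ (S₁.cover d)

    ∙-cancel′ : ∀ a b → b ∙ (a ∙ b) ≡ a
    ∙-cancel′ a b = trans (cong (b ∙_) (∙-comm a b)) (∙-cancel b a)

    block₀₁₂ : ∀ {a b c} → a ∙ b ≡ c → Block (Off Hole) cell (p₀ a) (p₁ b) (p₂ c)
    block₀₁₂ {a} {b} refl = block ((λ ()) , proj₂) ((λ ()) , proj₂) ((λ ()) , proj₂)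
      refl (cong (λ v → YZ , p₀ v) (∙-cancel′ a b)) (cong (λ v → XZ , p₁ v) (∙-cancel a b))

    block₂₁₀ : ∀ {a b c} → a ∙ b ≡ c → Block (Off Hole) cell (p₂ c) (p₁ b) (p₀ a)
    block₂₁₀ {a} {b} refl = block ((λ ()) , proj₂) ((λ ()) , proj₁) ((λ ()) , proj₁)
      (cong (λ v → XY , p₀ v) (trans (∙-comm _ b) (∙-cancel′ a b)))
      (cong (λ v → YZ , p₂ v) (∙-comm b a))
      (cong (λ v → XZ , p₁ v) (trans (∙-comm _ a) (∙-cancel a b)))

    -- A bidirectional triple is a degenerate bipyramid: its rim has two points and both poles
    -- coincide.
    closed₀₁₂ : ∀ {a b c} → a ∙ b ≡ c → Closed (Off Hole) cell (p₀ a) (p₁ b) (p₂ c)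
    closed₀₁₂ eq = closed (block₀₁₂ eq) (block₂₁₀ eq) (block₂₁₀ eq) (block₀₁₂ eq)

    closed₂₁₀ : ∀ {a b c} → a ∙ b ≡ c → Closed (Off Hole) cell (p₂ c) (p₁ b) (p₀ a)
    closed₂₁₀ eq = closed (block₂₁₀ eq) (block₀₁₂ eq) (block₀₁₂ eq) (block₂₁₀ eq)

    cover : ∀ {p q} → Off Hole p q → Covered′ p q
    cover {inj₁ _} {inj₁ _} (p≢q , ¬H) = group₀ ((λ { refl → p≢q refl }) , ¬H)
    cover {p₁ _} {p₁ _} (p≢q , _) = group₁ ((λ { refl → p≢q refl }) , proj₁)
    cover {p₁ a} {pₑ e} _ = group₁ {inj₁ a} {inj₂ e} ((λ ()) , proj₁)
    cover {pₑ e} {p₁ b} _ = group₁ {inj₂ e} {inj₁ b} ((λ ()) , proj₂)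
    cover {p₂ _} {p₂ _} (p≢q , _) = group₂ ((λ { refl → p≢q refl }) , proj₁)
    cover {p₂ a} {pₑ e} _ = group₂ {inj₁ a} {inj₂ e} ((λ ()) , proj₁)
    cover {pₑ e} {p₂ b} _ = group₂ {inj₂ e} {inj₁ b} ((λ ()) , proj₂)
    cover {p₀ a} {p₁ b} _ = asXY (closed₀₁₂ refl)
    cover {p₁ b} {p₂ c} _ = asYZ (closed₀₁₂ (trans (∙-comm _ b) (∙-cancel b c)))
    cover {p₀ a} {p₂ c} _ = asXZ (closed₀₁₂ (∙-cancel a c))
    cover {p₂ c} {p₁ b} _ = asXY (closed₂₁₀ (trans (∙-comm _ b) (∙-cancel′ c b)))
    cover {p₁ b} {p₀ a} _ = asYZ (closed₂₁₀ (∙-comm a b))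
    cover {p₂ c} {p₀ a} _ = asXZ (closed₂₁₀ (∙-cancel′ c a))

  system : System Point Hole
  system = record { cell = cell ; cover = cover }

module Filling {W E : Set} (S : System (W ⊎ E) IsInj₂) (S₁ : System E ∅) where
  private
    module S = System S
    module S₁ = System S₁

    cell : Cells (W ⊎ E)
    cell (inj₂ a) (inj₂ b) = map₂ inj₂ (S₁.cell a b)
    cell (inj₁ a) q = S.cell (inj₁ a) q
    cell (inj₂ a) (inj₁ b) = S.cell (inj₂ a) (inj₁ b)

    hom : ∀ {a b} → Off IsInj₂ a b → Off ∅ a b × cell a b ≡ map₂ (λ v → v) (S.cell a b)
    hom {inj₁ _} {_} (a≢b , _) = off a≢b , refl
    hom {inj₂ _} {inj₁ _} (a≢b , _) = off a≢b , refl
    hom {inj₂ _} {inj₂ _} (_ , ¬E) = contradiction (tt , tt) ¬E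

    cover : ∀ {a b} → Off ∅ a b → Covered (Off ∅) cell a b
    cover {inj₁ _} {_} (a≢b , _) = Covered-map (λ v → v) hom (S.cover (a≢b , proj₁))
    cover {inj₂ _} {inj₁ _} (a≢b , _) = Covered-map (λ v → v) hom (S.cover (a≢b , proj₂))
    cover {inj₂ a} {inj₂ b} (a≢b , _) =
      Covered-map inj₂ (λ (x≢y , _) → off (λ { refl → x≢y refl }) , refl) (S₁.cover (off λ { refl → a≢b refl }))

  system : System (W ⊎ E) ∅
  system = record { cell = cell ; cover = cover }

-- a ∙ b is the residue of - (a + b); starting from 2 w keeps ∸ from truncating.
module NegSum (m : ℕ) where
  private
    w = suc m

  residue : ℕ → ℕ → ℕ
  residue a b = (w + w ∸ (a + b)) % w

  _∙_ : Fin w → Fin w → Fin w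
  a ∙ b = (w + w ∸ (toℕ a + toℕ b)) mod w

  toℕ-∙ : ∀ a b → toℕ (a ∙ b) ≡ residue (toℕ a) (toℕ b)
  toℕ-∙ a b = toℕ-fromℕ< _

  ∙-comm : ∀ a b → a ∙ b ≡ b ∙ a
  ∙-comm a b = cong (λ s → (w + w ∸ s) mod w) (+-comm (toℕ a) (toℕ b))

  residue-cancel : ∀ {a b} → a < w → b < w → residue a (residue a b) ≡ b
  residue-cancel {a} {b} a<w b<w = begin
    t % w           ≡⟨ cong (_% w) t≡b+qw ⟩
    (b + q * w) % w ≡⟨ [m+kn]%n≡m%n b q w ⟩
    b % w           ≡⟨ m<n⇒m%n≡m b<w ⟩
    b               ∎
    where
    open ≡-Reasoning
    s = w + w ∸ (a + b)
    q = s / w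
    r = s % w
    t = w + w ∸ (a + r)
    s+ab : s + (a + b) ≡ w + w
    s+ab = m∸n+n≡m (+-mono-≤ (<⇒≤ a<w) (<⇒≤ b<w))
    t+ar : t + (a + r) ≡ w + w
    t+ar = m∸n+n≡m (+-mono-≤ (<⇒≤ a<w) (<⇒≤ (m%n<n s w)))
    swap₁ : ∀ t a r y → t + (a + (r + y)) ≡ t + (a + r) + y
    swap₁ = solve-∀
    swap₂ : ∀ s a b y → s + (a + b) + y ≡ b + y + (a + s)
    swap₂ = solve-∀
    t≡b+qw : t ≡ b + q * w
    t≡b+qw = +-cancelʳ-≡ (a + s) t (b + q * w) (begin
      t + (a + s)           ≡⟨ cong (λ v → t + (a + v)) (m≡m%n+[m/n]*n s w) ⟩
      t + (a + (r + q * w)) ≡⟨ swap₁ t a r (q * w) ⟩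
      t + (a + r) + q * w   ≡⟨ cong (_+ q * w) (trans t+ar (sym s+ab)) ⟩
      s + (a + b) + q * w   ≡⟨ swap₂ s a b (q * w) ⟩
      b + q * w + (a + s)   ∎)

  ∙-cancel : ∀ a b → a ∙ (a ∙ b) ≡ b
  ∙-cancel a b = toℕ-injective (trans (toℕ-∙ a (a ∙ b))
    (trans (cong (residue (toℕ a)) (toℕ-∙ a b)) (residue-cancel (toℕ<n a) (toℕ<n b))))

negsum : ∀ w → Fin w → Fin w → Fin w
negsum (suc m) = NegSum._∙_ m

negsum-comm : ∀ w a b → negsum w a b ≡ negsum w b a
negsum-comm (suc m) = NegSum.∙-comm m

negsum-cancel : ∀ w a b → negsum w a (negsum w a b) ≡ b
negsum-cancel (suc m) = NegSum.∙-cancel m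

-- The constructions in terms of orders

Holey : ℕ → ℕ → Set
Holey w k = System (Fin w ⊎ Fin k) IsInj₂

Full : ℕ → Set
Full n = System (Fin n) ∅

recount : ∀ {m n} → m ≡ n → Fin m ↔ Fin n
recount refl = ↔-refl

full-transport : ∀ {V W : Set} → V ↔ W → System V ∅ → System W ∅
full-transport f = relocate f (λ _ ()) (λ _ ())

double : ∀ {n} → Full n → Full (n * 2 + 1)
double {n} S = full-transport
  (↔-trans ((↔-trans (↔-refl ×-↔ ↔-sym 2↔Bool) (↔-sym *↔×)) ⊎-↔ ↔-sym 1↔⊤) (↔-sym +↔⊎))
  (Doubling.system _≟ᶠ_ S)

private
  exchange : {A B C : Set} → ((A ⊎ B) ⊎ C) ↔ ((A ⊎ C) ⊎ B)
  exchange = mk↔ₛ′ to from to-from from-to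
    where
    to : (_ ⊎ _) ⊎ _ → (_ ⊎ _) ⊎ _
    to (inj₁ (inj₁ a)) = inj₁ (inj₁ a)
    to (inj₁ (inj₂ b)) = inj₂ b
    to (inj₂ c) = inj₁ (inj₂ c)
    from : (_ ⊎ _) ⊎ _ → (_ ⊎ _) ⊎ _
    from (inj₁ (inj₁ a)) = inj₁ (inj₁ a)
    from (inj₁ (inj₂ c)) = inj₂ c
    from (inj₂ b) = inj₁ (inj₂ b)
    to-from : ∀ v → to (from v) ≡ v
    to-from (inj₁ (inj₁ _)) = refl
    to-from (inj₁ (inj₂ _)) = refl
    to-from (inj₂ _) = refl
    from-to : ∀ v → from (to v) ≡ v
    from-to (inj₁ (inj₁ _)) = refl
    from-to (inj₁ (inj₂ _)) = refl
    from-to (inj₂ _) = refl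

-- The two systems are matched by the position of their points only. Where this puts the hole of k
-- points relative to the e shared points is irrelevant, so k and e are independent.
triple : ∀ {w₀ k w e} → w₀ + k ≡ w + e → Holey w₀ k → Holey w e → Holey (w₀ + (w + w)) k
triple {w₀} {k} {w} {e} eq S₀ S₁ =
  relocate regroup
    (λ { (inj₁ (inj₂ _)) _ → tt ; (inj₁ (inj₁ _)) () ; (inj₂ _) () })
    (λ { (inj₁ (inj₂ _)) _ → tt ; (inj₁ (inj₁ _)) () ; (inj₂ _) () })
    relabelled
  where
  φ : (Fin w₀ ⊎ Fin k) ↔ (Fin w ⊎ Fin e)
  φ = ↔-trans (↔-sym +↔⊎) (↔-trans (recount eq) +↔⊎)
  H : Fin w ⊎ Fin e → Set
  H u = IsInj₂ (Inverse.from φ u)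
  S₀′ : System (Fin w ⊎ Fin e) H
  S₀′ = relocate φ (λ v → subst IsInj₂ (sym (Inverse.strictlyInverseʳ φ v)))
          (λ v → subst IsInj₂ (Inverse.strictlyInverseʳ φ v)) S₀
  relabel : ((Fin w ⊎ Fin e) ⊎ (Fin w ⊎ Fin w)) ↔ ((Fin w₀ ⊎ Fin k) ⊎ (Fin w ⊎ Fin w))
  relabel = ↔-sym φ ⊎-↔ ↔-refl
  relabelled : System ((Fin w₀ ⊎ Fin k) ⊎ (Fin w ⊎ Fin w)) [ IsInj₂ , const ⊥ ]′
  relabelled = relocate relabel
    (λ { (inj₁ _) h → h ; (inj₂ _) () })
    (λ { (inj₁ _) h → h ; (inj₂ _) () })
    (Tripling.system (negsum w) (negsum-comm w) (negsum-cancel w) S₀′ S₁)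
  regroup : ((Fin w₀ ⊎ Fin k) ⊎ (Fin w ⊎ Fin w)) ↔ (Fin (w₀ + (w + w)) ⊎ Fin k)
  regroup = ↔-trans exchange (↔-trans (↔-refl ⊎-↔ ↔-sym +↔⊎) (↔-sym +↔⊎) ⊎-↔ ↔-refl)

fill : ∀ {w k} → Holey w k → Full k → Full (w + k)
fill S S₁ = full-transport (↔-sym +↔⊎) (Filling.system S S₁)

no-hole : ∀ {n} → Full n → Holey n 0
no-hole S = relocate f (λ _ ()) (λ _ ()) S
  where
  f : _ ↔ (_ ⊎ Fin 0)
  f = mk↔ₛ′ inj₁ (λ { (inj₁ i) → i ; (inj₂ ()) }) (λ { (inj₁ i) → refl ; (inj₂ ()) }) (λ _ → refl)

-- A single point contains no pair, so it may be declared a hole. The hole really grows here, hence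
-- `transport` in place of `relocate`.
point-hole : ∀ {n} → Full (n + 1) → Holey n 1
point-hole S = transport +↔⊎ (λ _ ()) keep S
  where
  keep : ∀ {a b} → Off ∅ a b → Off IsInj₂ (Inverse.to +↔⊎ a) (Inverse.to +↔⊎ b)
  keep {a} {b} d = p , λ (h , h′) → p (equal _ _ h h′)
    where
    p = proj₁ (Off-to {H = ∅} {K = ∅} +↔⊎ (λ _ ()) d)
    equal : ∀ (u v : Fin _ ⊎ Fin 1) → IsInj₂ u → IsInj₂ v → u ≡ v
    equal (inj₂ zero) (inj₂ zero) _ _ = refl

-- Explicit systems and their verification by evaluation

∧⁻ : ∀ {x y} → T (x ∧ y) → T x × T y
∧⁻ = Equivalence.to T-∧

∧⁺ : ∀ {x y} → T x → T y → T (x ∧ y)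
∧⁺ p q = Equivalence.from T-∧ (p , q)

not⁺ : ∀ {x} → ¬ T x → T (not x)
not⁺ {false} _ = tt
not⁺ {true} ¬p = contradiction tt ¬p

not⁻ : ∀ {x} → T (not x) → ¬ T x
not⁻ {false} _ ()

at : {A : Set} → A → List A → ℕ → A
at d []       _       = d
at d (x ∷ _)  zero    = x
at d (_ ∷ xs) (suc i) = at d xs i

put : {A : Set} → (A → A) → List A → ℕ → List A
put f []       _       = []
put f (x ∷ xs) zero    = f x ∷ xs
put f (x ∷ xs) (suc i) = x ∷ put f xs i

Table : Set
Table = List (List (Role × ℕ))

cellAt : Table → ℕ → ℕ → Role × ℕ
cellAt t a b = at (XY , 0) (at [] t a) b

-- A bipyramid with poles y and c over the rim x₀ , … , xₖ₋₁ stands for the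
-- triples ⟨ xᵢ , y , xᵢ₊₁ ⟩ and ⟨ xᵢ₊₁ , c , xᵢ ⟩.  A bidirectional triple is
-- the degenerate case k = 2, y = c.
infix 6 _and_over_
data Bipyramid : Set where
  _and_over_ : ℕ → ℕ → List ℕ → Bipyramid

tri : ℕ → ℕ → ℕ → Bipyramid
tri x y z = y and y over (x ∷ z ∷ [])

triples : Bipyramid → List (ℕ × ℕ × ℕ)
triples (y and c over []) = []
triples (y and c over (x₀ ∷ xs)) = go x₀ xs
  where
  edge : ℕ → ℕ → List (ℕ × ℕ × ℕ)
  edge u v = (u , y , v) ∷ (v , c , u) ∷ []
  go : ℕ → List ℕ → List (ℕ × ℕ × ℕ)
  go u []       = edge u x₀
  go u (v ∷ vs) = edge u v ++ go v vs

-- Nothing is claimed about the result: unset entries keep a dummy value and entries may be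
-- overwritten; validity is left to `check`. A triangle invariant under the rotation is entered
-- repeatedly with different middle points, which is harmless since each entry replaces all six
-- pairs.
table : ℕ → List Bipyramid → Table
table n bs = foldr enter (replicate n (replicate n (XY , 0))) (concatMap triples bs)
  where
  set : ℕ → ℕ → Role × ℕ → Table → Table
  set a b v t = put (λ row → put (const v) row b) t a
  enter : ℕ × ℕ × ℕ → Table → Table
  enter (x , y , z) = set x y (XY , z) ∘ set y z (YZ , x) ∘ set x z (XZ , y)

-- The points p < g · m are permuted in m cycles of length g, the others are
-- fixed.
develop : (g m : ℕ) .{{_ : NonZero g}} → List Bipyramid → List Bipyramid
develop g m bs = concatMap (λ t → map (shift t) bs) (upTo g)
  where
  point : ℕ → ℕ → ℕ
  point t p = if p <ᵇ g * m then p / g * g + (p % g + t) % g else p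
  shift : ℕ → Bipyramid → Bipyramid
  shift t (y and c over xs) = point t y and point t c over map (point t) xs

transpose : ℕ → ℕ → ℕ → ℕ
transpose a b p = if p ≡ᵇ a then b else if p ≡ᵇ b then a else p

rename : (ℕ → ℕ) → List Bipyramid → List Bipyramid
rename f = map λ { (y and c over xs) → f y and f c over map f xs }

_=ᵇ_ : Role → Role → Bool
XY =ᵇ XY = true
YZ =ᵇ YZ = true
XZ =ᵇ XZ = true
_  =ᵇ _  = false

=ᵇ⇒≡ : ∀ {r s} → T (r =ᵇ s) → r ≡ s
=ᵇ⇒≡ {XY} {XY} _ = refl
=ᵇ⇒≡ {YZ} {YZ} _ = refl
=ᵇ⇒≡ {XZ} {XZ} _ = refl

allᵇ : (ℕ → Bool) → ℕ → Bool
allᵇ f zero    = true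
allᵇ f (suc m) = f m ∧ allᵇ f m

allᵇ⁻ : ∀ f m → T (allᵇ f m) → ∀ {a} → a < m → T (f a)
allᵇ⁻ f (suc m) p {a} a<sm with a ℕ.≟ m
... | yes refl = proj₁ (∧⁻ p)
... | no a≢m = allᵇ⁻ f m (proj₂ (∧⁻ p)) (ℕ.≤∧≢⇒< (s≤s⁻¹ a<sm) a≢m)

-- The test runs on bare numbers, the hole being the last k of them; the passage to `Fin w ⊎ Fin k`
-- is made once, in the soundness proof, by `Covered-map`.
module Check (w k : ℕ) .{{_ : NonZero (w + k)}} (t : Table) where
  private
    n = w + k

  dom : ℕ → ℕ → Bool
  dom a b = (a <ᵇ n) ∧ (b <ᵇ n) ∧ not (a ≡ᵇ b) ∧ ((a <ᵇ w) ∨ (b <ᵇ w))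

  eqᵇ : Role × ℕ → Role → ℕ → Bool
  eqᵇ (r , z) s y = (z ≡ᵇ y) ∧ (r =ᵇ s)

  blockᵇ : ℕ → ℕ → ℕ → Bool
  blockᵇ x y z = dom x y ∧ dom y z ∧ dom x z ∧
    eqᵇ (cellAt t x y) XY z ∧ eqᵇ (cellAt t y z) YZ x ∧ eqᵇ (cellAt t x z) XZ y

  closedᵇ : ℕ → ℕ → ℕ → Bool
  closedᵇ x y z = let u = proj₂ (cellAt t z y) ; c = proj₂ (cellAt t z x) in
                  blockᵇ x y z ∧ blockᵇ z y u ∧ blockᵇ z c x ∧ blockᵇ u c z

  coveredᵇ : Role × ℕ → ℕ → ℕ → Bool
  coveredᵇ (XY , z) a b = closedᵇ a b z
  coveredᵇ (YZ , z) a b = closedᵇ z a b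
  coveredᵇ (XZ , z) a b = closedᵇ a z b

  check : Bool
  check = allᵇ (λ a → allᵇ (λ b → if dom a b then coveredᵇ (cellAt t a b) a b else true) n) n

  private
    D : ℕ → ℕ → Set
    D a b = T (dom a b)

    eqᵇ⁻ : ∀ {v s y} → T (eqᵇ v s y) → v ≡ (s , y)
    eqᵇ⁻ {r , z} p = cong₂ _,_ (=ᵇ⇒≡ (proj₂ (∧⁻ p))) (ℕ.≡ᵇ⇒≡ z _ (proj₁ (∧⁻ {z ≡ᵇ _} p)))

    blockᵇ⁻ : ∀ {x y z} → T (blockᵇ x y z) → Block D (cellAt t) x y z
    blockᵇ⁻ {x} {y} {z} p =
      let p₁ , q₁ = ∧⁻ {dom x y} p
          p₂ , q₂ = ∧⁻ {dom y z} q₁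
          p₃ , q₃ = ∧⁻ {dom x z} q₂
          p₄ , q₄ = ∧⁻ {eqᵇ (cellAt t x y) XY z} q₃
          p₅ , p₆ = ∧⁻ {eqᵇ (cellAt t y z) YZ x} q₄
      in block p₁ p₂ p₃ (eqᵇ⁻ p₄) (eqᵇ⁻ p₅) (eqᵇ⁻ p₆)

    closedᵇ⁻ : ∀ {x y z} → T (closedᵇ x y z) → Closed D (cellAt t) x y z
    closedᵇ⁻ {x} {y} {z} p =
      let u = proj₂ (cellAt t z y)
          c = proj₂ (cellAt t z x)
          p₁ , q₁ = ∧⁻ {blockᵇ x y z} p
          p₂ , q₂ = ∧⁻ {blockᵇ z y u} q₁
          p₃ , p₄ = ∧⁻ {blockᵇ z c x} q₂
      in closed (blockᵇ⁻ p₁) (blockᵇ⁻ p₂) (blockᵇ⁻ p₃) (blockᵇ⁻ p₄)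

    coveredᵇ⁻ : ∀ v {a b} → T (coveredᵇ v a b) → Covered D (cellAt t) a b
    coveredᵇ⁻ (XY , _) p = asXY (closedᵇ⁻ p)
    coveredᵇ⁻ (YZ , _) p = asYZ (closedᵇ⁻ p)
    coveredᵇ⁻ (XZ , _) p = asXZ (closedᵇ⁻ p)

    record Valid (a b : ℕ) : Set where
      field
        a<n : a < n
        b<n : b < n
        a≢b : a ≢ b
        out : a < w ⊎ b < w

    D⁻ : ∀ {a b} → D a b → Valid a b
    D⁻ {a} {b} p =
      let p₁ , q₁ = ∧⁻ {a <ᵇ n} p
          p₂ , q₂ = ∧⁻ {b <ᵇ n} q₁
          p₃ , p₄ = ∧⁻ {not (a ≡ᵇ b)} q₂
      in record
        { a<n = ℕ.<ᵇ⇒< a n p₁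
        ; b<n = ℕ.<ᵇ⇒< b n p₂
        ; a≢b = λ eq → not⁻ p₃ (ℕ.≡⇒≡ᵇ a b eq)
        ; out = Sum.map (ℕ.<ᵇ⇒< a w) (ℕ.<ᵇ⇒< b w) (Equivalence.to (T-∨ {a <ᵇ w}) p₄)
        }

    D⁺ : ∀ {a b} → Valid a b → D a b
    D⁺ {a} {b} v = ∧⁺ (ℕ.<⇒<ᵇ (Valid.a<n v)) (∧⁺ (ℕ.<⇒<ᵇ (Valid.b<n v))
        (∧⁺ (not⁺ (Valid.a≢b v ∘ ℕ.≡ᵇ⇒≡ a b)) (Equivalence.from T-∨ (Sum.map ℕ.<⇒<ᵇ ℕ.<⇒<ᵇ (Valid.out v)))))

    point : ℕ → Fin w ⊎ Fin k
    point a = splitAt w (a mod n)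

    code : Fin w ⊎ Fin k → ℕ
    code v = toℕ (join w k v)

    code-point : ∀ {a} → a < n → code (point a) ≡ a
    code-point {a} a<n = trans (cong toℕ (join-splitAt w k (a mod n)))
      (trans (toℕ-fromℕ< (m%n<n a n)) (m<n⇒m%n≡m a<n))

    point-code : ∀ v → point (code v) ≡ v
    point-code v = trans (cong (splitAt w) (toℕ-injective (trans (toℕ-fromℕ< (m%n<n (code v) n)) (m<n⇒m%n≡m (toℕ<n (join w k v))))))
      (splitAt-join w k v)

    cell : Cells (Fin w ⊎ Fin k)
    cell u v = map₂ point (cellAt t (code u) (code v))

    outside : ∀ v → code v < w → ¬ IsInj₂ v
    outside (inj₂ j) p _ = ℕ.<⇒≱ p (subst (w ≤_) (sym (toℕ-↑ʳ w j)) (ℕ.m≤m+n w (toℕ j)))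

    valid : ∀ {u v} → Off IsInj₂ u v → Valid (code u) (code v)
    valid {u} {v} (u≢v , ¬H) = record
      { a<n = toℕ<n (join w k u)
      ; b<n = toℕ<n (join w k v)
      ; a≢b = λ eq → u≢v (trans (sym (point-code u)) (trans (cong point eq) (point-code v)))
      ; out = out u v ¬H
      }
      where
      small : ∀ i → code (inj₁ i) < w
      small i = subst (_< w) (sym (toℕ-↑ˡ i k)) (toℕ<n i)
      out : ∀ u v → ¬ (IsInj₂ u × IsInj₂ v) → code u < w ⊎ code v < w
      out (inj₁ i) _ _ = inj₁ (small i)
      out (inj₂ _) (inj₁ i) _ = inj₂ (small i)
      out (inj₂ _) (inj₂ _) ¬H = contradiction (tt , tt) ¬H

    hom : ∀ {a b} → D a b → Off IsInj₂ (point a) (point b) × cell (point a) (point b) ≡ map₂ point (cellAt t a b)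
    hom {a} {b} d = (a≢b′ , hole (Valid.out v)) , cong₂ (λ x y → map₂ point (cellAt t x y)) pa pb
      where
      v = D⁻ d
      pa = code-point (Valid.a<n v)
      pb = code-point (Valid.b<n v)
      a≢b′ : point a ≢ point b
      a≢b′ eq = Valid.a≢b v (trans (sym pa) (trans (cong code eq) pb))
      hole : a < w ⊎ b < w → ¬ (IsInj₂ (point a) × IsInj₂ (point b))
      hole (inj₁ a<w) (h , _) = outside (point a) (subst (_< w) (sym pa) a<w) h
      hole (inj₂ b<w) (_ , h) = outside (point b) (subst (_< w) (sym pb) b<w) h

  system : T check → Holey w k
  system ok = record { cell = cell ; cover = cover }
    where
    if⁻ : ∀ {b c} → T b → T (if b then c else true) → T c
    if⁻ {true} _ p = p
    cover : ∀ {u v} → Off IsInj₂ u v → Covered (Off IsInj₂) cell u v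
    cover {u} {v} d = subst₂ (Covered (Off IsInj₂) cell) (point-code u) (point-code v)
      (Covered-map point hom (coveredᵇ⁻ (cellAt t (code u) (code v)) (if⁻ d′ (allᵇ⁻ _ n (allᵇ⁻ _ n ok (Valid.a<n (valid d))) (Valid.b<n (valid d))))))
      where d′ = D⁺ (valid d)

-- For a hole of three points, `blocks` generates a complete system, and `transposed` moves one of
-- its triangles to the last three places, where the check ignores it. The hole thus need not be
-- invariant under the rotation.
record Starter : Set where
  constructor starter
  field
    g m        : ℕ
    {{g≢0}}    : NonZero g
    transposed : List (ℕ × ℕ)
    blocks     : List Bipyramid

  blockTable : ℕ → Table
  blockTable n = table n (rename (λ p → foldr (uncurry transpose) p transposed) (develop g m blocks))

finite : (w k : ℕ) .{{_ : NonZero (w + k)}} (s : Starter) → T (Check.check w k (Starter.blockTable s (w + k))) → Holey w k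
finite w k s = Check.system w k (Starter.blockTable s (w + k))

-- Systems with small automorphism groups, found by computer search.

holey-13-3 : Holey 13 3
holey-13-3 = finite 13 3 (starter 3 5 ((9 , 14) ∷ (12 , 13) ∷ [])
   (15 and 0 over (3 ∷ 1 ∷ 6 ∷ []) ∷ 3 and 8 over (4 ∷ 14 ∷ 10 ∷ []) ∷
    9 and 13 over (1 ∷ 11 ∷ 8 ∷ []) ∷ tri 12 9 15 ∷ tri 0 4 9 ∷ tri 0 13 14 ∷ tri 3 8 12 ∷ tri 6 7 8 ∷
    [])) _

holey-12-4 : Holey 12 4
holey-12-4 = finite 12 4 (starter 3 4 []
   (0 and 3 over (14 ∷ 6 ∷ 10 ∷ []) ∷ 6 and 10 over (2 ∷ 12 ∷ 4 ∷ []) ∷ tri 0 1 2 ∷ tri 0 3 4 ∷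
    tri 0 8 15 ∷ tri 13 0 9 ∷ tri 9 4 15 ∷ tri 13 3 7 ∷ tri 9 7 10 ∷ tri 6 7 8 ∷ [])) _

holey-15-3 : Holey 15 3
holey-15-3 = finite 15 3 (starter 3 6 ((9 , 17) ∷ (4 , 16) ∷ (0 , 15) ∷ [])
   (0 and 5 over (8 ∷ 6 ∷ 15 ∷ []) ∷ 6 and 10 over (11 ∷ 13 ∷ 4 ∷ []) ∷
    12 and 16 over (2 ∷ 5 ∷ 4 ∷ []) ∷ tri 0 4 9 ∷ tri 9 2 6 ∷ tri 12 0 1 ∷ tri 15 2 10 ∷ tri 6 12 17 ∷
    tri 6 10 14 ∷ tri 15 9 16 ∷ tri 15 12 14 ∷ [])) _

holey-14-4 : Holey 14 4
holey-14-4 = finite 14 4 (starter 2 7 []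
   (0 and 2 over (12 ∷ 15 ∷ 8 ∷ []) ∷ 4 and 7 over (0 ∷ 3 ∷ 11 ∷ []) ∷
    8 and 10 over (4 ∷ 17 ∷ 7 ∷ []) ∷ 12 and 13 over (5 ∷ 16 ∷ 4 ∷ []) ∷ tri 0 5 14 ∷ tri 4 2 9 ∷
    tri 15 4 6 ∷ tri 10 11 15 ∷ tri 0 1 16 ∷ tri 12 1 7 ∷ tri 17 1 3 ∷ tri 0 9 10 ∷ tri 17 12 13 ∷
    tri 10 12 14 ∷ tri 10 8 13 ∷ tri 16 2 11 ∷ tri 2 3 14 ∷ tri 2 7 13 ∷ tri 14 6 7 ∷ tri 6 8 16 ∷
    tri 14 8 9 ∷ [])) _

holey-19-3 : Holey 19 3
holey-19-3 = finite 19 3 (starter 11 2 ((9 , 21) ∷ (4 , 20) ∷ (11 , 19) ∷ [])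
   (0 and 19 over (7 ∷ 10 ∷ 21 ∷ []) ∷ tri 11 4 9 ∷ tri 11 17 18 ∷ tri 0 2 17 ∷ tri 11 3 19 ∷ [])) _

holey-18-4 : Holey 18 4
holey-18-4 = finite 18 4 (starter 3 6 []
   (0 and 4 over (6 ∷ 11 ∷ 7 ∷ []) ∷ 6 and 9 over (14 ∷ 15 ∷ 19 ∷ []) ∷
    12 and 16 over (3 ∷ 18 ∷ 2 ∷ []) ∷ tri 18 7 10 ∷ tri 19 2 5 ∷ tri 0 2 14 ∷ tri 20 2 4 ∷
    tri 6 1 21 ∷ tri 9 0 10 ∷ tri 0 15 16 ∷ tri 6 16 20 ∷ tri 20 10 13 ∷ tri 12 6 13 ∷ tri 3 7 15 ∷
    tri 21 14 16 ∷ tri 9 13 16 ∷ tri 3 9 17 ∷ tri 21 3 11 ∷ tri 3 4 14 ∷ [])) _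

holey-21-3 : Holey 21 3
holey-21-3 = finite 21 3 (starter 3 8 ((16 , 22) ∷ (18 , 21) ∷ [])
   (0 and 5 over (17 ∷ 8 ∷ 16 ∷ []) ∷ 6 and 11 over (18 ∷ 8 ∷ 10 ∷ []) ∷
    12 and 16 over (9 ∷ 14 ∷ 3 ∷ []) ∷ 18 and 23 over (14 ∷ 1 ∷ 20 ∷ []) ∷ tri 18 16 23 ∷ tri 0 15 18 ∷
    tri 9 15 21 ∷ tri 12 8 15 ∷ tri 12 16 20 ∷ tri 9 17 22 ∷ tri 3 10 19 ∷ tri 3 5 20 ∷ tri 18 7 22 ∷
    tri 0 11 12 ∷ tri 9 0 23 ∷ tri 9 2 4 ∷ tri 0 1 2 ∷ tri 3 0 7 ∷ tri 0 6 14 ∷ tri 0 4 21 ∷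
    tri 12 5 23 ∷ tri 21 5 7 ∷ tri 21 22 23 ∷ tri 6 12 22 ∷ [])) _

holey-20-4 : Holey 20 4
holey-20-4 = finite 20 4 (starter 10 2 []
   (0 and 18 over (2 ∷ 12 ∷ 19 ∷ []) ∷ tri 10 7 18 ∷ tri 0 1 7 ∷ tri 21 3 8 ∷ tri 21 13 18 ∷
    tri 20 2 16 ∷ tri 23 3 18 ∷ tri 22 8 16 ∷ [])) _

holey-25-3 : Holey 25 3
holey-25-3 = finite 25 3 (starter 9 3 ((14 , 27) ∷ (4 , 26) ∷ (0 , 25) ∷ [])
   (27 and 4 over (12 ∷ 5 ∷ 19 ∷ []) ∷ 9 and 24 over (3 ∷ 20 ∷ 16 ∷ []) ∷ tri 0 4 14 ∷ tri 0 2 11 ∷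
    tri 18 5 17 ∷ tri 0 3 19 ∷ tri 18 7 25 ∷ tri 18 12 26 ∷ tri 9 10 13 ∷ tri 18 15 24 ∷ [])) _

holey-24-4 : Holey 24 4
holey-24-4 = finite 24 4 (starter 12 2 []
   (0 and 18 over (4 ∷ 21 ∷ 16 ∷ []) ∷ tri 0 19 20 ∷ tri 0 2 3 ∷ tri 12 6 11 ∷ tri 12 16 20 ∷
    tri 24 3 9 ∷ tri 24 14 20 ∷ tri 27 10 13 ∷ tri 25 10 20 ∷ tri 26 8 19 ∷ [])) _

holey-27-3 : Holey 27 3
holey-27-3 = finite 27 3 (starter 15 2 ((26 , 29) ∷ (20 , 28) ∷ (0 , 27) ∷ [])
   (0 and 22 over (25 ∷ 8 ∷ 21 ∷ []) ∷ tri 0 20 26 ∷ tri 0 22 24 ∷ tri 15 20 25 ∷ tri 15 14 22 ∷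
    tri 0 1 19 ∷ tri 0 12 27 ∷ tri 0 2 11 ∷ tri 0 5 10 ∷ [])) _

holey-26-4 : Holey 26 4
holey-26-4 = finite 26 4 (starter 13 2 []
   (0 and 15 over (19 ∷ 1 ∷ 16 ∷ []) ∷ tri 13 15 20 ∷ tri 0 5 17 ∷ tri 0 6 10 ∷ tri 0 11 24 ∷
    tri 29 12 20 ∷ tri 28 10 17 ∷ tri 26 11 20 ∷ tri 27 2 25 ∷ [])) _

holey-31-3 : Holey 31 3
holey-31-3 = finite 31 3 (starter 17 2 ((27 , 33) ∷ (1 , 32) ∷ (0 , 31) ∷ [])
   (0 and 21 over (4 ∷ 14 ∷ 29 ∷ []) ∷ tri 0 1 27 ∷ tri 0 6 19 ∷ tri 0 8 28 ∷ tri 0 12 18 ∷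
    tri 17 1 3 ∷ tri 0 21 22 ∷ tri 17 19 22 ∷ tri 17 24 30 ∷ [])) _

holey-30-4 : Holey 30 4
holey-30-4 = finite 30 4 (starter 15 2 []
   (0 and 28 over (14 ∷ 5 ∷ 21 ∷ []) ∷ tri 0 4 7 ∷ tri 0 2 19 ∷ tri 15 16 19 ∷ tri 0 15 24 ∷
    tri 0 18 20 ∷ tri 15 20 25 ∷ tri 30 8 19 ∷ tri 31 13 26 ∷ tri 32 9 19 ∷ tri 33 14 26 ∷ [])) _

holey-33-3 : Holey 33 3
holey-33-3 = finite 33 3 (starter 11 3 ([])
   (33 and 2 over (16 ∷ 1 ∷ 26 ∷ []) ∷ 34 and 16 over (7 ∷ 15 ∷ 28 ∷ []) ∷
    35 and 25 over (32 ∷ 6 ∷ 18 ∷ []) ∷ tri 33 34 35 ∷ tri 11 6 9 ∷ tri 0 2 22 ∷ tri 0 4 11 ∷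
    tri 0 6 29 ∷ tri 22 5 11 ∷ tri 0 21 27 ∷ tri 22 14 17 ∷ tri 11 15 20 ∷ tri 22 13 28 ∷
    tri 22 30 32 ∷ [])) _

holey-32-4 : Holey 32 4
holey-32-4 = finite 32 4 (starter 16 2 []
   (0 and 21 over (20 ∷ 7 ∷ 4 ∷ []) ∷ tri 33 7 15 ∷ tri 33 18 26 ∷ tri 0 2 24 ∷ tri 0 1 6 ∷
    tri 16 18 21 ∷ tri 32 6 16 ∷ tri 16 13 20 ∷ tri 0 18 25 ∷ tri 16 11 22 ∷ tri 34 13 25 ∷
    tri 35 15 30 ∷ [])) _

holey-3-0 : Holey 3 0
holey-3-0 = finite 3 0 (starter 1 1 [] (tri 0 1 2 ∷ [])) _

-- The cyclic Steiner triple system of order 13: the differences of { 0 , 1 , 4 } and { 0 , 2 , 7 }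
-- are all nonzero residues.
holey-13-0 : Holey 13 0
holey-13-0 = finite 13 0 (starter 13 1 [] (tri 0 1 4 ∷ tri 0 2 7 ∷ [])) _

holey-1-0 : Holey 1 0
holey-1-0 = finite 1 0 (starter 1 1 [] []) _

-- The orders that are reached

Has : ℕ → ℕ → Set
Has n k = Σ ℕ λ w → w + k ≡ n × Holey w k

full : ∀ {n} → Has n 0 → Full n
full (w , refl , S) = relocate (↔-sym +↔⊎) (λ { (inj₁ _) () ; (inj₂ ()) }) (λ { (inj₁ _) () ; (inj₂ ()) }) S

has-full : ∀ {n} → Full n → Has n 0
has-full {n} S = n , +-identityʳ n , no-hole S

has-double : ∀ {n} → Has n 0 → Has (n * 2 + 1) 0
has-double S = has-full (double (full S))

has-fill : ∀ {n} → Has n 3 → Has n 0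
has-fill (w , refl , S) = has-full (fill S (full (3 , refl , holey-3-0)))

has-point : ∀ {n} → Has (n + 1) 0 → Has (n + 1) 1
has-point {n} S = n , refl , point-hole (full S)

-- The order is n = 3 s - 2 e, written without truncated subtraction. The first system provides the
-- copy whose hole survives, the second one the other two copies.
has-triple : ∀ {s k e} n → n + 2 * e ≡ 3 * s → Has s k → Has s e → Has n k
has-triple {s} {k} {e} n eq (w₀ , p , S₀) (w , q , S₁) =
  w₀ + (w + w) , +-cancelʳ-≡ (2 * e) _ _ total , triple (trans p (sym q)) S₀ S₁
  where
  open ≡-Reasoning
  rearrange : ∀ a k w e → a + (w + w) + k + 2 * e ≡ a + k + ((w + e) + (w + e))
  rearrange = solve-∀
  thrice : ∀ s → s + (s + s) ≡ 3 * s
  thrice = solve-∀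
  total : w₀ + (w + w) + k + 2 * e ≡ n + 2 * e
  total = begin
    w₀ + (w + w) + k + 2 * e        ≡⟨ rearrange w₀ k w e ⟩
    w₀ + k + ((w + e) + (w + e))    ≡⟨ cong₂ (λ x y → x + (y + y)) p q ⟩
    s + (s + s)                     ≡⟨ thrice s ⟩
    3 * s                           ≡⟨ eq ⟨
    n + 2 * e                       ∎

record Even (n : ℕ) : Set where
  constructor even
  field
    has₃ : Has n 3
    has₄ : Has n 4

  has₀ : Has n 0
  has₀ = has-fill has₃

even-triple : ∀ {s e} n → n + 2 * e ≡ 3 * s → Even s → Has s e → Even n
even-triple n eq (even S₃ S₄) S = even (has-triple n eq S₃ S) (has-triple n eq S₄ S)

even-point : ∀ {s} → Even (suc s) → Has (suc s) 1
even-point {s} S = subst (λ n → Has n 1) (+-comm s 1) (has-point (subst (λ n → Has n 0) (+-comm 1 s) (Even.has₀ S)))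

data Mod₃ : ℕ → Set where
  +0 : ∀ v → Mod₃ (v * 3)
  +1 : ∀ v → Mod₃ (1 + v * 3)
  +2 : ∀ v → Mod₃ (2 + v * 3)

mod₃ : ∀ n → Mod₃ n
mod₃ zero = +0 0
mod₃ (suc n) with mod₃ n
... | +0 v = +1 v
... | +1 v = +2 v
... | +2 v = +0 (suc v)

v<r+v*3 : ∀ r v → 0 < v → v < r + v * 3
v<r+v*3 r (suc v) _ = ≤-trans (s≤s (s≤s (≤-trans (m≤m*n v 3) (m≤n+m (v * 3) 1)))) (m≤n+m (suc v * 3) r)

-- Orders 18 v + 6 and 18 v + 4 come from systems with holes of size 3 and 4
-- respectively, which is why both are carried along.
even-systems : ∀ u → (3 ≤ u → Even (u * 6)) × (2 ≤ u → Even (4 + u * 6))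
even-systems = <-rec P λ u rec → step₀ (mod₃ u) rec , step₄ (mod₃ u) rec
  where
  P : ℕ → Set
  P u = (3 ≤ u → Even (u * 6)) × (2 ≤ u → Even (4 + u * 6))

  2≤ : ∀ {v} → 2 ≤ 2 + v
  2≤ = s≤s (s≤s z≤n)
  3≤ : ∀ {v} → 3 ≤ 3 + v
  3≤ = s≤s (s≤s (s≤s z≤n))

  18v : ∀ v → v * 3 * 6 + 2 * 0 ≡ 3 * (v * 6)
  18v = solve-∀
  18v+6 : ∀ v → (1 + v * 3) * 6 + 2 * 3 ≡ 3 * (4 + v * 6)
  18v+6 = solve-∀
  18v+12 : ∀ v → (2 + v * 3) * 6 + 2 * 0 ≡ 3 * (4 + v * 6)
  18v+12 = solve-∀
  18v+4 : ∀ v → 4 + v * 3 * 6 + 2 * 4 ≡ 3 * (4 + v * 6)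
  18v+4 = solve-∀
  18v+10 : ∀ v → 4 + (1 + v * 3) * 6 + 2 * 1 ≡ 3 * (4 + v * 6)
  18v+10 = solve-∀
  18v+16 : ∀ v → 4 + (2 + v * 3) * 6 + 2 * 1 ≡ 3 * ((1 + v) * 6)
  18v+16 = solve-∀

  -- Here and in `step₄` the explicit systems stand exactly where s would be 6, 10 or 12: orders 18,
  -- 24, 30, 36 and 16, 22, 28, 34.
  step₀ : ∀ {u} → Mod₃ u → (∀ {v} → v < u → P v) → 3 ≤ u → Even (u * 6)
  step₀ (+0 1) _ _ = even (_ , refl , holey-15-3) (_ , refl , holey-14-4)
  step₀ (+0 2) _ _ = even (_ , refl , holey-33-3) (_ , refl , holey-32-4)
  step₀ (+0 v@(suc (suc (suc _)))) rec _ = even-triple _ (18v v) S (Even.has₀ S)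
    where S = proj₁ (rec (v<r+v*3 0 v (s≤s z≤n))) 3≤
  step₀ (+1 0) _ (s≤s ())
  step₀ (+1 1) _ _ = even (_ , refl , holey-21-3) (_ , refl , holey-20-4)
  step₀ (+1 v@(suc (suc _))) rec _ = even-triple _ (18v+6 v) S (Even.has₃ S)
    where S = proj₂ (rec (v<r+v*3 1 v (s≤s z≤n))) 2≤
  step₀ (+2 0) _ (s≤s (s≤s ()))
  step₀ (+2 1) _ _ = even (_ , refl , holey-27-3) (_ , refl , holey-26-4)
  step₀ (+2 v@(suc (suc _))) rec _ = even-triple _ (18v+12 v) S (Even.has₀ S)
    where S = proj₂ (rec (v<r+v*3 2 v (s≤s z≤n))) 2≤

  step₄ : ∀ {u} → Mod₃ u → (∀ {v} → v < u → P v) → 2 ≤ u → Even (4 + u * 6)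
  step₄ (+0 1) _ _ = even (_ , refl , holey-19-3) (_ , refl , holey-18-4)
  step₄ (+0 v@(suc (suc _))) rec _ = even-triple _ (18v+4 v) S (Even.has₄ S)
    where S = proj₂ (rec (v<r+v*3 0 v (s≤s z≤n))) 2≤
  step₄ (+1 0) _ (s≤s ())
  step₄ (+1 1) _ _ = even (_ , refl , holey-25-3) (_ , refl , holey-24-4)
  step₄ (+1 v@(suc (suc _))) rec _ = even-triple _ (18v+10 v) S (even-point S)
    where S = proj₂ (rec (v<r+v*3 1 v (s≤s z≤n))) 2≤
  step₄ (+2 0) _ _ = even (_ , refl , holey-13-3) (_ , refl , holey-12-4)
  step₄ (+2 1) _ _ = even (_ , refl , holey-31-3) (_ , refl , holey-30-4)
  step₄ (+2 v@(suc (suc _))) rec _ = even-triple _ (18v+16 v) S (even-point S)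
    where S = proj₁ (rec {suc v} (s≤s (s≤s (m≤m*n v 3)))) 3≤

data Mod₂ : ℕ → Set where
  +0 : ∀ v → Mod₂ (v * 2)
  +1 : ∀ v → Mod₂ (1 + v * 2)

mod₂ : ∀ n → Mod₂ n
mod₂ zero = +0 0
mod₂ (suc n) with mod₂ n
... | +0 v = +1 v
... | +1 v = +0 (suc v)

systems : ∀ q → (q ∉ 0 ∷ 2 ∷ 4 ∷ [] → Has (q * 3) 0) × (q ∉ 1 ∷ 3 ∷ [] → Has (1 + q * 3) 0)
systems = <-rec P λ q rec → step₀ (mod₂ q) rec , step₁ (mod₂ q) rec
  where
  P : ℕ → Set
  P q = (q ∉ 0 ∷ 2 ∷ 4 ∷ [] → Has (q * 3) 0) × (q ∉ 1 ∷ 3 ∷ [] → Has (1 + q * 3) 0)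

  S₇ : Has 7 0
  S₇ = has-double (3 , refl , holey-3-0)
  S₉ : Has 9 0
  S₉ = has-triple 9 refl (3 , refl , holey-3-0) (3 , refl , holey-3-0)

  6u : ∀ u → u * 6 ≡ u * 2 * 3
  6u = solve-∀
  6u+3 : ∀ u → (1 + u * 3) * 2 + 1 ≡ (1 + u * 2) * 3
  6u+3 = solve-∀
  6u+1 : ∀ u → u * 3 * 2 + 1 ≡ 1 + u * 2 * 3
  6u+1 = solve-∀
  6u+4 : ∀ u → 4 + u * 6 ≡ 1 + (1 + u * 2) * 3
  6u+4 = solve-∀

  u<u*2 : ∀ u → 0 < u → u < u * 2
  u<u*2 (suc u) _ = s≤s (s≤s (m≤m*n u 2))

  has : ∀ {m n} → m ≡ n → Has m 0 → Has n 0
  has refl S = S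

  step₀ : ∀ {q} → Mod₂ q → (∀ {v} → v < q → P v) → q ∉ 0 ∷ 2 ∷ 4 ∷ [] → Has (q * 3) 0
  step₀ (+0 0) _ q∉ = contradiction (here refl) q∉
  step₀ (+0 1) _ q∉ = contradiction (there (here refl)) q∉
  step₀ (+0 2) _ q∉ = contradiction (there (there (here refl))) q∉
  step₀ (+0 u@(suc (suc (suc _)))) _ _ = has (6u u) (Even.has₀ (proj₁ (even-systems u) (s≤s (s≤s (s≤s z≤n)))))
  -- Order 6 u + 3 is twice 3 u + 1 plus one. This fails when 3 u + 1 is 4 or 10; orders 9 and 21
  -- are tripled from 3 and 7 instead.
  step₀ (+1 u) rec _ with u ℕ.≟ 1 | u ℕ.≟ 3
  ... | yes refl | _ = S₉
  ... | _ | yes refl = has-triple 21 refl S₇ S₇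
  ... | no u≢1 | no u≢3 = has (6u+3 u) (has-double (proj₂ (rec (s≤s (m≤m*n u 2)))
          λ { (here eq) → u≢1 eq ; (there (here eq)) → u≢3 eq }))

  step₁ : ∀ {q} → Mod₂ q → (∀ {v} → v < q → P v) → q ∉ 1 ∷ 3 ∷ [] → Has (1 + q * 3) 0
  -- Order 6 u + 1 is twice 3 u plus one. Besides u = 0 this fails when 3 u is 6 or 12; order 13 is
  -- explicit and 25 = 3 · 9 - 2.
  step₁ (+0 u) rec _ with u ℕ.≟ 0 | u ℕ.≟ 2 | u ℕ.≟ 4
  ... | yes refl | _ | _ = 1 , refl , holey-1-0
  ... | _ | yes refl | _ = 13 , refl , holey-13-0
  ... | _ | _ | yes refl = has-triple 25 refl S₉ (has-point {8} S₉)
  ... | no u≢0 | no u≢2 | no u≢4 = has (6u+1 u) (has-double (proj₁ (rec (u<u*2 u (n≢0⇒n>0 u≢0)))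
          λ { (here eq) → u≢0 eq ; (there (here eq)) → u≢2 eq ; (there (there (here eq))) → u≢4 eq }))
  step₁ (+1 0) _ q∉ = contradiction (here refl) q∉
  step₁ (+1 1) _ q∉ = contradiction (there (here refl)) q∉
  step₁ (+1 u@(suc (suc _))) _ _ = has (6u+4 u) (Even.has₀ (proj₂ (even-systems u) (s≤s (s≤s z≤n))))

toLDTS : ∀ {n} → Has n 0 → FlexibleLDTS n
toLDTS S = ToLDTS.flexibleLDTS ↔-refl (full S)

existence : ∀ n .{{_ : NonZero n}} → n % 3 ≡ 0 ⊎ n % 3 ≡ 1 → n ∉ 4 ∷ 6 ∷ 10 ∷ 12 ∷ [] → FlexibleLDTS n
existence n r n∉ with mod₃ n | r
... | +0 q | _ = toLDTS (proj₁ (systems q) λ where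
    (here refl) → contradiction refl (≢-nonZero⁻¹ (q * 3))
    (there (here refl)) → n∉ (there (here refl))
    (there (there (here refl))) → n∉ (there (there (there (here refl)))))
... | +1 q | _ = toLDTS (proj₂ (systems q) λ where
    (here refl) → n∉ (here refl)
    (there (here refl)) → n∉ (there (there (here refl))))
... | +2 q | r = contradiction (subst (λ x → x ≡ 0 ⊎ x ≡ 1) ([m+kn]%n≡m%n 2 q 3) r) λ { (inj₁ ()) ; (inj₂ ()) }

-- Counting

𝟙 : Bool → ℕ
𝟙 true  = 1
𝟙 false = 0

count : ∀ {n} → (Fin n → Bool) → ℕ
count f = sum (𝟙 ∘ f)

erase : ∀ {n} → Fin n → (Fin n → ℕ) → Fin n → ℕ
erase i g j = if does (j ≟ᶠ i) then 0 else g j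

sum-erase : ∀ {n} (i : Fin n) g → sum g ≡ g i + sum (erase i g)
sum-erase zero    g = refl
sum-erase (suc i) g = begin
  g zero + sum (g ∘ suc)                               ≡⟨ cong (g zero +_) (sum-erase i (g ∘ suc)) ⟩
  g zero + (g (suc i) + sum (erase i (g ∘ suc)))       ≡⟨ swap (g zero) (g (suc i)) _ ⟩
  g (suc i) + (g zero + sum (erase i (g ∘ suc)))       ≡⟨ cong (λ s → g (suc i) + (g zero + s)) (sum-cong-≗ shift) ⟩
  g (suc i) + (g zero + sum (erase (suc i) g ∘ suc))   ∎
  where
  open ≡-Reasoning
  swap : ∀ a b c → a + (b + c) ≡ b + (a + c)
  swap = solve-∀
  shift : ∀ j → erase i (g ∘ suc) j ≡ erase (suc i) g (suc j)
  shift j with j ≟ᶠ i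
  ... | yes _ = refl
  ... | no _  = refl

-- By induction on m: a positive f zero is paid for by g at φ zero, which is then erased. Where f
-- vanishes nothing has to be paid, so φ may collide there.
sum-inject : ∀ {m n} (f : Fin m → ℕ) (g : Fin n → ℕ) (φ : Fin m → Fin n) → (∀ x → f x ≤ g (φ x)) →
             (∀ {x y} → 0 < f x → 0 < f y → φ x ≡ φ y → x ≡ y) → sum f ≤ sum g
sum-inject {zero}  f g φ f≤g inj = z≤n
sum-inject {suc m} f g φ f≤g inj = case (f zero) refl
  where
  inj′ : ∀ {x y} → 0 < f (suc x) → 0 < f (suc y) → φ (suc x) ≡ φ (suc y) → x ≡ y
  inj′ p q eq = suc-injective (inj p q eq)
  case : ∀ v → f zero ≡ v → sum f ≤ sum g
  case zero eq = subst (λ v → v + sum (f ∘ suc) ≤ sum g) (sym eq) (sum-inject (f ∘ suc) g (φ ∘ suc) (f≤g ∘ suc) inj′)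
  case (suc v) eq = ≤-trans (+-mono-≤ (f≤g zero) (sum-inject (f ∘ suc) (erase (φ zero) g) (φ ∘ suc) f≤g′ inj′))
                      (≤-reflexive (sym (sum-erase (φ zero) g)))
    where
    f≤g′ : ∀ x → f (suc x) ≤ erase (φ zero) g (φ (suc x))
    f≤g′ x with φ (suc x) ≟ᶠ φ zero
    ... | no _ = f≤g (suc x)
    ... | yes same with f (suc x) in eq′
    ...   | zero = z≤n
    ...   | suc _ = contradiction (inj (subst (0 <_) (sym eq′) (s≤s z≤n)) (subst (0 <_) (sym eq) (s≤s z≤n)) same) λ ()

T⇒1≤ : ∀ {b} → T b → 1 ≤ 𝟙 b
T⇒1≤ {true} _ = ≤-refl

1≤⇒T : ∀ {b} → 0 < 𝟙 b → T b
1≤⇒T {true} _ = tt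

𝟙-mono : ∀ {a b} → (T a → T b) → 𝟙 a ≤ 𝟙 b
𝟙-mono {false} _ = z≤n
𝟙-mono {true}  f = T⇒1≤ (f tt)

count-inject : ∀ {m n} (f : Fin m → Bool) (g : Fin n → Bool) (φ : Fin m → Fin n) → (∀ x → T (f x) → T (g (φ x))) →
               (∀ {x y} → T (f x) → T (f y) → φ x ≡ φ y → x ≡ y) → count f ≤ count g
count-inject f g φ hom inj = sum-inject (𝟙 ∘ f) (𝟙 ∘ g) φ (λ x → 𝟙-mono (hom x)) (λ p q → inj (1≤⇒T p) (1≤⇒T q))

count-biject : ∀ {m n} (f : Fin m → Bool) (g : Fin n → Bool) (φ : Fin m → Fin n) (ψ : Fin n → Fin m) →
               (∀ x → T (f x) → T (g (φ x)) × ψ (φ x) ≡ x) → (∀ y → T (g y) → T (f (ψ y)) × φ (ψ y) ≡ y) →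
               count f ≡ count g
count-biject f g φ ψ to from = ≤-antisym
  (count-inject f g φ (λ x → proj₁ ∘ to x)
     λ p q eq → trans (sym (proj₂ (to _ p))) (trans (cong ψ eq) (proj₂ (to _ q))))
  (count-inject g f ψ (λ y → proj₁ ∘ from y)
     λ p q eq → trans (sym (proj₂ (from _ p))) (trans (cong φ eq) (proj₂ (from _ q))))

count-split : ∀ {n} (f p : Fin n → Bool) → count f ≡ count (λ x → f x ∧ p x) + count (λ x → f x ∧ not (p x))
count-split f p = trans (sum-cong-≗ λ x → split (f x) (p x)) (∑-distrib-+ (λ x → 𝟙 (f x ∧ p x)) (λ x → 𝟙 (f x ∧ not (p x))))
  where
  split : ∀ a b → 𝟙 a ≡ 𝟙 (a ∧ b) + 𝟙 (a ∧ not b)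
  split true  true  = refl
  split true  false = refl
  split false _     = refl

count-cong : ∀ {n} {f g : Fin n → Bool} → (∀ x → T (f x) → T (g x)) → (∀ x → T (g x) → T (f x)) → count f ≡ count g
count-cong {f = f} {g} p q = ≤-antisym (count-inject f g (λ x → x) p λ _ _ eq → eq)
                                       (count-inject g f (λ x → x) q λ _ _ eq → eq)

_≺_ : ∀ {n} → Fin n → Fin n → Bool
i ≺ j = toℕ i <ᵇ toℕ j

≺⁻ : ∀ {n} {i j : Fin n} → T (i ≺ j) → toℕ i < toℕ j
≺⁻ {i = i} = <ᵇ⇒< (toℕ i) _

≺-flip : ∀ {n} {i j : Fin n} → i ≢ j → T (not (i ≺ j)) → T (j ≺ i)
≺-flip i≢j p = <⇒<ᵇ (≤∧≢⇒< (≮⇒≥ λ lt → not⁻ p (<⇒<ᵇ lt)) λ eq → i≢j (sym (toℕ-injective eq)))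

≺-asym : ∀ {n} {i j : Fin n} → T (i ≺ j) → T (not (j ≺ i))
≺-asym {i = i} {j} p = not⁺ λ q → <-asym (≺⁻ {i = i} p) (≺⁻ {i = j} q)

-- σ exchanges the points x with x ≺ σ x and the remaining ones.
count-involution : ∀ {n} (f : Fin n → Bool) (σ : Fin n → Fin n) →
                   (∀ x → T (f x) → T (f (σ x)) × σ (σ x) ≡ x × σ x ≢ x) → ∃ λ k → count f ≡ 2 * k
count-involution f σ σ-inv = count f₁ , (begin
  count f             ≡⟨ count-split f (λ x → x ≺ σ x) ⟩
  count f₁ + count f₂ ≡⟨ cong (count f₁ +_) (count-biject f₁ f₂ σ σ to from) ⟨
  count f₁ + count f₁ ≡⟨ cong (count f₁ +_) (+-identityʳ (count f₁)) ⟨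
  2 * count f₁        ∎)
  where
  open ≡-Reasoning
  f₁ f₂ : _ → Bool
  f₁ x = f x ∧ (x ≺ σ x)
  f₂ x = f x ∧ not (x ≺ σ x)
  to : ∀ x → T (f₁ x) → T (f₂ (σ x)) × σ (σ x) ≡ x
  to x p with ∧⁻ {f x} p
  ... | fx , lt with σ-inv x fx
  ...   | fσx , σσx≡x , _ = ∧⁺ fσx (subst (λ v → T (not (σ x ≺ v))) (sym σσx≡x) (≺-asym {i = x} lt)) , σσx≡x
  from : ∀ x → T (f₂ x) → T (f₁ (σ x)) × σ (σ x) ≡ x
  from x p with ∧⁻ {f x} p
  ... | fx , ge with σ-inv x fx
  ...   | fσx , σσx≡x , σx≢x = ∧⁺ fσx (subst (λ v → T (σ x ≺ v)) (sym σσx≡x) (≺-flip (≢-sym σx≢x) ge)) , σσx≡x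

<ᵇ-swap : ∀ {a b} → a ≢ b → (b <ᵇ a) ≡ not (a <ᵇ b)
<ᵇ-swap {a} {b} a≢b with a <ᵇ b in p | b <ᵇ a in q
... | true  | true  = contradiction (<ᵇ⇒< b a (subst T (sym q) tt)) (<-asym (<ᵇ⇒< a b (subst T (sym p) tt)))
... | true  | false = refl
... | false | true  = refl
... | false | false = contradiction (≤-antisym (≮⇒≥ λ lt → subst T q (<⇒<ᵇ lt)) (≮⇒≥ λ lt → subst T p (<⇒<ᵇ lt))) a≢b

-- The six comparisons are determined by three of them, and of the eight outcomes only the two
-- cyclic ones fail; they contradict transitivity.
unique-least : ∀ {a b c} → a ≢ b → b ≢ c → c ≢ a →
               1 ≡ 𝟙 ((a <ᵇ b) ∧ (a <ᵇ c)) + (𝟙 ((b <ᵇ c) ∧ (b <ᵇ a)) + 𝟙 ((c <ᵇ a) ∧ (c <ᵇ b)))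
unique-least {a} {b} {c} a≢b b≢c c≢a
  rewrite <ᵇ-swap a≢b | <ᵇ-swap b≢c | <ᵇ-swap c≢a
  with a <ᵇ b in ab | b <ᵇ c in bc | c <ᵇ a in ca
... | true  | true  | true  = contradiction (<-trans (lt {b} bc) (lt {c} ca)) (<-asym (lt {a} ab))
  where
  lt : ∀ {x y} → (x <ᵇ y) ≡ true → x < y
  lt {x} {y} eq = <ᵇ⇒< x y (subst T (sym eq) tt)
... | true  | true  | false = refl
... | true  | false | true  = refl
... | true  | false | false = refl
... | false | true  | true  = refl
... | false | true  | false = refl
... | false | false | true  = refl
... | false | false | false = contradiction (≤-trans (ge {a} ab) (ge {c} ca)) (<⇒≱ (≤∧≢⇒< (ge {b} bc) (≢-sym b≢c)))
  where
  ge : ∀ {x y} → (x <ᵇ y) ≡ false → y ≤ x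
  ge eq = ≮⇒≥ λ lt → subst T eq (<⇒<ᵇ lt)

-- Every orbit has three elements, exactly one of which is minimal.
count-order3 : ∀ {n} (f : Fin n → Bool) (σ : Fin n → Fin n) →
               (∀ x → T (f x) → T (f (σ x)) × σ (σ (σ x)) ≡ x × σ x ≢ x) → ∃ λ k → count f ≡ 3 * k
count-order3 {n} f σ σ-ord = count f₀ , (begin
  count f                                 ≡⟨ sum-cong-≗ one ⟩
  sum (λ x → 𝟙 (f₀ x) + (𝟙 (f₁ x) + 𝟙 (f₂ x)))
    ≡⟨ trans (∑-distrib-+ (𝟙 ∘ f₀) _) (cong (count f₀ +_) (∑-distrib-+ (𝟙 ∘ f₁) (𝟙 ∘ f₂))) ⟩
  count f₀ + (count f₁ + count f₂)        ≡⟨ cong₂ (λ a b → count f₀ + (a + b)) f₁≡f₀ f₂≡f₀ ⟩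
  count f₀ + (count f₀ + count f₀)        ≡⟨ thrice (count f₀) ⟩
  3 * count f₀                            ∎)
  where
  open ≡-Reasoning
  thrice : ∀ a → a + (a + a) ≡ 3 * a
  thrice = solve-∀
  least : Fin n → Bool
  least x = (x ≺ σ x) ∧ (x ≺ σ (σ x))
  f₀ f₁ f₂ : Fin n → Bool
  f₀ x = f x ∧ least x
  f₁ x = f x ∧ least (σ x)
  f₂ x = f x ∧ least (σ (σ x))

  σf : ∀ {x} → T (f x) → T (f (σ x))
  σf {x} p = proj₁ (σ-ord x p)
  σ³ : ∀ {x} → T (f x) → σ (σ (σ x)) ≡ x
  σ³ {x} p = proj₁ (proj₂ (σ-ord x p))

  f₁≡f₀ : count f₁ ≡ count f₀
  f₁≡f₀ = count-biject f₁ f₀ σ (σ ∘ σ)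
    (λ x p → let fx , m = ∧⁻ {f x} p in ∧⁺ (σf fx) m , σ³ fx)
    (λ x p → let fx , m = ∧⁻ {f x} p in ∧⁺ (σf (σf fx)) (subst (T ∘ least) (sym (σ³ fx)) m) , σ³ fx)

  f₂≡f₀ : count f₂ ≡ count f₀
  f₂≡f₀ = count-biject f₂ f₀ (σ ∘ σ) σ
    (λ x p → let fx , m = ∧⁻ {f x} p in ∧⁺ (σf (σf fx)) m , σ³ fx)
    (λ x p → let fx , m = ∧⁻ {f x} p in ∧⁺ (σf fx) (subst (T ∘ least) (sym (σ³ fx)) m) , σ³ fx)

  one : ∀ x → 𝟙 (f x) ≡ 𝟙 (f₀ x) + (𝟙 (f₁ x) + 𝟙 (f₂ x))
  one x with f x in eq
  ... | false = refl
  ... | true = subst₂ (λ u v → 1 ≡ 𝟙 (least x) + (𝟙 ((σ x ≺ σ (σ x)) ∧ (σ x ≺ u)) + 𝟙 ((σ (σ x) ≺ u) ∧ (σ (σ x) ≺ v))))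
      (sym (σ³ fx)) (sym (cong σ (σ³ fx)))
      (unique-least (σ-moves fx) (σ-moves (σf fx)) (λ e → σ-moves (σf (σf fx)) (trans e (sym (cong toℕ (σ³ fx))))))
    where
    fx : T (f x)
    fx = subst T (sym eq) tt
    σ-moves : ∀ {y} → T (f y) → toℕ y ≢ toℕ (σ y)
    σ-moves {y} p e = proj₂ (proj₂ (σ-ord y p)) (sym (toℕ-injective e))

∑-const : ∀ m c → sum {m} (λ _ → c) ≡ m * c
∑-const zero    c = refl
∑-const (suc m) c = cong (c +_) (∑-const m c)

count-one : ∀ {n} (y : Fin n) → count (λ x → does (x ≟ᶠ y)) ≡ 1
count-one {suc n} zero = cong suc (trans (∑-const n 0) (*-zeroʳ n))
count-one (suc y) = count-one y

count-witness : ∀ {n} (f : Fin n → Bool) → 1 ≤ count f → ∃ λ x → T (f x)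
count-witness {zero} f ()
count-witness {suc n} f p with f zero in eq
... | true = zero , subst T (sym eq) tt
... | false = let x , q = count-witness (f ∘ suc) p in suc x , q

-- Bipyramids and triangles

-- The kind of an ordered pair: Δ if its triple occurs in both directions,
-- and otherwise the role of the pair.  A pair (x , y) of kind P says that y
-- is a pole of a bipyramid with x on its rim.
data Kind : Set where
  P Q O Δ : Kind

_≡ᵏ_ : Kind → Kind → Bool
P ≡ᵏ P = true
Q ≡ᵏ Q = true
O ≡ᵏ O = true
Δ ≡ᵏ Δ = true
_ ≡ᵏ _ = false

≡ᵏ-refl : ∀ κ → T (κ ≡ᵏ κ)
≡ᵏ-refl P = tt
≡ᵏ-refl Q = tt
≡ᵏ-refl O = tt
≡ᵏ-refl Δ = tt

≡ᵏ⇒≡ : ∀ {κ μ} → T (κ ≡ᵏ μ) → κ ≡ μ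
≡ᵏ⇒≡ {P} {P} _ = refl
≡ᵏ⇒≡ {Q} {Q} _ = refl
≡ᵏ⇒≡ {O} {O} _ = refl
≡ᵏ⇒≡ {Δ} {Δ} _ = refl

flip : Kind → Kind
flip P = Q
flip Q = P
flip O = O
flip Δ = Δ

module Kinds {n : ℕ} (S : System (Fin n) ∅) where
  open System S
  V = Fin n

  op : V → V → V
  op a b = proj₂ (cell a b)

  fromRole : Role → Kind
  fromRole XY = P
  fromRole YZ = Q
  fromRole XZ = O

  kind : V → V → Kind
  kind a b with op a b ≟ᶠ op b a
  ... | yes _ = Δ
  ... | no _  = fromRole (proj₁ (cell a b))

  record Val (a b : V) (κ : Kind) (z : V) : Set where
    constructor val
    field
      a≢b  : a ≢ b
      kd   : kind a b ≡ κ
      flip-kd : kind b a ≡ flip κ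
      target : op a b ≡ z

  record Bip (x y z : V) : Set where
    constructor bip
    field
      blk  : Block (Off ∅) cell x y z
      two-poles : op z x ≢ y

  private
    B : V → V → V → Set
    B = Block (Off ∅) cell

    next : ∀ {x y z} → B x y z → B z y (op z y)
    next b = proj₁ (Closed-next cover b)
    back : ∀ {x y z} → B x y z → B z (op z x) x
    back b = proj₁ (proj₂ (Closed-next cover b))
    shift : ∀ {x y z} → B x y z → B (op z y) (op z x) z
    shift b = proj₂ (proj₂ (Closed-next cover b))
    prev : ∀ {x y z} → B x y z → B (op x (op z x)) y x
    prev b = proj₁ (Closed-prev cover b)

    kind-Δ : ∀ {a b} → op a b ≡ op b a → kind a b ≡ Δ
    kind-Δ {a} {b} eq with op a b ≟ᶠ op b a
    ... | yes _ = refl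
    ... | no ¬eq = contradiction eq ¬eq

    kind-role : ∀ {a b r z} → op a b ≢ op b a → cell a b ≡ (r , z) → kind a b ≡ fromRole r
    kind-role {a} {b} ¬comm eq with op a b ≟ᶠ op b a
    ... | yes comm = contradiction comm ¬comm
    ... | no _ = cong (fromRole ∘ proj₁) eq

    third≡ : ∀ {a b r} {z : V} → cell a b ≡ (r , z) → op a b ≡ z
    third≡ = cong proj₂

    uniqueʸ : ∀ {x y y′ z} → B x y z → B x y′ z → y ≡ y′
    uniqueʸ b b′ = ,-injectiveʳ (trans (sym (Block.cxz b)) (Block.cxz b′))

  Bip-next : ∀ {x y z} → Bip x y z → Bip z y (op z y)
  Bip-next (bip b c≢y) = bip (next b) λ eq → c≢y (trans (sym (third≡ (Block.cxz (shift b)))) eq)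

  Bip-back : ∀ {x y z} → Bip x y z → Bip z (op z x) x
  Bip-back (bip b c≢y) = bip (back b) λ eq → c≢y (trans (sym eq) (third≡ (Block.cxz b)))

  Bip-shift : ∀ {x y z} → Bip x y z → Bip (op z y) (op z x) z
  Bip-shift (bip b c≢y) = bip (shift b) λ eq → c≢y (trans (sym eq) (third≡ (Block.cxz (next b))))

  private
    -- Equality means that the rim points before and after x coincide. Then ⟨ z , y , x ⟩ and ⟨ z ,
    -- c , x ⟩ share the pair (z , x), so the poles are equal.
    asymᴾ : ∀ {x y z} → Bip x y z → op x y ≢ op y x
    asymᴾ {x} {y} {z} (bip b c≢y) eq = c≢y (sym (uniqueʸ (subst (λ v → B v y x) w≡z (prev b)) (back b)))
      where
      w≡z : op x (op z x) ≡ z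
      w≡z = trans (sym (third≡ (Block.cyz (prev b)))) (trans (sym eq) (third≡ (Block.cxy b)))

    asymᴼ : ∀ {x y z} → Bip x y z → op x z ≢ op z x
    asymᴼ (bip b c≢y) eq = c≢y (trans (sym eq) (third≡ (Block.cxz b)))

    kind-xy : ∀ {x y z} → Bip x y z → kind x y ≡ P
    kind-xy p@(bip b _) = kind-role (asymᴾ p) (Block.cxy b)
    kind-yx : ∀ {x y z} → Bip x y z → kind y x ≡ Q
    kind-yx p@(bip b _) = kind-role (≢-sym (asymᴾ p)) (Block.cyz (prev b))
    kind-xz : ∀ {x y z} → Bip x y z → kind x z ≡ O
    kind-xz p@(bip b _) = kind-role (asymᴼ p) (Block.cxz b)

  Bip-xy : ∀ {x y z} → Bip x y z → Val x y P z
  Bip-xy p@(bip b _) = val (proj₁ (Block.Dxy b)) (kind-xy p) (kind-yx p) (third≡ (Block.cxy b))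

  Bip-yz : ∀ {x y z} → Bip x y z → Val y z Q x
  Bip-yz p@(bip b _) = val (proj₁ (Block.Dyz b)) (kind-yx (Bip-next p)) (kind-xy (Bip-next p)) (third≡ (Block.cyz b))

  Bip-xz : ∀ {x y z} → Bip x y z → Val x z O y
  Bip-xz p@(bip b _) = val (proj₁ (Block.Dxz b)) (kind-xz p) (kind-xz (Bip-back p)) (third≡ (Block.cxz b))

  data View (a b : V) : V → Set where
    vP : ∀ {z} → Bip a b z → View a b z
    vQ : ∀ {z} → Bip z a b → View a b z
    vO : ∀ {z} → Bip a z b → View a b z
    vΔ : ∀ {z} → Val a b Δ z → Val a z Δ b → Val b z Δ a → View a b z

  private
    Tri-val : ∀ {x y z} → B x y z → B z y x → Val x y Δ z × Val x z Δ y × Val y z Δ x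
    Tri-val b b′ =
      Δval (proj₁ (Block.Dxy b)) (third≡ (Block.cxy b)) (third≡ (Block.cyz b′)) ,
      Δval (proj₁ (Block.Dxz b)) (third≡ (Block.cxz b)) (third≡ (Block.cxz b′)) ,
      Δval (proj₁ (Block.Dyz b)) (third≡ (Block.cyz b)) (third≡ (Block.cxy b′))
      where
      Δval : ∀ {a b z} → a ≢ b → op a b ≡ z → op b a ≡ z → Val a b Δ z
      Δval a≢b p q = val a≢b (kind-Δ (trans p (sym q))) (kind-Δ (trans q (sym p))) p

    bip-or-tri : ∀ {x y z} → B x y z → Bip x y z ⊎ B z y x
    bip-or-tri {x} {y} {z} b with op z x ≟ᶠ y
    ... | yes c≡y = inj₂ (subst (λ v → B z v x) c≡y (back b))
    ... | no c≢y  = inj₁ (bip b c≢y)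

  Val-Δ-sym : ∀ {a b z} → Val a b Δ z → Val b a Δ z
  Val-Δ-sym {a} {b} (val a≢b k f t) = val (≢-sym a≢b) f k (trans (sym (commute k)) t)
    where
    commute : kind a b ≡ Δ → op a b ≡ op b a
    commute k with op a b ≟ᶠ op b a
    ... | yes eq = eq
    ... | no _ with proj₁ (cell a b)
    commute () | no _ | XY
    commute () | no _ | YZ
    commute () | no _ | XZ

  view : ∀ {a b} → a ≢ b → View a b (op a b)
  view a≢b with cover (off a≢b)
  view a≢b | asXY c with bip-or-tri (Closed.self c)
  ... | inj₁ p rewrite third≡ (Block.cxy (Closed.self c)) = vP p
  ... | inj₂ b′ rewrite third≡ (Block.cxy (Closed.self c)) =
    let p , q , r = Tri-val (Closed.self c) b′ in vΔ p q r
  view a≢b | asYZ c with bip-or-tri (Closed.self c)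
  ... | inj₁ p rewrite third≡ (Block.cyz (Closed.self c)) = vQ p
  ... | inj₂ b′ rewrite third≡ (Block.cyz (Closed.self c)) =
    let p , q , r = Tri-val (Closed.self c) b′ in vΔ r (Val-Δ-sym p) (Val-Δ-sym q)
  view a≢b | asXZ c with bip-or-tri (Closed.self c)
  ... | inj₁ p rewrite third≡ (Block.cxz (Closed.self c)) = vO p
  ... | inj₂ b′ rewrite third≡ (Block.cxz (Closed.self c)) =
    let p , q , r = Tri-val (Closed.self c) b′ in vΔ q p (Val-Δ-sym r)

  view′ : ∀ {a b z} → a ≢ b → op a b ≡ z → View a b z
  view′ a≢b refl = view a≢b

  isP : ∀ {a b} → a ≢ b → kind a b ≡ P → Bip a b (op a b)
  isP a≢b k with view a≢b
  ... | vP p = p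
  ... | vQ p = contradiction (trans (sym k) (Val.kd (Bip-yz p))) λ ()
  ... | vO p = contradiction (trans (sym k) (Val.kd (Bip-xz p))) λ ()
  ... | vΔ v _ _ = contradiction (trans (sym k) (Val.kd v)) λ ()

  isQ : ∀ {a b} → a ≢ b → kind a b ≡ Q → Bip (op a b) a b
  isQ a≢b k with view a≢b
  ... | vP p = contradiction (trans (sym k) (Val.kd (Bip-xy p))) λ ()
  ... | vQ p = p
  ... | vO p = contradiction (trans (sym k) (Val.kd (Bip-xz p))) λ ()
  ... | vΔ v _ _ = contradiction (trans (sym k) (Val.kd v)) λ ()

  isO : ∀ {a b} → a ≢ b → kind a b ≡ O → Bip a (op a b) b
  isO a≢b k with view a≢b
  ... | vP p = contradiction (trans (sym k) (Val.kd (Bip-xy p))) λ ()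
  ... | vQ p = contradiction (trans (sym k) (Val.kd (Bip-yz p))) λ ()
  ... | vO p = p
  ... | vΔ v _ _ = contradiction (trans (sym k) (Val.kd v)) λ ()

  isΔ : ∀ {a b} → a ≢ b → kind a b ≡ Δ → Val a b Δ (op a b) × Val a (op a b) Δ b × Val b (op a b) Δ a
  isΔ a≢b k with view a≢b
  ... | vP p = contradiction (trans (sym k) (Val.kd (Bip-xy p))) λ ()
  ... | vQ p = contradiction (trans (sym k) (Val.kd (Bip-yz p))) λ ()
  ... | vO p = contradiction (trans (sym k) (Val.kd (Bip-xz p))) λ ()
  ... | vΔ p q r = p , q , r

  kind-flip : ∀ {a b} → a ≢ b → kind b a ≡ flip (kind a b)
  kind-flip {a} {b} a≢b with kind a b in k
  ... | P = Val.flip-kd (Bip-xy (isP a≢b k))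
  ... | Q = Val.flip-kd (Bip-yz (isQ a≢b k))
  ... | O = Val.flip-kd (Bip-xz (isO a≢b k))
  ... | Δ = Val.flip-kd (proj₁ (isΔ a≢b k))

  select : Kind → V → V → Bool
  select κ y x = not (does (x ≟ᶠ y)) ∧ (kind y x ≡ᵏ κ)

  select⁺ : ∀ {κ y x} → x ≢ y → kind y x ≡ κ → T (select κ y x)
  select⁺ {κ} {y} {x} x≢y refl with x ≟ᶠ y
  ... | yes x≡y = contradiction x≡y x≢y
  ... | no _ = ≡ᵏ-refl κ

  select⁻ : ∀ {κ y x} → T (select κ y x) → y ≢ x × kind y x ≡ κ
  select⁻ {κ} {y} {x} p with x ≟ᶠ y
  ... | no x≢y = ≢-sym x≢y , ≡ᵏ⇒≡ p

  select-val : ∀ {y x κ z} → Val y x κ z → T (select κ y x)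
  select-val v = select⁺ (≢-sym (Val.a≢b v)) (Val.kd v)

  N : Kind → V → ℕ
  N κ y = count (select κ y)

  N-total : ∀ y → N P y + N Q y + (N O y + N Δ y) + 1 ≡ n
  N-total y = begin
    N P y + N Q y + (N O y + N Δ y) + 1
      ≡⟨ cong₂ (λ a b → a + b + 1) (∑-distrib-+ (𝟙 ∘ select P y) _) (∑-distrib-+ (𝟙 ∘ select O y) _) ⟨
    sum f + sum g + 1
      ≡⟨ cong₂ _+_ (∑-distrib-+ f g) (count-one y) ⟨
    sum (λ x → f x + g x) + count (λ x → does (x ≟ᶠ y))
      ≡⟨ ∑-distrib-+ (λ x → f x + g x) _ ⟨
    sum (λ x → f x + g x + 𝟙 (does (x ≟ᶠ y)))
      ≡⟨ sum-cong-≗ each ⟩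
    sum {n} (λ _ → 1)
      ≡⟨ trans (∑-const n 1) (*-identityʳ n) ⟩
    n ∎
    where
    open ≡-Reasoning
    f g : V → ℕ
    f x = 𝟙 (select P y x) + 𝟙 (select Q y x)
    g x = 𝟙 (select O y x) + 𝟙 (select Δ y x)
    each : ∀ x → f x + g x + 𝟙 (does (x ≟ᶠ y)) ≡ 1
    each x with x ≟ᶠ y
    ... | yes _ = refl
    ... | no _ with kind y x
    ...   | P = refl
    ...   | Q = refl
    ...   | O = refl
    ...   | Δ = refl

  -- Both count the triples of bipyramids that start at y, by their last and by their middle point.
  N-O≡P : ∀ y → N O y ≡ N P y
  N-O≡P y = count-biject (select O y) (select P y) (op y) (op y)
    (λ z s → let a , k = select⁻ {O} s ; b = isO a k in select-val (Bip-xy b) , Val.target (Bip-xy b))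
    (λ x s → let a , k = select⁻ {P} s ; b = isP a k in select-val (Bip-xz b) , Val.target (Bip-xz b))

  ∑N-Q≡P : sum (N Q) ≡ sum (N P)
  ∑N-Q≡P = begin
    sum (λ y → sum (λ x → 𝟙 (select Q y x))) ≡⟨ ∑-comm (λ y x → 𝟙 (select Q y x)) ⟩
    sum (λ x → sum (λ y → 𝟙 (select Q y x))) ≡⟨ sum-cong-≗ (λ x → count-cong (to x) (from x)) ⟩
    sum (N P)                                ∎
    where
    open ≡-Reasoning
    to : ∀ x y → T (select Q y x) → T (select P x y)
    to x y s = let a , k = select⁻ {Q} s in select⁺ a (trans (kind-flip a) (cong flip k))
    from : ∀ x y → T (select P x y) → T (select Q y x)
    from x y s = let a , k = select⁻ {P} s in select⁺ a (trans (kind-flip a) (cong flip k))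

  -- c is sent to the other pole of the bipyramid with y on its rim.
  N-P-even : ∀ y → ∃ λ k → N P y ≡ 2 * k
  N-P-even y = count-involution (select P y) (λ c → op (op y c) y) λ c s →
    let a , k = select⁻ {P} s
        b     = isP a k
        b′    = Bip-back b
        b″    = subst (λ v → Bip (op y (op (op y c) y)) v y) (Val.target (Bip-xz b)) (Bip-shift b′)
    in select-val (Bip-xy (Bip-next b′)) , Val.target (Bip-xz b″) , Bip.two-poles b

  N-Δ-even : ∀ y → ∃ λ k → N Δ y ≡ 2 * k
  N-Δ-even y = count-involution (select Δ y) (op y) λ x s →
    let a , k = select⁻ {Δ} s ; _ , v , w = isΔ a k
    in select-val v , Val.target v , ≢-sym (Val.a≢b w)

  -- All rims have length three: x ↦ `op x y` moves along a rim with pole y.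
  Short : Set
  Short = ∀ {x y} → x ≢ y → kind x y ≡ P → op (op (op x y) y) y ≡ x

  private
    around : ∀ {y x} → y ≢ x → kind y x ≡ Q → Bip x y (op x y)
    around a k = Bip-next (isQ a k)

  N-Q-triple : Short → ∀ y → ∃ λ k → N Q y ≡ 3 * k
  N-Q-triple short y = count-order3 (select Q y) (λ x → op x y) λ x s →
    let a , k = select⁻ {Q} s ; b = around a k
    in select-val (Bip-yz b) , short (≢-sym a) (trans (kind-flip a) (cong flip k)) , ≢-sym (Val.a≢b (Bip-xz b))

  -- The next rim point is a second one. A third is not asked for: in even order the degree equation
  -- makes the number odd, so excluding 1 gives at least 3.
  N-Q≥2 : ∀ {y x} → y ≢ x → kind y x ≡ Q → 2 ≤ N Q y
  N-Q≥2 {y} {x} a k = count-inject {2} (λ _ → true) (select Q y) φ hom inj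
    where
    b = around a k
    φ : Fin 2 → V
    φ zero = x
    φ (suc zero) = op x y
    hom : ∀ i → T true → T (select Q y (φ i))
    hom zero _ = select⁺ (≢-sym a) k
    hom (suc zero) _ = select-val (Bip-yz b)
    inj : ∀ {i j} → T true → T true → φ i ≡ φ j → i ≡ j
    inj {zero} {zero} _ _ _ = refl
    inj {zero} {suc zero} _ _ eq = contradiction eq (Val.a≢b (Bip-xz b))
    inj {suc zero} {zero} _ _ eq = contradiction (sym eq) (Val.a≢b (Bip-xz b))
    inj {suc zero} {suc zero} _ _ _ = refl

  ∃Q : ∀ {y} → 1 ≤ N Q y → ∃ λ x → y ≢ x × kind y x ≡ Q
  ∃Q {y} 1≤N = let x , s = count-witness (select Q y) 1≤N in x , select⁻ {Q} s

  -- Here p points lie on the rims of bipyramids with pole y, y lies on the rims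
  -- of a bipyramids, and b bidirectional triples pass through y.
  record Profile (y : V) : Set where
    field
      p a b  : ℕ
      p≡     : N Q y ≡ p
      a≡     : N P y ≡ 2 * a
      b≡     : N Δ y ≡ 2 * b
      degree : p + (2 * (2 * a) + 2 * b) + 1 ≡ n

  profile : ∀ y → Profile y
  profile y with N-P-even y | N-Δ-even y
  ... | a , a≡ | b , b≡ = record { p = N Q y ; a = a ; b = b ; p≡ = refl ; a≡ = a≡ ; b≡ = b≡ ; degree = degree }
    where
    open ≡-Reasoning
    arrange : ∀ p q t → p + (2 * q + t) + 1 ≡ q + p + (q + t) + 1
    arrange = solve-∀
    degree : N Q y + (2 * (2 * a) + 2 * b) + 1 ≡ n
    degree = begin
      N Q y + (2 * (2 * a) + 2 * b) + 1   ≡⟨ cong₂ (λ u v → N Q y + (2 * u + v) + 1) a≡ b≡ ⟨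
      N Q y + (2 * N P y + N Δ y) + 1     ≡⟨ arrange (N Q y) (N P y) (N Δ y) ⟩
      N P y + N Q y + (N P y + N Δ y) + 1 ≡⟨ cong (λ v → N P y + N Q y + (v + N Δ y) + 1) (N-O≡P y) ⟨
      N P y + N Q y + (N O y + N Δ y) + 1 ≡⟨ N-total y ⟩
      n                                   ∎

  weight : V → ℕ
  weight y = 3 * N Q y + N Δ y

  -- Over all ordered pairs the kinds P, Q and O are equally frequent, so three times the number of
  -- Q accounts for everything except Δ.
  ∑-weight : sum weight + n ≡ n * n
  ∑-weight = begin
    sum weight + n
      ≡⟨ cong (_+ n) (∑-distrib-+ (λ y → 3 * N Q y) (N Δ)) ⟩
    sum (λ y → 3 * N Q y) + sum (N Δ) + n
      ≡⟨ cong (λ s → s + sum (N Δ) + n) (trans (∑-distrib-+ (N Q) _) (cong (sum (N Q) +_) (trans (∑-distrib-+ (N Q) _)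
           (cong (sum (N Q) +_) (sum-cong-≗ (λ y → +-identityʳ (N Q y))))))) ⟩
    sum (N Q) + (sum (N Q) + sum (N Q)) + sum (N Δ) + n
      ≡⟨ cong₂ (λ u v → u + (sum (N Q) + v) + sum (N Δ) + n) ∑N-Q≡P (trans ∑N-Q≡P (sym (sum-cong-≗ N-O≡P))) ⟩
    sum (N P) + (sum (N Q) + sum (N O)) + sum (N Δ) + n
      ≡⟨ arrange (sum (N P)) (sum (N Q)) (sum (N O)) (sum (N Δ)) n ⟩
    sum (N P) + sum (N Q) + (sum (N O) + sum (N Δ)) + n
      ≡⟨ cong₂ (λ u v → u + v + n) (∑-distrib-+ (N P) (N Q)) (∑-distrib-+ (N O) (N Δ)) ⟨
    sum (λ y → N P y + N Q y) + sum (λ y → N O y + N Δ y) + n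
      ≡⟨ cong₂ _+_ (∑-distrib-+ (λ y → N P y + N Q y) _) (trans (∑-const n 1) (*-identityʳ n)) ⟨
    sum (λ y → N P y + N Q y + (N O y + N Δ y)) + sum {n} (λ _ → 1)
      ≡⟨ ∑-distrib-+ (λ y → N P y + N Q y + (N O y + N Δ y)) _ ⟨
    sum (λ y → N P y + N Q y + (N O y + N Δ y) + 1)
      ≡⟨ sum-cong-≗ N-total ⟩
    sum {n} (λ _ → n)
      ≡⟨ ∑-const n n ⟩
    n * n ∎
    where
    open ≡-Reasoning
    arrange : ∀ p q o t n → p + (q + o) + t + n ≡ p + q + (o + t) + n
    arrange = solve-∀

-- Non-existence

-- Each triple covers one ordered pair in each of the three roles.
module ModThree {n : ℕ} (S : System (Fin n) ∅) where
  open System S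
  private
    V = Fin n

    op : V → V → V
    op a b = proj₂ (cell a b)

    select : Role → V → V → Bool
    select r y x = not (does (x ≟ᶠ y)) ∧ (proj₁ (cell y x) =ᵇ r)

    =ᵇ-refl : ∀ r → T (r =ᵇ r)
    =ᵇ-refl XY = tt
    =ᵇ-refl YZ = tt
    =ᵇ-refl XZ = tt

    select⁺ : ∀ {r y x z} → Off ∅ y x → cell y x ≡ (r , z) → T (select r y x) × op y x ≡ z
    select⁺ {r} {y} {x} (y≢x , _) eq with x ≟ᶠ y
    ... | yes x≡y = contradiction (sym x≡y) y≢x
    ... | no _ rewrite eq = =ᵇ-refl r , refl

    select⁻ : ∀ {r y x} → T (select r y x) → Off ∅ y x × cell y x ≡ (r , op y x)
    select⁻ {r} {y} {x} p with x ≟ᶠ y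
    ... | no x≢y = off (≢-sym x≢y) , cong (_, op y x) (=ᵇ⇒≡ p)

    B = Block (Off ∅) cell

    blockᵡʸ : ∀ {y x} → T (select XY y x) → B y x (op y x)
    blockᵡʸ s with select⁻ {XY} s
    ... | d , eq with cover d
    ...   | asXY c rewrite Block.cxy (Closed.self c) = Closed.self c
    ...   | asYZ c = contradiction (trans (sym eq) (Block.cyz (Closed.self c))) λ ()
    ...   | asXZ c = contradiction (trans (sym eq) (Block.cxz (Closed.self c))) λ ()

    blockʸᶻ : ∀ {y x} → T (select YZ y x) → B (op y x) y x
    blockʸᶻ s with select⁻ {YZ} s
    ... | d , eq with cover d
    ...   | asXY c = contradiction (trans (sym eq) (Block.cxy (Closed.self c))) λ ()
    ...   | asYZ c rewrite Block.cyz (Closed.self c) = Closed.self c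
    ...   | asXZ c = contradiction (trans (sym eq) (Block.cxz (Closed.self c))) λ ()

    blockᵡᶻ : ∀ {y x} → T (select XZ y x) → B y (op y x) x
    blockᵡᶻ s with select⁻ {XZ} s
    ... | d , eq with cover d
    ...   | asXY c = contradiction (trans (sym eq) (Block.cxy (Closed.self c))) λ ()
    ...   | asYZ c = contradiction (trans (sym eq) (Block.cyz (Closed.self c))) λ ()
    ...   | asXZ c rewrite Block.cxz (Closed.self c) = Closed.self c

    M : Role → V → ℕ
    M r y = count (select r y)

    M-XZ : ∀ y → M XZ y ≡ M XY y
    M-XZ y = count-biject (select XZ y) (select XY y) (op y) (op y)
      (λ z s → let b = blockᵡᶻ s in select⁺ (Block.Dxy b) (Block.cxy b))
      (λ x s → let b = blockᵡʸ s in select⁺ (Block.Dxz b) (Block.cxz b))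

    ∑M-YZ : sum (M YZ) ≡ sum (M XY)
    ∑M-YZ = begin
      sum (M YZ)
        ≡⟨ sum-cong-≗ (λ x → count-biject (select YZ x) (λ y → select XY y x) (op x) (λ y → op y x) (to x) (from x)) ⟩
      sum (λ x → sum (λ y → 𝟙 (select XY y x)))
        ≡⟨ ∑-comm (λ x y → 𝟙 (select XY y x)) ⟩
      sum (M XY) ∎
      where
      open ≡-Reasoning
      to : ∀ x z → T (select YZ x z) → T (select XY (op x z) x) × op (op x z) x ≡ z
      to x z s = let b = blockʸᶻ s in select⁺ (Block.Dxy b) (Block.cxy b)
      from : ∀ x y → T (select XY y x) → T (select YZ x (op y x)) × op x (op y x) ≡ y
      from x y s = let b = blockᵡʸ s in select⁺ (Block.Dyz b) (Block.cyz b)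

    total : ∀ y → M XY y + (M YZ y + M XZ y) + 1 ≡ n
    total y = begin
      M XY y + (M YZ y + M XZ y) + 1
        ≡⟨ cong (λ v → M XY y + v + 1) (∑-distrib-+ (𝟙 ∘ select YZ y) _) ⟨
      M XY y + sum g + 1
        ≡⟨ cong₂ _+_ (∑-distrib-+ (𝟙 ∘ select XY y) g) (count-one y) ⟨
      sum (λ x → 𝟙 (select XY y x) + g x) + count (λ x → does (x ≟ᶠ y))
        ≡⟨ ∑-distrib-+ (λ x → 𝟙 (select XY y x) + g x) _ ⟨
      sum (λ x → 𝟙 (select XY y x) + g x + 𝟙 (does (x ≟ᶠ y)))
        ≡⟨ sum-cong-≗ each ⟩
      sum {n} (λ _ → 1)
        ≡⟨ trans (∑-const n 1) (*-identityʳ n) ⟩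
      n ∎
      where
      open ≡-Reasoning
      g : V → ℕ
      g x = 𝟙 (select YZ y x) + 𝟙 (select XZ y x)
      each : ∀ x → 𝟙 (select XY y x) + g x + 𝟙 (does (x ≟ᶠ y)) ≡ 1
      each x with x ≟ᶠ y
      ... | yes _ = refl
      ... | no _ with proj₁ (cell y x)
      ...   | XY = refl
      ...   | YZ = refl
      ...   | XZ = refl

  square : n * n ≡ n + sum (M XY) * 3
  square = begin
    n * n
      ≡⟨ ∑-const n n ⟨
    sum {n} (λ _ → n)
      ≡⟨ sum-cong-≗ total ⟨
    sum (λ y → M XY y + (M YZ y + M XZ y) + 1)
      ≡⟨ ∑-distrib-+ (λ y → M XY y + (M YZ y + M XZ y)) _ ⟩
    sum (λ y → M XY y + (M YZ y + M XZ y)) + sum {n} (λ _ → 1)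
      ≡⟨ cong₂ _+_ (trans (∑-distrib-+ (M XY) _) (cong (sum (M XY) +_) (∑-distrib-+ (M YZ) (M XZ))))
                   (trans (∑-const n 1) (*-identityʳ n)) ⟩
    sum (M XY) + (sum (M YZ) + sum (M XZ)) + n
      ≡⟨ cong₂ (λ u v → sum (M XY) + (u + v) + n) ∑M-YZ (sum-cong-≗ M-XZ) ⟩
    sum (M XY) + (sum (M XY) + sum (M XY)) + n
      ≡⟨ arrange (sum (M XY)) n ⟩
    n + sum (M XY) * 3 ∎
    where
    open ≡-Reasoning
    arrange : ∀ m n → m + (m + m) + n ≡ n + m * 3
    arrange = solve-∀

  -- `square` makes n² and n congruent modulo 3, but 2² leaves remainder 1.
  n%3≢2 : ∀ v → n ≢ 2 + v * 3
  n%3≢2 v refl = contradiction 1≡2 λ ()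
    where
    expand : ∀ v → (2 + v * 3) * (2 + v * 3) ≡ 1 + (1 + 4 * v + 3 * (v * v)) * 3
    expand = solve-∀
    gather : ∀ v m → 2 + v * 3 + m * 3 ≡ 2 + (v + m) * 3
    gather = solve-∀
    1≡2 : 1 ≡ 2
    1≡2 = trans (sym ([m+kn]%n≡m%n 1 (1 + 4 * v + 3 * (v * v)) 3))
      (trans (cong (_% 3) (trans (sym (expand v)) (trans square (gather v (sum (M XY))))))
        ([m+kn]%n≡m%n 2 (v + sum (M XY)) 3))

-- Orders 4, 6 and 10

module EvenOrder {n : ℕ} (S : System (Fin n) ∅) where
  open Kinds S

  N-Q≢1 : ∀ y → N Q y ≢ 1
  N-Q≢1 y eq with ∃Q {y} (≤-reflexive (sym eq))
  ... | _ , a , k with subst (2 ≤_) eq (N-Q≥2 a k)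
  ...   | s≤s ()

  -- For a concrete n the degree equation together with p ≠ 1 has few solutions, so properties of
  -- all profiles are tested by evaluation. The parity of p comes out of the equation.
  profiles : (ℕ → ℕ → ℕ → Bool) → Bool
  profiles C = allᵇ (λ p → allᵇ (λ a → allᵇ (λ b →
    not ((p + (2 * (2 * a) + 2 * b) + 1 ≡ᵇ n) ∧ not (p ≡ᵇ 1)) ∨ C p a b) n) n) n

  profiles⁻ : ∀ C → T (profiles C) → ∀ {y} (π : Profile y) → T (C (Profile.p π) (Profile.a π) (Profile.b π))
  profiles⁻ C ok {y} π with Equivalence.to (T-∨ {not _}) (allᵇ⁻ _ n (allᵇ⁻ _ n (allᵇ⁻ _ n ok p<n) a<n) b<n)
    where
    open Profile π
    below : ∀ {m} → m ≤ p + (2 * (2 * a) + 2 * b) → m < n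
    below {m} le = subst (m <_) degree (subst (suc m ≤_) (+-comm 1 _) (s≤s le))
    p<n : p < n
    p<n = below (m≤m+n p _)
    a<n : a < n
    a<n = below (≤-trans (≤-trans (m≤n*m a 2) (m≤n*m (2 * a) 2)) (≤-trans (m≤m+n _ (2 * b)) (m≤n+m _ p)))
    b<n : b < n
    b<n = below (≤-trans (m≤n*m b 2) (≤-trans (m≤n+m _ (2 * (2 * a))) (m≤n+m _ p)))
  ... | inj₂ c = c
  ... | inj₁ ¬d = contradiction
        (∧⁺ (≡⇒≡ᵇ _ n degree) (not⁺ λ e → N-Q≢1 y (trans p≡ (≡ᵇ⇒≡ p 1 e)))) (not⁻ ¬d)
    where open Profile π

  light : ∀ c → T (profiles λ p a b → c ≤ᵇ 3 * p + 2 * b) → n * c + n ≤ n * n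
  light c ok = ≤-trans (+-monoˡ-≤ n (subst (_≤ sum weight) (∑-const n c)
      (sum-inject (λ _ → c) weight (λ y → y) heavy λ _ _ eq → eq))) (≤-reflexive ∑-weight)
    where
    heavy : ∀ y → c ≤ weight y
    heavy y = subst₂ (λ p t → c ≤ 3 * p + t) (sym p≡) (sym b≡)
      (≤ᵇ⇒≤ c _ (profiles⁻ (λ p a b → c ≤ᵇ 3 * p + 2 * b) ok (profile y)))
      where open Profile (profile y)

no-4 : ¬ System (Fin 4) ∅
-- Since p is odd and not 1, every weight is at least 3 · 3.
no-4 S = n≮n 16 (≤-trans (m≤m+n 17 23) (EvenOrder.light S 9 tt))

no-6 : ¬ System (Fin 6) ∅
no-6 S = n≮n 36 (≤-trans (m≤m+n 37 23) (EvenOrder.light S 9 tt))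

no-10 : ¬ System (Fin 10) ∅
-- The bound 9 would just be consistent, as 10 · 9 + 10 = 10². But p = 3 leaves 4 a + 2 b = 6, so b
-- ≥ 1 and the weight is at least 11.
no-10 S = n≮n 100 (≤-trans (m≤m+n 101 19) (EvenOrder.light S 11 tt))

-- Points are named 0 , 1 , … in the order in which the search meets them, so
-- that all points not met yet count as a single case.  An entry records what is
-- known about a pair of named points.
data Entry : Set where
  unknown : Entry
  kinded  : Kind → Entry
  known   : Kind → ℕ → Entry

Board : Set
Board = List (List Entry)

entry : Board → ℕ → ℕ → Entry
entry t x y = at unknown (at [] t x) y

write : ℕ → ℕ → Entry → Board → Board
write x y e t = put (λ row → put (λ _ → e) row y) t x

-- `nothing` stands for a contradiction, the desired end of a branch.
guard : Bool → Board → Maybe Board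
guard true  t = just t
guard false t = nothing

learnKind : ℕ → ℕ → Kind → Board → Maybe Board
learnKind x y κ t with entry t x y
... | unknown   = just (write x y (kinded κ) t)
... | kinded μ  = guard (κ ≡ᵏ μ) t
... | known μ _ = guard (κ ≡ᵏ μ) t

learnThird : ℕ → ℕ → Kind → ℕ → Board → Maybe Board
learnThird x y κ z t with entry t x y
... | unknown   = just (write x y (known κ z) t)
... | kinded μ  = guard (κ ≡ᵏ μ) (write x y (known κ z) t)
... | known μ w = guard ((κ ≡ᵏ μ) ∧ (z ≡ᵇ w)) t

-- The kind of (x , y) determines that of (y , x), but the third points of the two pairs may differ,
-- so only the kind is recorded for the reverse pair.
learn : ℕ → ℕ → Kind → ℕ → Board → Maybe Board
learn x y κ z t = learnThird x y κ z t >>= learnKind y x (flip κ)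

learnBip : ℕ → ℕ → ℕ → Board → Maybe Board
learnBip x y z t = learn x y P z t >>= learn y z Q x >>= learn x z O y

learnTri : ℕ → ℕ → ℕ → Board → Maybe Board
learnTri x y z t =
  learn x y Δ z t >>= learn x z Δ y >>= learn y z Δ x >>= learn y x Δ z >>= learn z x Δ y >>= learn z y Δ x

learnAs : ℕ → ℕ → Kind → ℕ → Board → Maybe Board
learnAs x y P z = learnBip x y z
learnAs x y Q z = learnBip z x y
learnAs x y O z = learnBip x z y
learnAs x y Δ z = learnTri x y z

has-kind : Kind → Entry → Bool
has-kind κ unknown     = false
has-kind κ (kinded μ)  = κ ≡ᵏ μ
has-kind κ (known μ _) = κ ≡ᵏ μ

occurrences : Kind → List Entry → ℕ
occurrences κ []       = 0
occurrences κ (e ∷ es) = 𝟙 (has-kind κ e) + occurrences κ es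

-- The possible values (p , a , b) of a Profile.
Spectrum : Set
Spectrum = List (ℕ × ℕ × ℕ)

-- The weight above 9, which is its least value since p ≥ 3.
excess : ℕ × ℕ × ℕ → ℕ
excess (p , a , b) = 3 * p + 2 * b ∸ 9

module Refuter (spectrum : Spectrum) where

  fits : ℕ → ℕ → ℕ → ℕ × ℕ × ℕ → Bool
  fits p q t (p′ , a′ , b′) = (p ≤ᵇ p′) ∧ (q ≤ᵇ 2 * a′) ∧ (t ≤ᵇ 2 * b′)

  least : ℕ → ℕ → ℕ → Spectrum → ℕ
  -- The default 25 exceeds the available total of 24, so a row that fits no profile is refuted by
  -- itself.
  least p q t = foldr (λ π m → if fits p q t π then excess π ⊓ m else m) 25

  -- The numbers of P and of O at a point are both 2 a, so the larger of the two counts is the one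
  -- to compare.
  excess≥ : List Entry → ℕ
  excess≥ row = least (occurrences Q row) (occurrences P row ⊔ occurrences O row) (occurrences Δ row) spectrum

  -- 24 = 12 · 11 - 12 · 9 is the sum of the excesses of all points.
  heavy : ℕ → Board → Bool
  heavy k t = 24 <ᵇ sum {k} (λ i → excess≥ (at [] t (toℕ i)))

  options : ℕ → List (Kind × ℕ)
  -- Besides the k named points there is the fresh name k, unless all twelve points are named.
  options k = cartesianProduct (P ∷ Q ∷ O ∷ Δ ∷ []) (upTo (suc k ⊓ 12))

  -- The list prescribes the steps of the search: 12 x + y splits into cases for
  -- the pair (x , y), and 144 + 12 x + y closes up the triple known for (x , y).
  mutual
    refute : ℕ → ℕ → Board → List ℕ → Maybe (List ℕ)
    refute zero _ _ _ = nothing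
    refute (suc f) k t [] = nothing
    refute (suc f) k t (c ∷ cs) = if c <ᵇ 144 then branch f k (c / 12) (c % 12) t cs else close f k ((c ∸ 144) / 12) (c % 12) t cs

    attempt : ℕ → ℕ → Maybe Board → List ℕ → Maybe (List ℕ)
    attempt f k nothing  cs = just cs
    attempt f k (just t) cs = if heavy k t then just cs else refute f k t cs

    branch : ℕ → ℕ → ℕ → ℕ → Board → List ℕ → Maybe (List ℕ)
    branch f k x y t cs = if (x <ᵇ k) ∧ (y <ᵇ k) ∧ not (x ≡ᵇ y) then each f k x y t (options k) cs else nothing

    each : ℕ → ℕ → ℕ → ℕ → Board → List (Kind × ℕ) → List ℕ → Maybe (List ℕ)
    each f k x y t [] cs = just cs
    each f k x y t ((κ , z) ∷ os) cs =
      if (z ≡ᵇ x) ∨ (z ≡ᵇ y) then each f k x y t os cs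
      else (attempt f (k ⊔ suc z) (learnAs x y κ z t) cs >>= each f k x y t os)

    -- Once the next rim point u and the second pole c of ⟨ x , y , z ⟩ are known, ⟨ u , c , z ⟩
    -- must be a triple too. If c = y, the kind P is already contradicted.
    close : ℕ → ℕ → ℕ → ℕ → Board → List ℕ → Maybe (List ℕ)
    close f k x y t cs with entry t x y
    ... | known P z with entry t z y | entry t z x
    ...   | known P u | known O c = if c ≡ᵇ y then just cs else attempt f k (learnBip u c z t) cs
    ...   | _ | _ = nothing
    close f k x y t cs | _ = nothing

  refutes : ℕ → Maybe Board → List ℕ → Bool
  -- The fuel bounds the depth of the case tree, not its size.
  refutes k t cs with attempt 100 k t cs
  ... | just _ = true
  ... | nothing = false

empty : Board
empty = replicate 12 (replicate 12 unknown)

-- The poles 0 and 1 of a rim 2 , 3 , 4 , 5 , … of length at least four.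
longCycle : Maybe Board
longCycle = learnBip 2 0 3 empty >>= learnBip 3 0 4 >>= learnBip 4 0 5 >>= learnBip 3 1 2 >>= learnBip 4 1 3 >>= learnBip 5 1 4

-- A bidirectional triple through 0 and a rim edge of a bipyramid with pole 0.
triangle : Maybe Board
triangle = learnTri 0 1 2 empty >>= learnBip 3 0 4

-- spectrum₃ consists of the profiles with p divisible by 3.
spectrum spectrum₃ : Spectrum
spectrum = (3 , 2 , 0) ∷ (3 , 1 , 2) ∷ (3 , 0 , 4) ∷ (5 , 1 , 1) ∷ (5 , 0 , 3) ∷ (7 , 1 , 0) ∷ (7 , 0 , 2) ∷ (9 , 0 , 1) ∷ (11 , 0 , 0) ∷ []
spectrum₃ = (3 , 2 , 0) ∷ (3 , 1 , 2) ∷ (3 , 0 , 4) ∷ (9 , 0 , 1) ∷ []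

-- The case trees in preorder: each subtree consumes a prefix of the list and hands on the rest.
longCycleCodes triangleCodes : List ℕ
longCycleCodes =
  2 ∷ 192 ∷ 28 ∷ 50 ∷ 172 ∷ 74 ∷ 31 ∷ 76 ∷ 172 ∷ 56 ∷ 100 ∷ 200 ∷ 57 ∷ 256 ∷ 33 ∷ 34 ∷ 266 ∷ 58 ∷ 172 ∷ 30 ∷
  218 ∷ 54 ∷ 79 ∷ 230 ∷ 230 ∷ 230 ∷ 230 ∷ 50 ∷ 218 ∷ 32 ∷ 98 ∷ 176 ∷ 33 ∷ 254 ∷ 57 ∷ 58 ∷ 268 ∷ 34 ∷ 218 ∷
  230 ∷ 50 ∷ 174 ∷ 74 ∷ 31 ∷ 54 ∷ 174 ∷ 44 ∷ 68 ∷ 188 ∷ 33 ∷ 57 ∷ 63 ∷ 188 ∷ 188 ∷ 188 ∷ 188 ∷ 33 ∷ 57 ∷ 35 ∷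
  58 ∷ 34 ∷ 254 ∷ 99 ∷ 41 ∷ 212 ∷ 212 ∷ 212 ∷ 212 ∷ 188 ∷ 46 ∷ 272 ∷ 116 ∷ 188 ∷ 188 ∷ 272 ∷ 272 ∷ 47 ∷ 284 ∷
  116 ∷ 188 ∷ 188 ∷ 284 ∷ 284 ∷ 99 ∷ 207 ∷ 33 ∷ 57 ∷ 101 ∷ 207 ∷ 207 ∷ 33 ∷ 57 ∷ 35 ∷ 58 ∷ 34 ∷ 254 ∷ 45 ∷
  113 ∷ 207 ∷ 207 ∷ 69 ∷ 113 ∷ 213 ∷ 113 ∷ 99 ∷ 255 ∷ 255 ∷ 69 ∷ 113 ∷ 213 ∷ 113 ∷ 99 ∷ 255 ∷ 255 ∷ 255 ∷ 99 ∷
  185 ∷ 33 ∷ 57 ∷ 101 ∷ 185 ∷ 185 ∷ 33 ∷ 57 ∷ 35 ∷ 58 ∷ 34 ∷ 254 ∷ 99 ∷ 105 ∷ 189 ∷ 189 ∷ 189 ∷ 68 ∷ 101 ∷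
  212 ∷ 101 ∷ 41 ∷ 250 ∷ 8 ∷ 107 ∷ 12 ∷ 152 ∷ 152 ∷ 152 ∷ 152 ∷ 20 ∷ 1 ∷ 164 ∷ 164 ∷ 164 ∷ 164 ∷ 68 ∷ 101 ∷
  212 ∷ 101 ∷ 41 ∷ 251 ∷ 8 ∷ 106 ∷ 12 ∷ 152 ∷ 152 ∷ 152 ∷ 152 ∷ 20 ∷ 1 ∷ 164 ∷ 164 ∷ 164 ∷ 164 ∷ 174 ∷ 25 ∷
  181 ∷ 6 ∷ 192 ∷ 28 ∷ 50 ∷ 172 ∷ 86 ∷ 29 ∷ 88 ∷ 172 ∷ 172 ∷ 41 ∷ 63 ∷ 185 ∷ 33 ∷ 34 ∷ 266 ∷ 137 ∷ 33 ∷ 34 ∷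
  266 ∷ 137 ∷ 172 ∷ 32 ∷ 29 ∷ 34 ∷ 266 ∷ 35 ∷ 69 ∷ 266 ∷ 113 ∷ 185 ∷ 50 ∷ 230 ∷ 100 ∷ 54 ∷ 90 ∷ 198 ∷ 198 ∷
  29 ∷ 57 ∷ 58 ∷ 268 ∷ 34 ∷ 33 ∷ 254 ∷ 57 ∷ 58 ∷ 268 ∷ 34 ∷ 198 ∷ 55 ∷ 54 ∷ 58 ∷ 268 ∷ 59 ∷ 81 ∷ 268 ∷ 114 ∷
  186 ∷ 50 ∷ 175 ∷ 86 ∷ 29 ∷ 55 ∷ 175 ∷ 175 ∷ 32 ∷ 29 ∷ 34 ∷ 266 ∷ 35 ∷ 55 ∷ 175 ∷ 175 ∷ 58 ∷ 59 ∷ 278 ∷ 175 ∷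
  175 ∷ 73 ∷ 169 ∷ 1 ∷ 12 ∷ 152 ∷ 96 ∷ 9 ∷ 20 ∷ 152 ∷ 7 ∷ 192 ∷ 32 ∷ 100 ∷ 194 ∷ 112 ∷ 124 ∷ 34 ∷ 11 ∷ 54 ∷
  33 ∷ 194 ∷ 55 ∷ 58 ∷ 268 ∷ 11 ∷ 11 ∷ 31 ∷ 86 ∷ 178 ∷ 11 ∷ 11 ∷ 11 ∷ 29 ∷ 206 ∷ 33 ∷ 70 ∷ 63 ∷ 66 ∷ 69 ∷ 254 ∷
  206 ∷ 11 ∷ 185 ∷ 11 ∷ 66 ∷ 63 ∷ 69 ∷ 254 ∷ 206 ∷ 11 ∷ 221 ∷ 11 ∷ 11 ∷ 34 ∷ 11 ∷ 103 ∷ 230 ∷ 115 ∷ 127 ∷ 34 ∷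
  11 ∷ 87 ∷ 33 ∷ 230 ∷ 55 ∷ 88 ∷ 199 ∷ 11 ∷ 11 ∷ 28 ∷ 50 ∷ 178 ∷ 11 ∷ 11 ∷ 11 ∷ 33 ∷ 28 ∷ 58 ∷ 54 ∷ 220 ∷ 11 ∷
  55 ∷ 232 ∷ 11 ∷ 11 ∷ 29 ∷ 70 ∷ 63 ∷ 66 ∷ 68 ∷ 242 ∷ 206 ∷ 11 ∷ 185 ∷ 11 ∷ 66 ∷ 63 ∷ 68 ∷ 242 ∷ 206 ∷ 11 ∷
  221 ∷ 11 ∷ 11 ∷ 31 ∷ 94 ∷ 87 ∷ 187 ∷ 11 ∷ 88 ∷ 199 ∷ 11 ∷ 11 ∷ 254 ∷ 11 ∷ 11 ∷ 98 ∷ 172 ∷ 110 ∷ 122 ∷ 58 ∷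
  11 ∷ 29 ∷ 57 ∷ 172 ∷ 31 ∷ 34 ∷ 266 ∷ 11 ∷ 11 ∷ 55 ∷ 88 ∷ 202 ∷ 11 ∷ 11 ∷ 11 ∷ 62 ∷ 173 ∷ 69 ∷ 34 ∷ 28 ∷ 31 ∷
  33 ∷ 257 ∷ 173 ∷ 11 ∷ 194 ∷ 11 ∷ 31 ∷ 28 ∷ 33 ∷ 257 ∷ 173 ∷ 11 ∷ 230 ∷ 11 ∷ 11 ∷ 70 ∷ 11 ∷ 98 ∷ 55 ∷ 88 ∷
  202 ∷ 11 ∷ 11 ∷ 110 ∷ 122 ∷ 94 ∷ 11 ∷ 29 ∷ 68 ∷ 173 ∷ 28 ∷ 34 ∷ 266 ∷ 11 ∷ 11 ∷ 175 ∷ 11 ∷ 11 ∷ 23 ∷ 11 ∷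
  192 ∷ 29 ∷ 86 ∷ 122 ∷ 34 ∷ 266 ∷ 34 ∷ 55 ∷ 172 ∷ 32 ∷ 35 ∷ 33 ∷ 131 ∷ 33 ∷ 35 ∷ 131 ∷ 173 ∷ 34 ∷ 238 ∷ 238 ∷
  62 ∷ 67 ∷ 31 ∷ 233 ∷ 173 ∷ 33 ∷ 34 ∷ 233 ∷ 173 ∷ 69 ∷ 34 ∷ 28 ∷ 55 ∷ 194 ∷ 35 ∷ 31 ∷ 257 ∷ 173 ∷ 55 ∷ 31 ∷
  88 ∷ 230 ∷ 35 ∷ 28 ∷ 31 ∷ 257 ∷ 173 ∷ 88 ∷ 278 ∷ 70 ∷ 62 ∷ 67 ∷ 31 ∷ 233 ∷ 173 ∷ 32 ∷ 34 ∷ 233 ∷ 68 ∷ 34 ∷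
  28 ∷ 55 ∷ 194 ∷ 35 ∷ 31 ∷ 245 ∷ 173 ∷ 55 ∷ 31 ∷ 88 ∷ 230 ∷ 35 ∷ 28 ∷ 31 ∷ 245 ∷ 173 ∷ 88 ∷ 278 ∷ 173 ∷ 70 ∷
  62 ∷ 125 ∷ 31 ∷ 233 ∷ 173 ∷ 32 ∷ 35 ∷ 33 ∷ 131 ∷ 33 ∷ 35 ∷ 131 ∷ 125 ∷ 125 ∷ 173 ∷ 67 ∷ 230 ∷ 125 ∷ 70 ∷
  269 ∷ 70 ∷ 46 ∷ 207 ∷ 55 ∷ 93 ∷ 88 ∷ 58 ∷ 92 ∷ 88 ∷ 58 ∷ 62 ∷ 230 ∷ 230 ∷ 62 ∷ 32 ∷ 68 ∷ 242 ∷ 206 ∷ 69 ∷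
  70 ∷ 242 ∷ 242 ∷ 32 ∷ 70 ∷ 63 ∷ 66 ∷ 67 ∷ 242 ∷ 206 ∷ 43 ∷ 43 ∷ 185 ∷ 66 ∷ 63 ∷ 67 ∷ 242 ∷ 206 ∷ 87 ∷ 221 ∷
  67 ∷ 87 ∷ 233 ∷ 122 ∷ 62 ∷ 33 ∷ 69 ∷ 254 ∷ 206 ∷ 68 ∷ 70 ∷ 254 ∷ 33 ∷ 70 ∷ 63 ∷ 66 ∷ 67 ∷ 254 ∷ 206 ∷ 43 ∷
  43 ∷ 185 ∷ 66 ∷ 63 ∷ 67 ∷ 254 ∷ 206 ∷ 87 ∷ 221 ∷ 67 ∷ 87 ∷ 233 ∷ 254 ∷ 122 ∷ 34 ∷ 62 ∷ 266 ∷ 62 ∷ 89 ∷ 206 ∷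
  230 ∷ 55 ∷ 93 ∷ 88 ∷ 58 ∷ 92 ∷ 88 ∷ 58 ∷ 35 ∷ 62 ∷ 175 ∷ 34 ∷ 214 ∷ 58 ∷ 214 ∷ 62 ∷ 70 ∷ 178 ∷ 46 ∷ 178 ∷
  178 ∷ 169 ∷ 181 ∷ []
triangleCodes =
  3 ∷ 180 ∷ 5 ∷ 41 ∷ 204 ∷ 180 ∷ 27 ∷ 38 ∷ 171 ∷ 43 ∷ 7 ∷ 84 ∷ 151 ∷ 93 ∷ 19 ∷ 85 ∷ 166 ∷ 9 ∷ 259 ∷ 151 ∷ 73 ∷
  97 ∷ 55 ∷ 231 ∷ 171 ∷ 67 ∷ 84 ∷ 152 ∷ 96 ∷ 92 ∷ 219 ∷ 9 ∷ 6 ∷ 45 ∷ 44 ∷ 6 ∷ 72 ∷ 150 ∷ 108 ∷ 10 ∷ 47 ∷ 135 ∷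
  188 ∷ 72 ∷ 153 ∷ 108 ∷ 10 ∷ 46 ∷ 45 ∷ 38 ∷ 218 ∷ 87 ∷ 42 ∷ 30 ∷ 182 ∷ 8 ∷ 45 ∷ 46 ∷ 267 ∷ 47 ∷ 96 ∷ 153 ∷
  108 ∷ 114 ∷ 115 ∷ 108 ∷ 114 ∷ 115 ∷ 45 ∷ 46 ∷ 267 ∷ 47 ∷ 6 ∷ 72 ∷ 150 ∷ 83 ∷ 279 ∷ 72 ∷ 82 ∷ 150 ∷ 72 ∷ 154 ∷
  84 ∷ 82 ∷ 72 ∷ 84 ∷ 83 ∷ 155 ∷ 38 ∷ 174 ∷ 87 ∷ 42 ∷ 31 ∷ 187 ∷ 28 ∷ 29 ∷ 33 ∷ 254 ∷ 35 ∷ 45 ∷ 47 ∷ 278 ∷ 29 ∷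
  34 ∷ 266 ∷ 35 ∷ 46 ∷ 47 ∷ 278 ∷ 6 ∷ 43 ∷ 44 ∷ 243 ∷ 45 ∷ 84 ∷ 150 ∷ 46 ∷ 19 ∷ 8 ∷ 84 ∷ 151 ∷ 43 ∷ 44 ∷ 243 ∷
  45 ∷ 19 ∷ 46 ∷ 204 ∷ 180 ∷ 15 ∷ 37 ∷ 159 ∷ 43 ∷ 7 ∷ 84 ∷ 151 ∷ 93 ∷ 31 ∷ 86 ∷ 178 ∷ 9 ∷ 259 ∷ 151 ∷ 74 ∷ 98 ∷
  55 ∷ 231 ∷ 159 ∷ 67 ∷ 84 ∷ 152 ∷ 96 ∷ 92 ∷ 219 ∷ 9 ∷ 6 ∷ 45 ∷ 44 ∷ 6 ∷ 72 ∷ 150 ∷ 108 ∷ 10 ∷ 47 ∷ 135 ∷ 188 ∷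
  72 ∷ 153 ∷ 108 ∷ 10 ∷ 46 ∷ 45 ∷ 37 ∷ 217 ∷ 87 ∷ 42 ∷ 18 ∷ 181 ∷ 8 ∷ 45 ∷ 46 ∷ 267 ∷ 47 ∷ 96 ∷ 153 ∷ 108 ∷
  114 ∷ 115 ∷ 108 ∷ 114 ∷ 115 ∷ 45 ∷ 46 ∷ 267 ∷ 47 ∷ 6 ∷ 72 ∷ 150 ∷ 83 ∷ 279 ∷ 72 ∷ 82 ∷ 150 ∷ 72 ∷ 154 ∷ 84 ∷
  82 ∷ 72 ∷ 84 ∷ 83 ∷ 155 ∷ 37 ∷ 162 ∷ 87 ∷ 42 ∷ 19 ∷ 187 ∷ 16 ∷ 17 ∷ 21 ∷ 253 ∷ 23 ∷ 45 ∷ 47 ∷ 277 ∷ 17 ∷ 22 ∷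
  265 ∷ 23 ∷ 46 ∷ 47 ∷ 277 ∷ 6 ∷ 43 ∷ 44 ∷ 243 ∷ 45 ∷ 84 ∷ 150 ∷ 46 ∷ 31 ∷ 8 ∷ 84 ∷ 151 ∷ 43 ∷ 44 ∷ 243 ∷ 45 ∷
  31 ∷ 46 ∷ 204 ∷ 180 ∷ 6 ∷ 72 ∷ 151 ∷ 84 ∷ 8 ∷ 79 ∷ 151 ∷ 18 ∷ 10 ∷ 73 ∷ 265 ∷ 22 ∷ 10 ∷ 73 ∷ 166 ∷ 30 ∷ 23 ∷
  10 ∷ 30 ∷ 15 ∷ 37 ∷ 159 ∷ 44 ∷ 47 ∷ 135 ∷ 191 ∷ 135 ∷ 189 ∷ 45 ∷ 47 ∷ 44 ∷ 99 ∷ 182 ∷ 27 ∷ 33 ∷ 99 ∷ 111 ∷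
  106 ∷ 190 ∷ 37 ∷ 43 ∷ 47 ∷ 135 ∷ 191 ∷ 135 ∷ 189 ∷ 159 ∷ 45 ∷ 47 ∷ 43 ∷ 87 ∷ 182 ∷ 27 ∷ 33 ∷ 87 ∷ 111 ∷ 94 ∷
  190 ∷ 47 ∷ 37 ∷ 44 ∷ 159 ∷ 37 ∷ 43 ∷ 159 ∷ 37 ∷ 43 ∷ 44 ∷ 27 ∷ 182 ∷ 242 ∷ 32 ∷ 182 ∷ 28 ∷ 57 ∷ 124 ∷ 38 ∷
  27 ∷ 230 ∷ 31 ∷ 182 ∷ 28 ∷ 57 ∷ 124 ∷ 182 ∷ 43 ∷ 37 ∷ 21 ∷ 20 ∷ 20 ∷ 87 ∷ 182 ∷ 27 ∷ 44 ∷ 45 ∷ 37 ∷ 32 ∷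
  182 ∷ 19 ∷ 20 ∷ 20 ∷ 33 ∷ 87 ∷ 99 ∷ 44 ∷ 111 ∷ 94 ∷ 44 ∷ 45 ∷ 37 ∷ 31 ∷ 182 ∷ 19 ∷ 20 ∷ 20 ∷ 190 ∷ 37 ∷ 229 ∷
  19 ∷ 47 ∷ 229 ∷ 181 ∷ 27 ∷ 46 ∷ 38 ∷ 16 ∷ 57 ∷ 136 ∷ 45 ∷ 38 ∷ 16 ∷ 57 ∷ 136 ∷ 135 ∷ 255 ∷ 109 ∷ 43 ∷ 229 ∷
  229 ∷ 37 ∷ 20 ∷ 47 ∷ 241 ∷ 181 ∷ 27 ∷ 46 ∷ 38 ∷ 16 ∷ 57 ∷ 136 ∷ 45 ∷ 38 ∷ 16 ∷ 57 ∷ 136 ∷ 135 ∷ 255 ∷ 241 ∷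
  109 ∷ 44 ∷ 241 ∷ 241 ∷ 21 ∷ 253 ∷ 16 ∷ 17 ∷ 119 ∷ 277 ∷ 277 ∷ 47 ∷ 277 ∷ 37 ∷ 277 ∷ 277 ∷ 37 ∷ 165 ∷ 45 ∷
  165 ∷ 165 ∷ 37 ∷ 47 ∷ 167 ∷ 167 ∷ 167 ∷ 18 ∷ 73 ∷ 241 ∷ 20 ∷ 8 ∷ 82 ∷ 96 ∷ 152 ∷ 80 ∷ 82 ∷ 96 ∷ 154 ∷ 114 ∷
  8 ∷ 96 ∷ 153 ∷ 108 ∷ 10 ∷ 73 ∷ 164 ∷ 138 ∷ 23 ∷ 8 ∷ 96 ∷ 152 ∷ 108 ∷ 10 ∷ 83 ∷ 138 ∷ 218 ∷ 96 ∷ 153 ∷ 108 ∷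
  10 ∷ 82 ∷ 81 ∷ []

-- Soundness of the search

at-put : ∀ {A : Set} (d : A) f xs i j → at d (put f xs i) j ≡ at d xs j ⊎ (j ≡ i × at d (put f xs i) j ≡ f (at d xs j))
at-put d f []       i       j       = inj₁ refl
at-put d f (x ∷ xs) zero    zero    = inj₂ (refl , refl)
at-put d f (x ∷ xs) zero    (suc j) = inj₁ refl
at-put d f (x ∷ xs) (suc i) zero    = inj₁ refl
at-put d f (x ∷ xs) (suc i) (suc j) with at-put d f xs i j
... | inj₁ eq = inj₁ eq
... | inj₂ (refl , eq) = inj₂ (refl , eq)

entry-write : ∀ x y e t i j → entry (write x y e t) i j ≡ entry t i j ⊎ (i ≡ x × j ≡ y × entry (write x y e t) i j ≡ e)
entry-write x y e t i j with at-put [] (λ row → put (λ _ → e) row y) t x i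
... | inj₁ eq = inj₁ (cong (λ row → at unknown row j) eq)
... | inj₂ (i≡x , eq) rewrite eq with at-put unknown (λ _ → e) (at [] t i) y j
...   | inj₁ eq′ = inj₁ eq′
...   | inj₂ (j≡y , eq′) = inj₂ (i≡x , j≡y , eq′)

Realised : System (Fin 12) ∅ → (Fin 12 → ℕ) → Spectrum → Fin 12 → Set
Realised S h σ y = ∃ λ π → π ∈ σ × N Q y ≡ proj₁ π × N P y ≡ 2 * proj₁ (proj₂ π) × N O y ≡ 2 * proj₁ (proj₂ π) ×
                   N Δ y ≡ 2 * proj₂ (proj₂ π) × h y ≡ excess π
  where open Kinds S

module Soundness (S : System (Fin 12) ∅) (spectrum : Spectrum)
  (h : Fin 12 → ℕ) (∑h : sum h ≤ 24)
  (realised : ∀ y → Realised S h spectrum y)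
  where
  open Kinds S
  open Refuter spectrum

  -- ρ is defined on all numbers so that boards stay independent of k; only its values below k carry
  -- meaning.
  record Naming (k : ℕ) : Set where
    constructor naming
    field
      ρ         : ℕ → V
      injective : ∀ {i j} → i < k → j < k → ρ i ≡ ρ j → i ≡ j

  module _ {k : ℕ} (ν : Naming k) where
    open Naming ν

    Holds : ℕ → ℕ → Entry → Set
    Holds x y unknown     = ⊤
    Holds x y (kinded κ)  = x < k × y < k × ρ x ≢ ρ y × kind (ρ x) (ρ y) ≡ κ
    Holds x y (known κ z) = x < k × y < k × z < k × Val (ρ x) (ρ y) κ (ρ z)

    record Sat (t : Board) : Set where
      constructor sat
      field
        holds : ∀ x y → Holds x y (entry t x y)
    open Sat

    Ok : Maybe Board → Set
    Ok nothing  = ⊥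
    Ok (just t) = Sat t

    empty-sat : Sat empty
    empty-sat = sat λ x y → subst (Holds x y) (sym (blank x y)) tt
      where
      blank-row : ∀ n y → at unknown (replicate n unknown) y ≡ unknown
      blank-row zero    y       = refl
      blank-row (suc n) zero    = refl
      blank-row (suc n) (suc y) = blank-row n y
      blank-rows : ∀ m n x y → entry (replicate m (replicate n unknown)) x y ≡ unknown
      blank-rows zero    n x       y = refl
      blank-rows (suc m) n zero    y = blank-row n y
      blank-rows (suc m) n (suc x) y = blank-rows m n x y
      blank : ∀ x y → entry empty x y ≡ unknown
      blank = blank-rows 12 12

    infixl 1 _>>=ᵒᵏ_
    _>>=ᵒᵏ_ : ∀ {m f} → Ok m → (∀ {t} → Sat t → Ok (f t)) → Ok (m >>= f)
    _>>=ᵒᵏ_ {just _} s g = g s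

    guard-ok : ∀ {b t} → T b → Sat t → Ok (guard b t)
    guard-ok {true} _ s = s

    ≡ᵏ⁺ : ∀ {κ μ} → κ ≡ μ → T (κ ≡ᵏ μ)
    ≡ᵏ⁺ {κ} refl = ≡ᵏ-refl κ

    write-sat : ∀ {x y e t} → Holds x y e → Sat t → Sat (write x y e t)
    write-sat {x} {y} {e} {t} h s = sat λ i j → case i j (entry-write x y e t i j)
      where
      case : ∀ i j → entry (write x y e t) i j ≡ entry t i j ⊎ (i ≡ x × j ≡ y × entry (write x y e t) i j ≡ e) →
             Holds i j (entry (write x y e t) i j)
      case i j (inj₁ eq) = subst (Holds i j) (sym eq) (holds s i j)
      case i j (inj₂ (refl , refl , eq)) = subst (Holds i j) (sym eq) h

    learnKind-ok : ∀ {x y κ t} → x < k → y < k → ρ x ≢ ρ y → kind (ρ x) (ρ y) ≡ κ → Sat t → Ok (learnKind x y κ t)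
    learnKind-ok {x} {y} {κ} {t} x<k y<k ≢ρ eq s with entry t x y | holds s x y
    ... | unknown   | _ = write-sat (x<k , y<k , ≢ρ , eq) s
    ... | kinded μ  | _ , _ , _ , eq′ = guard-ok (≡ᵏ⁺ (trans (sym eq) eq′)) s
    ... | known μ _ | _ , _ , _ , v   = guard-ok (≡ᵏ⁺ (trans (sym eq) (Val.kd v))) s

    learn-ok : ∀ {x y κ z t} → x < k → y < k → z < k → Val (ρ x) (ρ y) κ (ρ z) → Sat t → Ok (learn x y κ z t)
    learn-ok {x} {y} {κ} {z} {t} x<k y<k z<k v s =
      put-third s >>=ᵒᵏ learnKind-ok y<k x<k (≢-sym (Val.a≢b v)) (Val.flip-kd v)
      where
      put-third : Sat t → Ok (learnThird x y κ z t)
      put-third s with entry t x y | holds s x y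
      ... | unknown   | _ = write-sat (x<k , y<k , z<k , v) s
      ... | kinded μ  | _ , _ , _ , eq = guard-ok (≡ᵏ⁺ (trans (sym (Val.kd v)) eq)) (write-sat (x<k , y<k , z<k , v) s)
      ... | known μ w | _ , _ , w<k , v′ = guard-ok (∧⁺ (≡ᵏ⁺ (trans (sym (Val.kd v)) (Val.kd v′)))
              (≡⇒≡ᵇ z w (injective z<k w<k (trans (sym (Val.target v)) (Val.target v′))))) s

    learnBip-ok : ∀ {x y z t} → x < k → y < k → z < k → Bip (ρ x) (ρ y) (ρ z) → Sat t → Ok (learnBip x y z t)
    learnBip-ok x<k y<k z<k b s =
      learn-ok x<k y<k z<k (Bip-xy b) s >>=ᵒᵏ learn-ok y<k z<k x<k (Bip-yz b) >>=ᵒᵏ learn-ok x<k z<k y<k (Bip-xz b)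

    learnTri-ok : ∀ {x y z t} → x < k → y < k → z < k →
                  Val (ρ x) (ρ y) Δ (ρ z) → Val (ρ x) (ρ z) Δ (ρ y) → Val (ρ y) (ρ z) Δ (ρ x) →
                  Sat t → Ok (learnTri x y z t)
    learnTri-ok x<k y<k z<k u v w s =
      learn-ok x<k y<k z<k u s >>=ᵒᵏ learn-ok x<k z<k y<k v >>=ᵒᵏ learn-ok y<k z<k x<k w >>=ᵒᵏ
      learn-ok y<k x<k z<k (Val-Δ-sym u) >>=ᵒᵏ learn-ok z<k x<k y<k (Val-Δ-sym v) >>=ᵒᵏ learn-ok z<k y<k x<k (Val-Δ-sym w)

    longCycle-ok : 0 < k → 1 < k → 2 < k → 3 < k → 4 < k → 5 < k →
                   Bip (ρ 2) (ρ 0) (ρ 3) → Bip (ρ 3) (ρ 0) (ρ 4) → Bip (ρ 4) (ρ 0) (ρ 5) →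
                   Bip (ρ 3) (ρ 1) (ρ 2) → Bip (ρ 4) (ρ 1) (ρ 3) → Bip (ρ 5) (ρ 1) (ρ 4) → Ok longCycle
    longCycle-ok i₀ i₁ i₂ i₃ i₄ i₅ p₀ p₁ p₂ q₀ q₁ q₂ =
      learnBip-ok i₂ i₀ i₃ p₀ empty-sat >>=ᵒᵏ learnBip-ok i₃ i₀ i₄ p₁ >>=ᵒᵏ learnBip-ok i₄ i₀ i₅ p₂ >>=ᵒᵏ
      learnBip-ok i₃ i₁ i₂ q₀ >>=ᵒᵏ learnBip-ok i₄ i₁ i₃ q₁ >>=ᵒᵏ learnBip-ok i₅ i₁ i₄ q₂

    triangle-ok : 0 < k → 1 < k → 2 < k → 3 < k → 4 < k →
                  Val (ρ 0) (ρ 1) Δ (ρ 2) → Val (ρ 0) (ρ 2) Δ (ρ 1) → Val (ρ 1) (ρ 2) Δ (ρ 0) →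
                  Bip (ρ 3) (ρ 0) (ρ 4) → Ok triangle
    triangle-ok i₀ i₁ i₂ i₃ i₄ u v w b = learnTri-ok i₀ i₁ i₂ u v w empty-sat >>=ᵒᵏ learnBip-ok i₃ i₀ i₄ b

    learnAs-ok : ∀ {x y z t} → x < k → y < k → z < k → ρ x ≢ ρ y → op (ρ x) (ρ y) ≡ ρ z → Sat t →
                 Ok (learnAs x y (kind (ρ x) (ρ y)) z t)
    learnAs-ok {x} {y} x<k y<k z<k x≢y eq s with view′ x≢y eq
    ... | vP b rewrite Val.kd (Bip-xy b) = learnBip-ok x<k y<k z<k b s
    ... | vQ b rewrite Val.kd (Bip-yz b) = learnBip-ok z<k x<k y<k b s
    ... | vO b rewrite Val.kd (Bip-xz b) = learnBip-ok x<k z<k y<k b s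
    ... | vΔ u v w rewrite Val.kd u = learnTri-ok x<k y<k z<k u v w s

    -- Different columns name different points, so nothing is counted twice.
    occurrences≤N : ∀ κ {i t} → i < k → Sat t → occurrences κ (at [] t i) ≤ N κ (ρ i)
    occurrences≤N κ {i} {t} i<k s = ≤-trans (≤-reflexive (as-count row))
      (count-inject flag (select κ (ρ i)) (ρ ∘ toℕ) (λ j → proj₁ ∘ flagged j)
        λ {j} {l} p q eq → toℕ-injective (injective (proj₂ (flagged j p)) (proj₂ (flagged l q)) eq))
      where
      row = at [] t i
      flag : Fin (length row) → Bool
      flag j = has-kind κ (lookup row j)
      as-count : ∀ es → occurrences κ es ≡ count (λ j → has-kind κ (lookup es j))
      as-count []       = refl
      as-count (e ∷ es) = cong (𝟙 (has-kind κ e) +_) (as-count es)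
      at-lookup : ∀ (es : List Entry) j → at unknown es (toℕ j) ≡ lookup es j
      at-lookup (_ ∷ _)  zero    = refl
      at-lookup (_ ∷ es) (suc j) = at-lookup es j
      flagged : ∀ j → T (flag j) → T (select κ (ρ i) (ρ (toℕ j))) × toℕ j < k
      flagged j p with lookup row j | subst (Holds i (toℕ j)) (at-lookup row j) (holds s i (toℕ j))
      ... | kinded μ  | _ , j<k , ≢ρ , eq = select⁺ (≢-sym ≢ρ) (trans eq (sym (≡ᵏ⇒≡ p))) , j<k
      ... | known μ _ | _ , j<k , _ , v = select⁺ (≢-sym (Val.a≢b v)) (trans (Val.kd v) (sym (≡ᵏ⇒≡ p))) , j<k

    light : ∀ {t} → Sat t → ¬ T (heavy k t)
    light {t} s hv = n≮n 24 (≤-trans (<ᵇ⇒< 24 _ hv) (≤-trans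
        (sum-inject (λ i → excess≥ (at [] t (toℕ i))) h (ρ ∘ toℕ) (λ i → below (toℕ<n i))
          (λ {i} {j} _ _ eq → toℕ-injective (injective (toℕ<n i) (toℕ<n j) eq))) ∑h))
      where
      least≤ : ∀ p q u σ {π} → π ∈ σ → T (fits p q u π) → least p q u σ ≤ excess π
      least≤ p q u (π ∷ σ) (here refl) ok with fits p q u π
      ... | true = m⊓n≤m _ _
      least≤ p q u (π ∷ σ) (there π∈) ok with fits p q u π
      ... | true  = ≤-trans (m⊓n≤n _ _) (least≤ p q u σ π∈ ok)
      ... | false = least≤ p q u σ π∈ ok
      below : ∀ {i} → i < k → excess≥ (at [] t i) ≤ h (ρ i)
      below {i} i<k with realised (ρ i)
      ... | π , π∈ , p≡ , q≡ , o≡ , t≡ , h≡ = subst (_ ≤_) (sym h≡) (least≤ (occurrences Q row) (occurrences P row ⊔ occurrences O row) (occurrences Δ row) spectrum π∈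
            (∧⁺ (≤⇒≤ᵇ (bound Q p≡)) (∧⁺ (≤⇒≤ᵇ (⊔-lub (bound P q≡) (bound O o≡))) (≤⇒≤ᵇ (bound Δ t≡)))))
        where
        row = at [] t i
        bound : ∀ κ {m} → N κ (ρ i) ≡ m → occurrences κ (at [] t i) ≤ m
        bound κ eq = ≤-trans (occurrences≤N κ {i} {t} i<k s) (≤-reflexive eq)

  extend-sat : ∀ {k k′ t} (ν : Naming k) (ν′ : Naming k′) → k ≤ k′ →
               (∀ {i} → i < k → Naming.ρ ν′ i ≡ Naming.ρ ν i) → Sat ν t → Sat ν′ t
  extend-sat {t = t} ν ν′ k≤k′ same s = sat λ x y → extend x y (entry t x y) (Sat.holds s x y)
    where
    extend : ∀ x y e → Holds ν x y e → Holds ν′ x y e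
    extend x y unknown _ = tt
    extend x y (kinded κ) (x<k , y<k , p) rewrite same x<k | same y<k = <-≤-trans x<k k≤k′ , <-≤-trans y<k k≤k′ , p
    extend x y (known κ z) (x<k , y<k , z<k , v) rewrite same x<k | same y<k | same z<k =
      <-≤-trans x<k k≤k′ , <-≤-trans y<k k≤k′ , <-≤-trans z<k k≤k′ , v

  -- The bound k ⊔ suc z treats old and fresh names alike, as `each` does.
  record Nameable {k : ℕ} (ν : Naming k) (v : V) : Set where
    field
      z     : ℕ
      z≤k   : z ≤ k
      z<12  : z < 12
      ν′    : Naming (k ⊔ suc z)
      same  : ∀ {i} → i < k → Naming.ρ ν′ i ≡ Naming.ρ ν i
      names : Naming.ρ ν′ z ≡ v

  -- If v is unnamed, then k + 1 different points are at hand, so the fresh name k is below 12.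
  name : ∀ {k} (ν : Naming k) v → Nameable ν v
  name {k} ν@(naming ρ injective) v with any? {n = k} (λ i → ρ (toℕ i) ≟ᶠ v)
  ... | yes (i , eq) = record
    { z = toℕ i ; z≤k = <⇒≤ (toℕ<n i)
    ; z<12 = ≤-trans (toℕ<n i) (injective⇒≤ {f = ρ ∘ toℕ} λ eq → toℕ-injective (injective (toℕ<n _) (toℕ<n _) eq))
    ; ν′ = subst Naming (sym (m≥n⇒m⊔n≡m (toℕ<n i))) ν
    ; same = λ {j} _ → cong (λ f → f j) (ρ-subst (sym (m≥n⇒m⊔n≡m (toℕ<n i))))
    ; names = trans (cong (λ f → f (toℕ i)) (ρ-subst (sym (m≥n⇒m⊔n≡m (toℕ<n i))))) eq
    }
    where
    ρ-subst : ∀ {m} (eq : k ≡ m) → Naming.ρ (subst Naming eq ν) ≡ ρ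
    ρ-subst refl = refl
  ... | no ¬named = record
    { z = k ; z≤k = ≤-refl ; z<12 = injective⇒≤ {f = f} f-inj
    ; ν′ = subst Naming (sym (m≤n⇒m⊔n≡n (n≤1+n k))) ν⁺
    ; same = λ {j} j<k → trans (cong (λ f → f j) (ρ-subst (sym (m≤n⇒m⊔n≡n (n≤1+n k))))) (old j<k)
    ; names = trans (cong (λ f → f k) (ρ-subst (sym (m≤n⇒m⊔n≡n (n≤1+n k))))) new
    }
    where
    ρ⁺ : ℕ → V
    ρ⁺ i = if i ≡ᵇ k then v else ρ i
    new : ρ⁺ k ≡ v
    new with k ≡ᵇ k | ≡⇒≡ᵇ k k refl
    ... | true | _ = refl
    old : ∀ {i} → i < k → ρ⁺ i ≡ ρ i
    old {i} i<k with i ≡ᵇ k in eq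
    ... | true  = contradiction (≡ᵇ⇒≡ i k (subst T (sym eq) tt)) (<⇒≢ i<k)
    ... | false = refl
    fresh : ∀ {i} → i < k → ρ i ≢ v
    fresh {i} i<k eq = ¬named (fromℕ< i<k , trans (cong ρ (toℕ-fromℕ< i<k)) eq)
    ν⁺ : Naming (suc k)
    ν⁺ = naming ρ⁺ λ i<sk j<sk → cmp (m<1+n⇒m<n∨m≡n i<sk) (m<1+n⇒m<n∨m≡n j<sk)
      where
      cmp : ∀ {i j} → i < k ⊎ i ≡ k → j < k ⊎ j ≡ k → ρ⁺ i ≡ ρ⁺ j → i ≡ j
      cmp (inj₁ p) (inj₁ q) eq = injective p q (trans (sym (old p)) (trans eq (old q)))
      cmp (inj₁ p) (inj₂ refl) eq = contradiction (trans (sym (old p)) (trans eq new)) (fresh p)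
      cmp (inj₂ refl) (inj₁ q) eq = contradiction (trans (sym (old q)) (trans (sym eq) new)) (fresh q)
      cmp (inj₂ refl) (inj₂ refl) eq = refl
    f : Fin (suc k) → V
    f = ρ⁺ ∘ toℕ
    f-inj : ∀ {i j} → f i ≡ f j → i ≡ j
    f-inj {i} {j} eq = toℕ-injective (Naming.injective ν⁺ (toℕ<n i) (toℕ<n j) eq)
    ρ-subst : ∀ {m} (eq : suc k ≡ m) → Naming.ρ (subst Naming eq ν⁺) ≡ ρ⁺
    ρ-subst refl = refl

  third-≢ : ∀ {a b} → a ≢ b → op a b ≢ a × op a b ≢ b
  third-≢ a≢b with view a≢b
  ... | vP b = ≢-sym (Val.a≢b (Bip-xz b)) , ≢-sym (Val.a≢b (Bip-yz b))
  ... | vQ b = Val.a≢b (Bip-xy b) , Val.a≢b (Bip-xz b)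
  ... | vO b = ≢-sym (Val.a≢b (Bip-xy b)) , Val.a≢b (Bip-yz b)
  ... | vΔ _ v w = ≢-sym (Val.a≢b v) , ≢-sym (Val.a≢b w)

  private
    kinds : List Kind
    kinds = P ∷ Q ∷ O ∷ Δ ∷ []

    kind∈ : ∀ κ → κ ∈ kinds
    kind∈ P = here refl
    kind∈ Q = there (here refl)
    kind∈ O = there (there (here refl))
    kind∈ Δ = there (there (there (here refl)))

    if-just : ∀ {A : Set} {b} {m : Maybe A} {r} → (if b then m else nothing) ≡ just r → T b × m ≡ just r
    if-just {b = true} eq = tt , eq

    >>=-just : ∀ {A B : Set} (m : Maybe A) {f : A → Maybe B} {r} → (m >>= f) ≡ just r → ∃ λ a → m ≡ just a × f a ≡ just r
    >>=-just (just a) eq = a , refl , eq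

  mutual
    refute-sound : ∀ f {k} t cs {r} → refute f k t cs ≡ just r → (ν : Naming k) → ¬ Sat ν t
    refute-sound zero t cs () ν s
    refute-sound (suc f) t [] () ν s
    refute-sound (suc f) t (c ∷ cs) eq ν s with c <ᵇ 144
    ... | true  = branch-sound f (c / 12) (c % 12) t cs eq ν s
    ... | false = close-sound f ((c ∸ 144) / 12) (c % 12) t cs eq ν s

    attempt-sound : ∀ f {k} m cs {r} → attempt f k m cs ≡ just r → (ν : Naming k) → ¬ Ok ν m
    attempt-sound f {k} (just t) cs eq ν s with heavy k t in hv
    ... | true  = light ν {t} s (subst T (sym hv) tt)
    ... | false = refute-sound f t cs eq ν s

    branch-sound : ∀ f {k} x y t cs {r} → branch f k x y t cs ≡ just r → (ν : Naming k) → ¬ Sat ν t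
    branch-sound f {k} x y t cs eq ν s with if-just eq
    ... | ok , eq′ with ∧⁻ {x <ᵇ k} ok
    ...   | x<ᵇk , ok′ with ∧⁻ {y <ᵇ k} ok′
    ...     | y<ᵇk , x≢ᵇy =
      each-sound f x y t (options k) cs eq′
        (∈-cartesianProduct⁺ (kind∈ (kind (ρ x) (ρ y))) (∈-upTo⁺ (⊓-glb (s≤s (Nameable.z≤k nm)) (Nameable.z<12 nm))))
        (λ eq → proj₁ (third-≢ ρx≢ρy) (trans (sym (Nameable.names nm)) (trans (cong ρ′ eq) (Nameable.same nm x<k))))
        (λ eq → proj₂ (third-≢ ρx≢ρy) (trans (sym (Nameable.names nm)) (trans (cong ρ′ eq) (Nameable.same nm y<k))))
        (Nameable.ν′ nm) learnt
      where
      open Naming ν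
      x<k : x < k
      x<k = <ᵇ⇒< x k x<ᵇk
      y<k : y < k
      y<k = <ᵇ⇒< y k y<ᵇk
      ρx≢ρy : ρ x ≢ ρ y
      ρx≢ρy e = not⁻ x≢ᵇy (≡⇒≡ᵇ x y (injective x<k y<k e))
      nm = name ν (op (ρ x) (ρ y))
      k≤ : k ≤ k ⊔ suc (Nameable.z nm)
      k≤ = m≤m⊔n k _
      ρ′ = Naming.ρ (Nameable.ν′ nm)
      learnt : Ok (Nameable.ν′ nm) (learnAs x y (kind (ρ x) (ρ y)) (Nameable.z nm) t)
      learnt = subst₂ (λ a b → Ok (Nameable.ν′ nm) (learnAs x y (kind a b) (Nameable.z nm) t)) (Nameable.same nm x<k) (Nameable.same nm y<k)
        (learnAs-ok (Nameable.ν′ nm) (<-≤-trans x<k k≤) (<-≤-trans y<k k≤) (m≤n⊔m k _)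
          (subst₂ _≢_ (sym (Nameable.same nm x<k)) (sym (Nameable.same nm y<k)) ρx≢ρy)
          (trans (cong₂ op (Nameable.same nm x<k) (Nameable.same nm y<k)) (sym (Nameable.names nm)))
          (extend-sat {t = t} ν (Nameable.ν′ nm) k≤ (Nameable.same nm) s))

    each-sound : ∀ f {k} x y t os cs {r κ z} → each f k x y t os cs ≡ just r → (κ , z) ∈ os → z ≢ x → z ≢ y →
                 (ν : Naming (k ⊔ suc z)) → ¬ Ok ν (learnAs x y κ z t)
    each-sound f {k} x y t ((κ , z) ∷ os) cs eq (here refl) z≢x z≢y ν ok with z ≡ᵇ x in zx | z ≡ᵇ y in zy
    ... | true | _ = z≢x (≡ᵇ⇒≡ z x (subst T (sym zx) tt))
    ... | false | true = z≢y (≡ᵇ⇒≡ z y (subst T (sym zy) tt))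
    ... | false | false with >>=-just (attempt f (k ⊔ suc z) (learnAs x y κ z t) cs) eq
    ...   | _ , eq′ , _ = attempt-sound f (learnAs x y κ z t) cs eq′ ν ok
    each-sound f {k} x y t ((κ , z) ∷ os) cs eq (there o∈) z≢x z≢y ν ok with (z ≡ᵇ x) ∨ (z ≡ᵇ y)
    ... | true = each-sound f x y t os cs eq o∈ z≢x z≢y ν ok
    ... | false with >>=-just (attempt f (k ⊔ suc z) (learnAs x y κ z t) cs) eq
    ...   | cs′ , _ , eq′ = each-sound f x y t os cs′ eq′ o∈ z≢x z≢y ν ok

    close-sound : ∀ f {k} x y t cs {r} → close f k x y t cs ≡ just r → (ν : Naming k) → ¬ Sat ν t
    close-sound f {k} x y t cs eq ν s with entry t x y | Sat.holds s x y
    ... | known P z | x<k , y<k , z<k , v with entry t z y | Sat.holds s z y | entry t z x | Sat.holds s z x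
    ...   | known P u | _ , _ , u<k , v₁ | known O c | _ , _ , c<k , v₂ with c ≡ᵇ y in cy
    ...     | true = Bip.two-poles b (trans (Val.target v₂) (cong ρ (≡ᵇ⇒≡ c y (subst T (sym cy) tt))))
      where
      open Naming ν
      b : Bip (ρ x) (ρ y) (ρ z)
      b = subst (Bip _ _) (Val.target v) (isP (Val.a≢b v) (Val.kd v))
    ...     | false = attempt-sound f (learnBip u c z t) cs eq ν
            (learnBip-ok ν u<k c<k z<k (subst₂ (λ a d → Bip a d (ρ z)) (Val.target v₁) (Val.target v₂) (Bip-shift b)) s)
      where
      open Naming ν
      b : Bip (ρ x) (ρ y) (ρ z)
      b = subst (Bip _ _) (Val.target v) (isP (Val.a≢b v) (Val.kd v))

  refutes-sound : ∀ {k} m cs → refutes k m cs ≡ true → (ν : Naming k) → ¬ Ok ν m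
  refutes-sound {k} m cs eq ν with attempt 100 k m cs in eq′
  ... | just _ = attempt-sound 100 m cs eq′ ν

-- Order 12

long-refuted : Refuter.refutes spectrum 6 longCycle longCycleCodes ≡ true
long-refuted = refl

triangle-refuted : Refuter.refutes spectrum₃ 5 triangle triangleCodes ≡ true
triangle-refuted = refl

memberᵇ : ℕ × ℕ × ℕ → Spectrum → Bool
memberᵇ _ [] = false
memberᵇ π@(p , a , b) ((p′ , a′ , b′) ∷ σ) = ((p ≡ᵇ p′) ∧ (a ≡ᵇ a′) ∧ (b ≡ᵇ b′)) ∨ memberᵇ π σ

memberᵇ⁻ : ∀ {π} σ → T (memberᵇ π σ) → π ∈ σ
memberᵇ⁻ {p , a , b} ((p′ , a′ , b′) ∷ σ) m with Equivalence.to (T-∨ {(p ≡ᵇ p′) ∧ (a ≡ᵇ a′) ∧ (b ≡ᵇ b′)}) m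
... | inj₂ m′ = there (memberᵇ⁻ σ m′)
... | inj₁ e with ∧⁻ {p ≡ᵇ p′} e
...   | e₁ , e′ with ∧⁻ {a ≡ᵇ a′} e′
...     | e₂ , e₃ = here (cong₂ _,_ (≡ᵇ⇒≡ p p′ e₁) (cong₂ _,_ (≡ᵇ⇒≡ a a′ e₂) (≡ᵇ⇒≡ b b′ e₃)))

at-injective : ∀ {A : Set} (d : A) {xs} → Unique xs → ∀ {i j} → i < length xs → j < length xs → at d xs i ≡ at d xs j → i ≡ j
at-injective d (_ ∷ _) {zero} {zero} _ _ _ = refl
at-injective d (x∉ ∷ _) {zero} {suc j} _ j< eq = contradiction eq (apart x∉ (s<s⁻¹ j<))
  where
  apart : ∀ {x xs} → All (x ≢_) xs → ∀ {j} → j < length xs → x ≢ at d xs j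
  apart (x≢ ∷ _)  {zero}  _ = x≢
  apart (_ ∷ x∉) {suc j} j< = apart x∉ (s<s⁻¹ j<)
at-injective d (x∉ ∷ u) {suc i} {zero} i< j< eq = sym (at-injective d (x∉ ∷ u) j< i< (sym eq))
at-injective d (_ ∷ u) {suc i} {suc j} i< j< eq = cong suc (at-injective d u (s<s⁻¹ i<) (s<s⁻¹ j<) eq)

lt : ∀ {i k} {_ : T (i <ᵇ k)} → i < k
lt {i} {k} {p} = <ᵇ⇒< i k p

module Twelve (S : System (Fin 12) ∅) where
  open Kinds S
  open EvenOrder S

  private
    h : V → ℕ
    h y = weight y ∸ 9

    h+9 : ∀ y → h y + 9 ≡ weight y
    h+9 y = m∸n+n≡m (subst₂ (λ p t → 9 ≤ 3 * p + t) (sym p≡) (sym b≡)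
      (≤ᵇ⇒≤ 9 _ (profiles⁻ (λ p a b → 9 ≤ᵇ 3 * p + 2 * b) tt (profile y))))
      where open Profile (profile y)

    ∑weight : sum weight ≡ 132
    ∑weight = +-cancelʳ-≡ 12 _ _ ∑-weight

    ∑h : sum h ≤ 24
    ∑h = ≤-reflexive (+-cancelʳ-≡ 108 _ _ (trans (sym (∑-distrib-+ h (λ _ → 9))) (trans (sum-cong-≗ h+9) ∑weight)))

    realise : ∀ {σ y} (π : Profile y) → (Profile.p π , Profile.a π , Profile.b π) ∈ σ → Realised S h σ y
    realise {y = y} π π∈ = _ , π∈ , p≡ , a≡ , trans (N-O≡P y) a≡ , b≡ , cong₂ (λ p t → 3 * p + t ∸ 9) p≡ b≡
      where open Profile π

    realised : ∀ y → Realised S h spectrum y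
    realised y = realise (profile y) (memberᵇ⁻ spectrum (profiles⁻ (λ p a b → memberᵇ (p , a , b) spectrum) tt (profile y)))

    module Long = Soundness S spectrum h ∑h realised

    -- If the rim is not closed after three steps, its first four points and the two poles are six
    -- different points in the configuration `longCycle`.
    no-long : ∀ {x y} → x ≢ y → kind x y ≡ P → op (op (op x y) y) y ≡ x
    no-long {x} {y} x≢y k = decidable-stable (op (op (op x y) y) y ≟ᶠ x) λ x₃≢x →
      Long.refutes-sound longCycle longCycleCodes long-refuted (ν x₃≢x) (ok x₃≢x)
      where
      x₁ = op x y
      x₂ = op x₁ y
      x₃ = op x₂ y
      c = op x₁ x
      p₀ : Bip x y x₁
      p₀ = isP x≢y k
      p₁ : Bip x₁ y x₂
      p₁ = Bip-next p₀
      p₂ : Bip x₂ y x₃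
      p₂ = Bip-next p₁
      q₀ : Bip x₁ c x
      q₀ = Bip-back p₀
      q₁ : Bip x₂ c x₁
      q₁ = Bip-shift p₀
      q₂ : Bip x₃ c x₂
      q₂ = subst (λ v → Bip x₃ v x₂) (Val.target (Bip-xz q₁)) (Bip-shift p₁)
      y≢c : y ≢ c
      y≢c = ≢-sym (Bip.two-poles p₀)
      -- Otherwise ⟨ x₁ , y , x ⟩ and ⟨ x₁ , c , x ⟩ share a pair and y = c.
      x≢x₂ : x ≢ x₂
      x≢x₂ eq = y≢c (trans (sym (Val.target (Bip-xz p₁))) (cong (op x₁) (sym eq)))
      x₁≢x₃ : x₁ ≢ x₃
      x₁≢x₃ eq = y≢c (trans (sym (Val.target (Bip-xz p₂))) (trans (cong (op x₂) (sym eq)) (Val.target (Bip-xz q₁))))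
      names : List V
      names = y ∷ c ∷ x ∷ x₁ ∷ x₂ ∷ x₃ ∷ []
      module _ (x₃≢x : x₃ ≢ x) where
        unique : Unique names
        unique =
          (y≢c ∷ ≢-sym x≢y ∷ Val.a≢b (Bip-yz p₀) ∷ Val.a≢b (Bip-yz p₁) ∷ Val.a≢b (Bip-yz p₂) ∷ []) ∷
          (Val.a≢b (Bip-yz q₀) ∷ Val.a≢b (Bip-yz q₁) ∷ Val.a≢b (Bip-yz q₂) ∷ ≢-sym (Val.a≢b (Bip-xy q₂)) ∷ []) ∷
          (Val.a≢b (Bip-xz p₀) ∷ x≢x₂ ∷ ≢-sym x₃≢x ∷ []) ∷
          (Val.a≢b (Bip-xz p₁) ∷ x₁≢x₃ ∷ []) ∷
          (Val.a≢b (Bip-xz p₂) ∷ []) ∷ [] ∷ []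
        ν : Long.Naming 6
        ν = Long.naming (at y names) (at-injective y unique)
        ok : Long.Ok ν longCycle
        ok = Long.longCycle-ok ν lt lt lt lt lt lt p₀ p₁ p₂ q₀ q₁ q₂

    p%3 : ∀ {y} (π : Profile y) → T (Profile.p π % 3 ≡ᵇ 0)
    p%3 {y} π = ≡⇒≡ᵇ (p % 3) 0 (trans (cong (_% 3) (trans (sym p≡) (trans (proj₂ k) (*-comm 3 (proj₁ k))))) (m*n%n≡0 (proj₁ k) 3))
      where
      open Profile π
      k : ∃ λ k → N Q y ≡ 3 * k
      k = N-Q-triple no-long y

    profiles₃ : ∀ (C : ℕ → ℕ → ℕ → Bool) → T (profiles λ p a b → not (p % 3 ≡ᵇ 0) ∨ C p a b) →
                ∀ {y} (π : Profile y) → T (C (Profile.p π) (Profile.a π) (Profile.b π))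
    profiles₃ C ok π with Equivalence.to (T-∨ {not _}) (profiles⁻ (λ p a b → not (p % 3 ≡ᵇ 0) ∨ C p a b) ok π)
    ... | inj₁ ¬p = contradiction (p%3 π) (not⁻ ¬p)
    ... | inj₂ c  = c

    realised₃ : ∀ y → Realised S h spectrum₃ y
    realised₃ y = realise (profile y)
      (memberᵇ⁻ spectrum₃ (profiles₃ (λ p a b → memberᵇ (p , a , b) spectrum₃) tt (profile y)))

    module Triangle = Soundness S spectrum₃ h ∑h realised₃

    no-triangle : ∀ {y x} → ¬ T (select Δ y x)
    no-triangle {y} {x} s = Triangle.refutes-sound triangle triangleCodes triangle-refuted ν ok
      where
      z = op y x
      y≢x = proj₁ (select⁻ {Δ} s)
      Δs = isΔ y≢x (proj₂ (select⁻ {Δ} s))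
      v₁ = proj₁ Δs
      v₂ = proj₁ (proj₂ Δs)
      v₃ = proj₂ (proj₂ Δs)
      -- p is odd, hence positive, so y is the pole of some bipyramid. Its rim is disjoint from the
      -- triangle because the kinds Q and Δ differ.
      pole : ∃ λ x′ → y ≢ x′ × kind y x′ ≡ Q
      pole = ∃Q (subst (1 ≤_) (sym (Profile.p≡ (profile y)))
        (≤ᵇ⇒≤ 1 _ (profiles₃ (λ p _ _ → 1 ≤ᵇ p) tt (profile y))))
      x′ = proj₁ pole
      u = op x′ y
      b : Bip x′ y u
      b = Bip-next (isQ (proj₁ (proj₂ pole)) (proj₂ (proj₂ pole)))
      apart : ∀ {i j κ μ} → kind y i ≡ κ → kind y j ≡ μ → κ ≢ μ → i ≢ j
      apart p q κ≢μ refl = κ≢μ (trans (sym p) q)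
      yx′ = proj₂ (proj₂ pole)
      yu  = Val.kd (Bip-yz b)
      names : List V
      names = y ∷ x ∷ z ∷ x′ ∷ u ∷ []
      unique : Unique names
      unique =
        (y≢x ∷ Val.a≢b v₂ ∷ proj₁ (proj₂ pole) ∷ Val.a≢b (Bip-yz b) ∷ []) ∷
        (Val.a≢b v₃ ∷ apart (Val.kd v₁) yx′ (λ ()) ∷ apart (Val.kd v₁) yu (λ ()) ∷ []) ∷
        (apart (Val.kd v₂) yx′ (λ ()) ∷ apart (Val.kd v₂) yu (λ ()) ∷ []) ∷
        (Val.a≢b (Bip-xz b) ∷ []) ∷ [] ∷ []
      ν : Triangle.Naming 5
      ν = Triangle.naming (at y names) (at-injective y unique)
      ok : Triangle.Ok ν triangle
      ok = Triangle.triangle-ok ν lt lt lt lt lt v₁ v₂ v₃ b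

  impossible : ⊥
  impossible = n≮n 108 (≤-trans (m≤m+n 109 23) (subst (_≤ 108) ∑weight
    (subst (sum weight ≤_) (∑-const 12 9) (sum-inject weight (λ _ → 9) (λ y → y) light₉ (λ _ _ eq → eq)))))
    where
    -- Without triangles b = 0, and p + 4 a = 11 with p divisible by 3 leaves only p = 3. The total
    -- is then at most 108 instead of 132.
    light₉ : ∀ y → weight y ≤ 9
    light₉ y = subst₂ (λ p t → 3 * p + t ≤ 9) (sym p≡) (sym b≡) (≤ᵇ⇒≤ _ 9 (small (Equivalence.to (T-∨ {not _})
        (profiles₃ (λ p a b → not (b ≡ᵇ 0) ∨ (3 * p + 2 * b ≤ᵇ 9)) tt (profile y)))))
      where
      open Profile (profile y)
      none : ¬ 0 < N Δ y
      none 1≤N = no-triangle (proj₂ (count-witness (select Δ y) 1≤N))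
      b≡0 : b ≡ 0
      b≡0 = m+n≡0⇒m≡0 b (trans (sym b≡) (n≤0⇒n≡0 (≮⇒≥ none)))
      small : T (not (b ≡ᵇ 0)) ⊎ T (3 * p + 2 * b ≤ᵇ 9) → T (3 * p + 2 * b ≤ᵇ 9)
      small (inj₁ ¬b) = contradiction (≡⇒≡ᵇ b 0 b≡0) (not⁻ ¬b)
      small (inj₂ t)  = t

no-12 : ¬ System (Fin 12) ∅
no-12 S = Twelve.impossible S

-- Both directions combined

necessity : ∀ n → FlexibleLDTS n → (n % 3 ≡ 0 ⊎ n % 3 ≡ 1) × n ∉ 4 ∷ 6 ∷ 10 ∷ 12 ∷ []
necessity n (D , latin , flexible) = residue (mod₃ n) S , excluded S
  where
  S : System (Fin n) ∅
  S = FromLDTS.system D latin flexible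

  residue : ∀ {n} → Mod₃ n → System (Fin n) ∅ → n % 3 ≡ 0 ⊎ n % 3 ≡ 1
  residue (+0 v) _ = inj₁ (m*n%n≡0 v 3)
  residue (+1 v) _ = inj₂ ([m+kn]%n≡m%n 1 v 3)
  residue (+2 v) S = contradiction refl (ModThree.n%3≢2 S v)

  excluded : ∀ {n} → System (Fin n) ∅ → n ∉ 4 ∷ 6 ∷ 10 ∷ 12 ∷ []
  excluded S (here refl) = no-4 S
  excluded S (there (here refl)) = no-6 S
  excluded S (there (there (here refl))) = no-10 S
  excluded S (there (there (there (here refl)))) = no-12 S

theorem4p7 : (n : ℕ) .{{_ : NonZero n}} →
    FlexibleLDTS n ⇔
    ((n % 3 ≡ 0 ⊎ n % 3 ≡ 1) × n ∉ (4 ∷ 6 ∷ 10 ∷ 12 ∷ []))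
theorem4p7 n = mk⇔ (necessity n) (λ (residue , n∉) → existence n residue n∉)
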